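{- For any positive integer $t$ and for any prime $p>t$, $$\frac{H_{p-1}^q(\{3\}^t)}{(1-q)^{3t}}\equiv\frac{1}{(t+1)p^2}\left(\binom{p+2t+1}{3t+2}+\binom{ -p+2t+1}{3t+2}\right)\pmod{[p]_q}.$$
   Context: Here $q$ is an indeterminate and $[n]_q=\frac{1-q^n}{1-q}=1+q+\cdots+q^{n-1}$. For positive integers $s_1,\dots,s_l$, $$H_n^q(s_1,\ldots,s_l)=\sum_{1\le k_1<\cdots<k_l\le n}\prod_{i=1}^l\frac{q^{(s_i-1)k_i}}{[k_i]_q^{s_i}}.$$ $\{s\}^t$ denotes $t$ consecutive copies of $s$. Binomial coefficients with arbitrary (possibly negative) upper entry are $\binom{\alpha}{k}=\frac{\alpha(\alpha-1)\cdots(\alpha-k+1)}{k!}$. For a prime $p$ and rational functions $A,B$ in $q$, $A\equiv B\pmod{[p]_q}$ means $A-B=f/g$ with $f,g$ polynomials in $q$ with integer coefficients, $g$ coprime to $[p]_q$ in $\mathbb{Q}[q]$, and $[p]_q\mid f$ ($[p]_q$ is the $p$th cyclotomic polynomial, irreducible over $\mathbb{Q}$). -}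

module Defs where

open import Algebra.Bundles.Raw using (RawRing)
import Algebra.Definitions.RawSemiring as RawSemiringDefinitions
open import Data.Fin.Base using (Fin; toℕ)
import Data.Fin.Properties as Fin
open import Data.Integer.Base as ℤ using (ℤ; +_)
open import Data.List.Base as List using (List; []; _∷_; allFin; cartesianProductWith; filter)
open import Data.Nat.Base as ℕ using (ℕ; zero; suc; _!)
open import Data.Nat.Properties using (_!≢0)
open import Data.Product.Base using (Σ-syntax; ∃-syntax; _×_)
open import Data.Rational.Base as ℚ using (ℚ; 0ℚ; 1ℚ)
import Data.Rational.Properties as ℚ
open import Data.Sum.Base using (_⊎_; inj₁; inj₂; [_,_])
open import Data.Vec.Base as Vec using (Vec)
open import Data.Vec.Relation.Unary.Linked using (linked?)
open import Level using (0ℓ)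
open import Relation.Binary.PropositionalEquality
open import Relation.Nullary using (¬_; yes; no)

-- Univariate polynomials in q, as coefficient lists with the constant
-- coefficient first.  Trailing zeros are allowed, so polynomials are
-- compared by _≈_ and not by _≡_.

module Polynomial (R : RawRing 0ℓ 0ℓ) where

  private module R = RawRing R

  Poly : Set
  Poly = List R.Carrier

  coeff : Poly → ℕ → R.Carrier
  coeff []      _       = R.0#
  coeff (a ∷ f) zero    = a
  coeff (a ∷ f) (suc n) = coeff f n

  infix 4 _≈_

  record _≈_ (f g : Poly) : Set where
    constructor mk≈
    field coeff-≈ : ∀ n → coeff f n R.≈ coeff g n

  open _≈_ public

  infixl 6 _+_ _-_
  infixl 7 _*_

  _+_ : Poly → Poly → Poly
  []      + g       = g
  (a ∷ f) + []      = a ∷ f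
  (a ∷ f) + (b ∷ g) = a R.+ b ∷ f + g

  -_ : Poly → Poly
  - f = List.map R.-_ f

  _-_ : Poly → Poly → Poly
  f - g = f + (- g)

  _*_ : Poly → Poly → Poly
  []      * g = []
  (a ∷ f) * g = List.map (a R.*_) g + (R.0# ∷ f * g)

  0ₚ 1ₚ q : Poly
  0ₚ = []
  1ₚ = R.1# ∷ []
  q  = R.0# ∷ R.1# ∷ []

  rawRing : RawRing 0ℓ 0ℓ
  rawRing = record
    { Carrier = Poly
    ; _≈_     = _≈_
    ; _+_     = _+_
    ; _*_     = _*_
    ; -_      = -_
    ; 0#      = 0ₚ
    ; 1#      = 1ₚ
    }

  open RawSemiringDefinitions (RawRing.rawSemiring rawRing) public
    using (_^_; _∣_; Coprime)

  -- [ n ]q = 1 + q + ⋯ + q ^ (n - 1)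
  [_]q : ℕ → Poly
  [ n ]q = List.replicate n R.1#

  record NonZero (f : Poly) : Set where
    constructor mkNonZero
    field ≉0 : ¬ (f ≈ 0ₚ)

module ℤ[q] = Polynomial ℤ.+-*-rawRing
module ℚ[q] = Polynomial ℚ.+-*-rawRing

ι : ℤ[q].Poly → ℚ[q].Poly
ι = List.map (ℚ._/ 1)

-- ℚ[q] is an integral domain.

module _ where
  open ℚ[q]

  private
    x*y≡0⇒y≡0 : ∀ x y → x ≢ 0ℚ → x ℚ.* y ≡ 0ℚ → y ≡ 0ℚ
    x*y≡0⇒y≡0 x y x≢0 xy≡0 = begin
      y                      ≡⟨ ℚ.*-identityˡ y ⟨
      1ℚ ℚ.* y               ≡⟨ cong (ℚ._* y) (ℚ.*-inverseˡ x) ⟨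
      (ℚ.1/ x) ℚ.* x ℚ.* y   ≡⟨ ℚ.*-assoc (ℚ.1/ x) x y ⟩
      (ℚ.1/ x) ℚ.* (x ℚ.* y) ≡⟨ cong ((ℚ.1/ x) ℚ.*_) xy≡0 ⟩
      (ℚ.1/ x) ℚ.* 0ℚ        ≡⟨ ℚ.*-zeroʳ (ℚ.1/ x) ⟩
      0ℚ                     ∎
      where
      open ≡-Reasoning
      instance _ = ℚ.≢-nonZero x≢0

  coeff-+ : ∀ f g n → coeff (f + g) n ≡ coeff f n ℚ.+ coeff g n
  coeff-+ []      g       n       = sym (ℚ.+-identityˡ (coeff g n))
  coeff-+ (a ∷ f) []      n       = sym (ℚ.+-identityʳ (coeff (a ∷ f) n))
  coeff-+ (a ∷ f) (b ∷ g) zero    = refl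
  coeff-+ (a ∷ f) (b ∷ g) (suc n) = coeff-+ f g n

  coeff-map* : ∀ a f n → coeff (List.map (a ℚ.*_) f) n ≡ a ℚ.* coeff f n
  coeff-map* a []      n       = sym (ℚ.*-zeroʳ a)
  coeff-map* a (b ∷ f) zero    = refl
  coeff-map* a (b ∷ f) (suc n) = coeff-map* a f n

  coeff-∷* : ∀ a f g n →
             coeff ((a ∷ f) * g) n ≡ a ℚ.* coeff g n ℚ.+ coeff (0ℚ ∷ f * g) n
  coeff-∷* a f g n = trans
    (coeff-+ (List.map (a ℚ.*_) g) (0ℚ ∷ f * g) n)
    (cong (ℚ._+ coeff (0ℚ ∷ f * g) n) (coeff-map* a g n))

  coeff-*0∷ : ∀ f g n → coeff (f * (0ℚ ∷ g)) n ≡ coeff (0ℚ ∷ f * g) n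
  coeff-*0∷ []      g zero    = refl
  coeff-*0∷ []      g (suc n) = refl
  coeff-*0∷ (a ∷ f) g zero    = trans (coeff-∷* a f (0ℚ ∷ g) zero)
    (trans (ℚ.+-identityʳ (a ℚ.* 0ℚ)) (ℚ.*-zeroʳ a))
  coeff-*0∷ (a ∷ f) g (suc n) = trans (coeff-∷* a f (0ℚ ∷ g) (suc n))
    (trans (cong (a ℚ.* coeff g n ℚ.+_) (coeff-*0∷ f g n)) (sym (coeff-∷* a f g n)))

  private
    cancel-∷ : ∀ a f g → a ≢ 0ℚ → (a ∷ f) * g ≈ 0ₚ → g ≈ 0ₚ
    cancel-∷ a f []      a≢0 eq = mk≈ λ _ → refl
    cancel-∷ a f (b ∷ g) a≢0 eq
      with refl ← x*y≡0⇒y≡0 a b a≢0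
             (trans (sym (trans (coeff-∷* a f (b ∷ g) 0) (ℚ.+-identityʳ (a ℚ.* b))))
                    (coeff-≈ eq 0)) = mk≈ λ where
        zero    → refl
        (suc n) → coeff-≈ g≈0 n
      where
      g≈0 : g ≈ 0ₚ
      g≈0 = cancel-∷ a f g a≢0 (mk≈ λ n →
        trans (sym (coeff-*0∷ (a ∷ f) g (suc n))) (coeff-≈ eq (suc n)))

  *-integral : ∀ f g → f * g ≈ 0ₚ → f ≈ 0ₚ ⊎ g ≈ 0ₚ
  *-integral []      g eq = inj₁ (mk≈ λ _ → refl)
  *-integral (a ∷ f) g eq with a ℚ.≟ 0ℚ
  ... | no  a≢0  = inj₂ (cancel-∷ a f g a≢0 eq)
  ... | yes refl with *-integral f g (mk≈ λ n →
          trans (sym (trans (coeff-∷* 0ℚ f g (suc n))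
                  (trans (cong (ℚ._+ coeff (f * g) n) (ℚ.*-zeroˡ (coeff g (suc n))))
                         (ℚ.+-identityˡ (coeff (f * g) n)))))
                (coeff-≈ eq (suc n)))
  ...   | inj₂ g≈0 = inj₂ g≈0
  ...   | inj₁ f≈0 = inj₁ (mk≈ λ where
            zero    → refl
            (suc n) → coeff-≈ f≈0 n)

  *-nonZero : ∀ f g → {{NonZero f}} → {{NonZero g}} → NonZero (f * g)
  *-nonZero f g {{mkNonZero f≉0}} {{mkNonZero g≉0}} =
    mkNonZero λ fg≈0 → [ f≉0 , g≉0 ] (*-integral f g fg≈0)

  ^-nonZero : ∀ f n → {{NonZero f}} → NonZero (f ^ n)
  ^-nonZero f zero    = mkNonZero λ eq → ℚ.1≢0 (coeff-≈ eq 0)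
  ^-nonZero f (suc n) {{f≉0}} = *-nonZero f (f ^ n) {{f≉0}} {{^-nonZero f n}}

  instance
    1-nonZero : NonZero 1ₚ
    1-nonZero = mkNonZero λ eq → ℚ.1≢0 (coeff-≈ eq 0)

    1-q-nonZero : NonZero (1ₚ - q)
    1-q-nonZero = mkNonZero λ eq → ℚ.1≢0 (coeff-≈ eq 0)

    [suc]q-nonZero : ∀ {n} → NonZero [ suc n ]q
    [suc]q-nonZero = mkNonZero λ eq → ℚ.1≢0 (coeff-≈ eq 0)

-- The field ℚ(q), as unreduced fractions compared by cross-multiplication.

module ℚ⟨q⟩ where

  private module P = ℚ[q]

  infix 8 _/_

  record RatFun : Set where
    constructor _/_
    field
      num       : P.Poly
      den       : P.Poly
      {{den≉0}} : P.NonZero den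

  infix  4 _≈_
  infixl 6 _+_ _-_
  infixl 7 _*_ _÷_

  _≈_ : RatFun → RatFun → Set
  (f₁ / g₁) ≈ (f₂ / g₂) = f₁ P.* g₂ P.≈ f₂ P.* g₁

  _+_ _-_ _*_ : RatFun → RatFun → RatFun
  (f₁ / g₁) + (f₂ / g₂) =
    _/_ (f₁ P.* g₂ P.+ f₂ P.* g₁) (g₁ P.* g₂) {{*-nonZero g₁ g₂}}
  (f₁ / g₁) - (f₂ / g₂) =
    _/_ (f₁ P.* g₂ P.- f₂ P.* g₁) (g₁ P.* g₂) {{*-nonZero g₁ g₂}}
  (f₁ / g₁) * (f₂ / g₂) =
    _/_ (f₁ P.* f₂) (g₁ P.* g₂) {{*-nonZero g₁ g₂}}

  _÷_ : RatFun → (h : P.Poly) → {{P.NonZero h}} → RatFun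
  (f / g) ÷ h = _/_ f (g P.* h) {{*-nonZero g h}}

  0ᵣ 1ᵣ : RatFun
  0ᵣ = P.0ₚ / P.1ₚ
  1ᵣ = P.1ₚ / P.1ₚ

  const : ℚ → RatFun
  const c = (c ∷ []) / P.1ₚ

open ℚ⟨q⟩ using (RatFun; _/_)

-- A ≡ B mod[ m ]: A - B = f / g with f, g ∈ ℤ[q], g coprime to m in ℚ[q]
-- and m ∣ f in ℤ[q].

infix 4 _≡_mod[_]

_≡_mod[_] : RatFun → RatFun → ℤ[q].Poly → Set
A ≡ B mod[ m ] =
  ∃[ f ] ∃[ g ] Σ[ g≉0 ∈ ℚ[q].NonZero (ι g) ]
    ((A ℚ⟨q⟩.- B) ℚ⟨q⟩.≈ (ι f / ι g) {{g≉0}}) ×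
    ℚ[q].Coprime (ι g) (ι m) ×
    m ℤ[q].∣ f

-- The element i of Fin n stands for the summation index k = i + 1, so that
-- k runs over 1, …, n.

tuples : ∀ n l → List (Vec (Fin n) l)
tuples n zero    = Vec.[] ∷ []
tuples n (suc l) = cartesianProductWith Vec._∷_ (allFin n) (tuples n l)

increasingTuples : ∀ n l → List (Vec (Fin n) l)
increasingTuples n l = filter (linked? Fin._<?_) (tuples n l)

1-q : ℚ[q].Poly
1-q = ℚ[q].1ₚ ℚ[q].- ℚ[q].q

-- q ^ ((s - 1) k) / [ k ]q ^ s, for s ≥ 1.
term : ∀ {n} → ℕ → Fin n → RatFun
term s i = _/_ (q ^ ((s ℕ.∸ 1) ℕ.* k)) ([ k ]q ^ s) {{^-nonZero [ k ]q s}}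
  where
  open ℚ[q]
  k = suc (toℕ i)

-- H n (s₁, …, s_l); the exponents s_i are meant to be positive.
H : ∀ (n : ℕ) {l} → Vec ℕ l → RatFun
H n {l} s = List.foldr ℚ⟨q⟩._+_ ℚ⟨q⟩.0ᵣ
  (List.map (λ k → Vec.foldr′ ℚ⟨q⟩._*_ ℚ⟨q⟩.1ᵣ (Vec.zipWith term s k))
            (increasingTuples n l))

-- α (α - 1) ⋯ (α - k + 1)
falling : ℚ → ℕ → ℚ
falling α zero    = 1ℚ
falling α (suc k) = falling α k ℚ.* (α ℚ.- (+ k ℚ./ 1))

binom : ℚ → ℕ → ℚ
binom α k = falling α k ℚ.* (+ 1 ℚ./ k !) {{k !≢0}}

-- Modulo [p]_q, write ω for the class of q: every 1 - ωᵏ with p ∤ k is a unit and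
-- ∏_{0<k<p} (X - ωᵏ) = 1 + X + ⋯ + X^{p-1}.  The left-hand side is the elementary
-- symmetric function e_t of ω^{2k} / (1 - ωᵏ)³, 0 < k < p, and its generating
-- function satisfies
--   p³ Σ_t e_t yᵗ = ∏_{0<k<p} ((1 - ωᵏ)³ + y ω^{2k}).
-- If a, b, c are the roots of (X - 1)³ = y X², then abc = 1 and multiplying by
-- y = (a - 1)(b - 1)(c - 1) turns the right-hand side into
--   (aᵖ - 1)(bᵖ - 1)(cᵖ - 1) = (aᵖ + bᵖ + cᵖ) - (a⁻ᵖ + b⁻ᵖ + c⁻ᵖ).
-- For every integer n the power sum aⁿ + bⁿ + cⁿ has the coefficient
-- n / s · binom (n + 2 s - 1) (3 s - 1) at yˢ for s > 0, as both satisfy the same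
-- recurrence in n.  The cubic splits over ℚ for infinitely many rational y, so the
-- coefficients can be compared by interpolation without adjoining its roots.

module Submission where

open import Defs
open import Algebra.Bundles using (CommutativeRing)
import Algebra.Properties.CommutativeSemigroup
import Algebra.Properties.CommutativeSemiring.Exp
import Algebra.Properties.Ring
import Algebra.Properties.Semiring.Exp
import Algebra.Properties.Semiring.Mult
import Algebra.Properties.Semiring.Mult.TCOptimised
import Algebra.Solver.Ring
open import Algebra.Solver.Ring.AlmostCommutativeRing using (_-Raw-AlmostCommutative⟶_; fromCommutativeRing)
open import Data.Bool.Base using (Bool; true; false; if_then_else_; _∧_)
open import Data.Fin.Base as Fin using (Fin; zero; suc; toℕ)
import Data.Fin.Properties as Fin
open import Data.Integer.Base as ℤ using (ℤ; +_; -[1+_])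
import Data.Integer.Properties as ℤ
import Data.Integer.Tactic.RingSolver as ℤSolver
open import Data.List.Base as List using (List; []; _∷_; _++_; allFin; tabulate; filter; cartesianProductWith)
open import Data.List.Properties using (map-tabulate; map-replicate; map-∘; map-cong)
open import Data.Maybe.Base using (map)
open import Data.Nat.Base as ℕ using (ℕ; zero; suc; NonZero; _≤_; _<_; s≤s; z≤n; s<s; z<s; _∸_; _!)
open import Data.Nat.Coprimality using (coprime-Bézout; prime⇒coprime)
open import Data.Nat.GCD using (module Bézout)
open import Data.Nat.Primality using (Prime; prime⇒nonZero)
import Data.Nat.Properties as ℕ
open import Data.Nat.Properties using (m*n≢0; m^n≢0)
import Data.Nat.Tactic.RingSolver as ℕSolver
open import Data.Product.Base using (_,_; ∃-syntax; Σ-syntax; proj₁; proj₂)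
open import Data.Rational.Base as ℚ using (ℚ; 0ℚ; 1ℚ; toℚᵘ)
import Data.Rational.Properties as ℚ
open import Data.Rational.Unnormalised.Base as ℚᵘ using (mkℚᵘ; *≡*; _≃_)
import Data.Rational.Unnormalised.Properties as ℚᵘ
open import Data.Sum.Base using (inj₁; inj₂)
open import Data.Vec.Base as Vec using (Vec; []; _∷_; replicate)
open import Data.Vec.Relation.Unary.Linked using (linked?)
open import Function.Base using (_∘_)
open import Level using (0ℓ)
import Relation.Binary.PropositionalEquality as ≡
open import Relation.Binary.Bundles using (Setoid)
open import Relation.Binary.Structures using (IsEquivalence)
open import Relation.Nullary.Decidable using (does; dec⇒maybe)
open import Relation.Unary using (Pred; Decidable)
open ≡ using (_≡_)
open ℚ⟨q⟩ using (RatFun; _/_)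

-- The congruence becomes an equality in ℚ[q] modulo [p]_q, presented as polynomials with a coarser
-- equality. The argument itself is carried out in any commutative ring with invertible positive
-- integers. Cancellation there rests on explicit inverses, and these come from integers: 1 - ω
-- divides p, Bézout passes from 1 - ω to 1 - ωᵏ, and differences of interpolation points become
-- nonzero integers after multiplication by integers. The split cubics come from the identity x³ +
-- v³ + w³ = 3xvw for x + v + w = 0: it says that x²/(vw), v²/(wx), w²/(xv), whose product is 1,
-- have sum 3. Taking them as ab, bc, ca for (x, v, w) = (-V, -1, V + 1) meets both conditions that
-- do not involve y and leaves V free, so there are enough points. Power sums with exponent p and -p
-- have degree at most p in y, so p + 1 points determine every coefficient up to yᵖ. The sum e_t
-- sits at the power t + 1 of y, which is within reach exactly for t < p.

module IntegerSolver (R : CommutativeRing 0ℓ 0ℓ) where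

  open CommutativeRing R
  open Algebra.Properties.Ring ring
  open Algebra.Properties.Semiring.Mult.TCOptimised semiring using (_×_; 1+×; ×-homo-+; ×1-homo-*)
  open import Relation.Binary.Reasoning.Setoid setoid

  private

    -- The solver needs coefficients with decidable equality, hence integers. The multiples are the
    -- optimised ones, with 1 × x = x, so that `#1` and `#3` denote exactly `1#` and `1# + 1# + 1#`.
    ⟦_⟧ : ℤ → Carrier
    ⟦ + n ⟧      = n × 1#
    ⟦ -[1+ n ] ⟧ = - (suc n × 1#)

    cancel : ∀ x y z → x + y - (x + z) ≈ y - z
    cancel x y z = begin
      x + y - (x + z)     ≈⟨ +-congˡ (-‿+-comm x z) ⟨
      x + y + (- x - z)   ≈⟨ +-congʳ (+-comm x y) ⟩
      y + x + (- x - z)   ≈⟨ +-assoc y x _ ⟩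
      y + (x + (- x - z)) ≈⟨ +-congˡ (+-assoc x (- x) (- z)) ⟨
      y + (x - x - z)     ≈⟨ +-congˡ (+-congʳ (-‿inverseʳ x)) ⟩
      y + (0# - z)        ≈⟨ +-congˡ (+-identityˡ (- z)) ⟩
      y - z               ∎

    ⊖-homo : ∀ m n → ⟦ m ℤ.⊖ n ⟧ ≈ m × 1# - n × 1#
    ⊖-homo m zero = begin
      m × 1#      ≈⟨ +-identityʳ _ ⟨
      m × 1# + 0# ≈⟨ +-congˡ -0#≈0# ⟨
      m × 1# - 0# ∎
    ⊖-homo zero (suc n) = sym (+-identityˡ _)
    ⊖-homo (suc m) (suc n) = begin
      ⟦ suc m ℤ.⊖ suc n ⟧     ≡⟨ ≡.cong ⟦_⟧ (ℤ.[1+m]⊖[1+n]≡m⊖n m n) ⟩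
      ⟦ m ℤ.⊖ n ⟧             ≈⟨ ⊖-homo m n ⟩
      m × 1# - n × 1#         ≈⟨ cancel 1# _ _ ⟨
      1# + m × 1# - (1# + n × 1#) ≈⟨ +-cong (1+× m 1#) (-‿cong (1+× n 1#)) ⟨
      suc m × 1# - suc n × 1# ∎

    -‿homo : ∀ i → ⟦ ℤ.- i ⟧ ≈ - ⟦ i ⟧
    -‿homo (+ zero)   = sym -0#≈0#
    -‿homo (+ suc n)  = refl
    -‿homo (-[1+ n ]) = sym (-‿involutive _)

    +-homo : ∀ i j → ⟦ i ℤ.+ j ⟧ ≈ ⟦ i ⟧ + ⟦ j ⟧
    +-homo (+ m)    (+ n)    = ×-homo-+ 1# m n
    +-homo (+ m)    -[1+ n ] = ⊖-homo m (suc n)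
    +-homo -[1+ m ] (+ n)    = trans (⊖-homo n (suc m)) (+-comm _ _)
    +-homo -[1+ m ] -[1+ n ] = begin
      - (suc (suc (m ℕ.+ n)) × 1#)      ≡⟨ ≡.cong (λ k → - (suc k × 1#)) (ℕ.+-suc m n) ⟨
      - ((suc m ℕ.+ suc n) × 1#)        ≈⟨ -‿cong (×-homo-+ 1# (suc m) (suc n)) ⟩
      - (suc m × 1# + suc n × 1#)       ≈⟨ -‿+-comm _ _ ⟨
      - (suc m × 1#) - suc n × 1#       ∎

    *-homo-+ : ∀ m j → ⟦ + m ℤ.* j ⟧ ≈ ⟦ + m ⟧ * ⟦ j ⟧
    *-homo-+ m (+ n) = trans (reflexive (≡.cong ⟦_⟧ (≡.sym (ℤ.pos-* m n)))) (×1-homo-* m n)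
    *-homo-+ m -[1+ n ] = begin
      ⟦ + m ℤ.* -[1+ n ] ⟧          ≡⟨ ≡.cong ⟦_⟧ (ℤ.neg-distribʳ-* (+ m) (+ suc n)) ⟨
      ⟦ ℤ.- (+ m ℤ.* + suc n) ⟧     ≈⟨ -‿homo (+ m ℤ.* + suc n) ⟩
      - ⟦ + m ℤ.* + suc n ⟧         ≈⟨ -‿cong (*-homo-+ m (+ suc n)) ⟩
      - (m × 1# * (suc n × 1#))     ≈⟨ -‿distribʳ-* _ _ ⟩
      m × 1# * - (suc n × 1#)       ∎

    *-homo : ∀ i j → ⟦ i ℤ.* j ⟧ ≈ ⟦ i ⟧ * ⟦ j ⟧
    *-homo (+ m) j = *-homo-+ m j
    *-homo -[1+ m ] j = begin
      ⟦ -[1+ m ] ℤ.* j ⟧            ≡⟨ ≡.cong ⟦_⟧ (ℤ.neg-distribˡ-* (+ suc m) j) ⟨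
      ⟦ ℤ.- (+ suc m ℤ.* j) ⟧       ≈⟨ -‿homo (+ suc m ℤ.* j) ⟩
      - ⟦ + suc m ℤ.* j ⟧           ≈⟨ -‿cong (*-homo-+ (suc m) j) ⟩
      - (suc m × 1# * ⟦ j ⟧)        ≈⟨ -‿distribˡ-* _ _ ⟩
      - (suc m × 1#) * ⟦ j ⟧        ∎

    morphism : ℤ.+-*-rawRing -Raw-AlmostCommutative⟶ fromCommutativeRing R
    morphism = record
      { ⟦_⟧    = ⟦_⟧
      ; +-homo = +-homo
      ; *-homo = *-homo
      ; -‿homo = -‿homo
      ; 0-homo = refl
      ; 1-homo = refl
      }

  open Algebra.Solver.Ring ℤ.+-*-rawRing (fromCommutativeRing R) morphism
    (λ i j → map (λ eq → reflexive (≡.cong ⟦_⟧ eq)) (dec⇒maybe (i ℤ.≟ j)))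
    public

  #0 : ∀ {n} → Polynomial n
  #0 = con (+ 0)

  #1 : ∀ {n} → Polynomial n
  #1 = con (+ 1)

  #3 : ∀ {n} → Polynomial n
  #3 = con (+ 3)

-- The commutative ring ℚ[q]

module PolynomialRing where

  open ℚ[q]
  open ≡ using (refl; sym; trans; cong; cong₂)

  private
    open Algebra.Properties.CommutativeSemigroup
      (CommutativeRing.+-commutativeSemigroup ℚ.+-*-commutativeRing) using (interchange)

    infixl 7 _·_
    _·_ : ℚ → Poly → Poly
    a · f = List.map (a ℚ.*_) f

  ≈-isEquivalence : IsEquivalence _≈_
  ≈-isEquivalence = record
    { refl  = mk≈ λ _ → refl
    ; sym   = λ f≈g → mk≈ λ n → sym (coeff-≈ f≈g n)
    ; trans = λ f≈g g≈h → mk≈ λ n → trans (coeff-≈ f≈g n) (coeff-≈ g≈h n)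
    }

  ≈-setoid : Setoid 0ℓ 0ℓ
  ≈-setoid = record { isEquivalence = ≈-isEquivalence }

  open IsEquivalence ≈-isEquivalence using () renaming (refl to ≈-refl; sym to ≈-sym; trans to ≈-trans)

  coeff-neg : ∀ f n → coeff (- f) n ≡ ℚ.- coeff f n
  coeff-neg []      n       = refl
  coeff-neg (a ∷ f) zero    = refl
  coeff-neg (a ∷ f) (suc n) = coeff-neg f n

  ∷-cong : ∀ {a b f g} → a ≡ b → f ≈ g → a ∷ f ≈ b ∷ g
  ∷-cong a≡b f≈g = mk≈ λ where
    zero    → a≡b
    (suc n) → coeff-≈ f≈g n

  +-cong : ∀ {f f′ g g′} → f ≈ f′ → g ≈ g′ → f + g ≈ f′ + g′
  +-cong {f} {f′} {g} {g′} f≈ g≈ = mk≈ λ n →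
    trans (coeff-+ f g n)
      (trans (cong₂ ℚ._+_ (coeff-≈ f≈ n) (coeff-≈ g≈ n)) (sym (coeff-+ f′ g′ n)))

  -‿cong : ∀ {f g} → f ≈ g → - f ≈ - g
  -‿cong {f} {g} f≈g = mk≈ λ n →
    trans (coeff-neg f n) (trans (cong ℚ.-_ (coeff-≈ f≈g n)) (sym (coeff-neg g n)))

  +-comm : ∀ f g → f + g ≈ g + f
  +-comm f g = mk≈ λ n →
    trans (coeff-+ f g n) (trans (ℚ.+-comm (coeff f n) (coeff g n)) (sym (coeff-+ g f n)))

  +-assoc : ∀ f g h → f + g + h ≈ f + (g + h)
  +-assoc f g h = mk≈ λ n → begin
    coeff (f + g + h) n                       ≡⟨ coeff-+ (f + g) h n ⟩
    coeff (f + g) n ℚ.+ coeff h n             ≡⟨ cong (ℚ._+ coeff h n) (coeff-+ f g n) ⟩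
    coeff f n ℚ.+ coeff g n ℚ.+ coeff h n     ≡⟨ ℚ.+-assoc (coeff f n) (coeff g n) (coeff h n) ⟩
    coeff f n ℚ.+ (coeff g n ℚ.+ coeff h n)   ≡⟨ cong (coeff f n ℚ.+_) (coeff-+ g h n) ⟨
    coeff f n ℚ.+ coeff (g + h) n             ≡⟨ coeff-+ f (g + h) n ⟨
    coeff (f + (g + h)) n                     ∎
    where open ≡.≡-Reasoning

  +-identityʳ : ∀ f → f + 0ₚ ≈ f
  +-identityʳ f = +-comm f 0ₚ

  -‿inverseʳ : ∀ f → f + - f ≈ 0ₚ
  -‿inverseʳ f = mk≈ λ n →
    trans (coeff-+ f (- f) n) (trans (cong (coeff f n ℚ.+_) (coeff-neg f n)) (ℚ.+-inverseʳ (coeff f n)))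

  private
    0∷0 : 0ℚ ∷ 0ₚ ≈ 0ₚ
    0∷0 = mk≈ λ where
      zero    → refl
      (suc n) → refl

    ·-cong : ∀ {a b f g} → a ≡ b → f ≈ g → a · f ≈ b · g
    ·-cong {a} {b} {f} {g} a≡b f≈g = mk≈ λ n →
      trans (coeff-map* a f n) (trans (cong₂ ℚ._*_ a≡b (coeff-≈ f≈g n)) (sym (coeff-map* b g n)))

    ·-distribʳ : ∀ a b f → (a ℚ.+ b) · f ≈ a · f + b · f
    ·-distribʳ a b f = mk≈ λ n → begin
      coeff ((a ℚ.+ b) · f) n                 ≡⟨ coeff-map* (a ℚ.+ b) f n ⟩
      (a ℚ.+ b) ℚ.* coeff f n                 ≡⟨ ℚ.*-distribʳ-+ (coeff f n) a b ⟩
      a ℚ.* coeff f n ℚ.+ b ℚ.* coeff f n     ≡⟨ cong₂ ℚ._+_ (coeff-map* a f n) (coeff-map* b f n) ⟨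
      coeff (a · f) n ℚ.+ coeff (b · f) n     ≡⟨ coeff-+ (a · f) (b · f) n ⟨
      coeff (a · f + b · f) n                 ∎
      where open ≡.≡-Reasoning

    ·-distribˡ : ∀ a f g → a · (f + g) ≈ a · f + a · g
    ·-distribˡ a f g = mk≈ λ n → begin
      coeff (a · (f + g)) n                   ≡⟨ coeff-map* a (f + g) n ⟩
      a ℚ.* coeff (f + g) n                   ≡⟨ cong (a ℚ.*_) (coeff-+ f g n) ⟩
      a ℚ.* (coeff f n ℚ.+ coeff g n)         ≡⟨ ℚ.*-distribˡ-+ a (coeff f n) (coeff g n) ⟩
      a ℚ.* coeff f n ℚ.+ a ℚ.* coeff g n     ≡⟨ cong₂ ℚ._+_ (coeff-map* a f n) (coeff-map* a g n) ⟨
      coeff (a · f) n ℚ.+ coeff (a · g) n     ≡⟨ coeff-+ (a · f) (a · g) n ⟨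
      coeff (a · f + a · g) n                 ∎
      where open ≡.≡-Reasoning

    ·-assoc : ∀ a b f → (a ℚ.* b) · f ≈ a · (b · f)
    ·-assoc a b f = mk≈ λ n → begin
      coeff ((a ℚ.* b) · f) n       ≡⟨ coeff-map* (a ℚ.* b) f n ⟩
      a ℚ.* b ℚ.* coeff f n         ≡⟨ ℚ.*-assoc a b (coeff f n) ⟩
      a ℚ.* (b ℚ.* coeff f n)       ≡⟨ cong (a ℚ.*_) (coeff-map* b f n) ⟨
      a ℚ.* coeff (b · f) n         ≡⟨ coeff-map* a (b · f) n ⟨
      coeff (a · (b · f)) n         ∎
      where open ≡.≡-Reasoning

    ·-identityˡ : ∀ f → 1ℚ · f ≈ f
    ·-identityˡ f = mk≈ λ n → trans (coeff-map* 1ℚ f n) (ℚ.*-identityˡ (coeff f n))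

    ·-zeroˡ : ∀ f → 0ℚ · f ≈ 0ₚ
    ·-zeroˡ f = mk≈ λ n → trans (coeff-map* 0ℚ f n) (ℚ.*-zeroˡ (coeff f n))

    +-medial : ∀ f g h k → f + g + (h + k) ≈ f + h + (g + k)
    +-medial f g h k = mk≈ λ n → begin
      coeff (f + g + (h + k)) n   ≡⟨ coeff-+₄ f g h k n ⟩
      coeff f n ℚ.+ coeff g n ℚ.+ (coeff h n ℚ.+ coeff k n)
                                  ≡⟨ interchange (coeff f n) (coeff g n) (coeff h n) (coeff k n) ⟩
      coeff f n ℚ.+ coeff h n ℚ.+ (coeff g n ℚ.+ coeff k n)
                                  ≡⟨ coeff-+₄ f h g k n ⟨
      coeff (f + h + (g + k)) n   ∎
      where
      open ≡.≡-Reasoning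
      coeff-+₄ : ∀ f g h k n → coeff (f + g + (h + k)) n ≡
                 coeff f n ℚ.+ coeff g n ℚ.+ (coeff h n ℚ.+ coeff k n)
      coeff-+₄ f g h k n = trans (coeff-+ (f + g) (h + k) n) (cong₂ ℚ._+_ (coeff-+ f g n) (coeff-+ h k n))

    0∷-+ : ∀ f g → 0ℚ ∷ (f + g) ≈ (0ℚ ∷ f) + (0ℚ ∷ g)
    0∷-+ f g = ∷-cong refl ≈-refl

    0∷-· : ∀ a f → 0ℚ ∷ a · f ≈ a · (0ℚ ∷ f)
    0∷-· a f = ∷-cong (sym (ℚ.*-zeroʳ a)) ≈-refl

    0∷-* : ∀ f g → (0ℚ ∷ f) * g ≈ 0ℚ ∷ f * g
    0∷-* f g = +-cong (·-zeroˡ g) ≈-refl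

  *-congˡ : ∀ f {g g′} → g ≈ g′ → f * g ≈ f * g′
  *-congˡ []      g≈ = ≈-refl
  *-congˡ (a ∷ f) g≈ = +-cong (·-cong {a} refl g≈) (∷-cong refl (*-congˡ f g≈))

  *-distribʳ : ∀ h f g → (f + g) * h ≈ f * h + g * h
  *-distribʳ h []      g       = ≈-refl
  *-distribʳ h (a ∷ f) []      = ≈-sym (+-identityʳ _)
  *-distribʳ h (a ∷ f) (b ∷ g) =
    ≈-trans (+-cong (·-distribʳ a b h)
                    (≈-trans (∷-cong refl (*-distribʳ h f g)) (0∷-+ (f * h) (g * h))))
            (+-medial (a · h) (b · h) (0ℚ ∷ f * h) (0ℚ ∷ g * h))

  *-zeroʳ : ∀ f → f * 0ₚ ≈ 0ₚ
  *-zeroʳ []      = ≈-refl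
  *-zeroʳ (a ∷ f) = ≈-trans (∷-cong refl (*-zeroʳ f)) 0∷0

  private
    -- The product recurses on its left factor; this is the matching recursion on the right factor,
    -- from which commutativity follows by induction.
    *-∷ : ∀ f b g → f * (b ∷ g) ≈ b · f + (0ℚ ∷ f * g)
    *-∷ []      b g = ≈-sym 0∷0
    *-∷ (a ∷ f) b g = ∷-cong (cong (ℚ._+ 0ℚ) (ℚ.*-comm a b)) (begin
      a · g + f * (b ∷ g)            ≈⟨ +-cong ≈-refl (*-∷ f b g) ⟩
      a · g + (b · f + (0ℚ ∷ f * g)) ≈⟨ +-assoc (a · g) (b · f) _ ⟨
      a · g + b · f + (0ℚ ∷ f * g)   ≈⟨ +-cong (+-comm (a · g) (b · f)) ≈-refl ⟩
      b · f + a · g + (0ℚ ∷ f * g)   ≈⟨ +-assoc (b · f) (a · g) _ ⟩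
      b · f + (a · g + (0ℚ ∷ f * g)) ∎)
      where open import Relation.Binary.Reasoning.Setoid ≈-setoid

  *-comm : ∀ f g → f * g ≈ g * f
  *-comm []      g = ≈-sym (*-zeroʳ g)
  *-comm (a ∷ f) g = ≈-trans (+-cong ≈-refl (∷-cong refl (*-comm f g))) (≈-sym (*-∷ g a f))

  -- Equal polynomials may be lists of different length, which blocks induction on the left factor.
  -- Commutativity moves that factor to the right, where congruence is known.
  *-cong : ∀ {f f′ g g′} → f ≈ f′ → g ≈ g′ → f * g ≈ f′ * g′
  *-cong {f} {f′} {g} {g′} f≈ g≈ = begin
    f * g    ≈⟨ *-congˡ f g≈ ⟩
    f * g′   ≈⟨ *-comm f g′ ⟩
    g′ * f   ≈⟨ *-congˡ g′ f≈ ⟩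
    g′ * f′  ≈⟨ *-comm g′ f′ ⟩
    f′ * g′  ∎
    where open import Relation.Binary.Reasoning.Setoid ≈-setoid

  private
    ·-* : ∀ a f g → (a · f) * g ≈ a · (f * g)
    ·-* a []      g = ≈-refl
    ·-* a (b ∷ f) g = begin
      (a ℚ.* b) · g + (0ℚ ∷ (a · f) * g)   ≈⟨ +-cong (·-assoc a b g) (∷-cong refl (·-* a f g)) ⟩
      a · (b · g) + (0ℚ ∷ a · (f * g))     ≈⟨ +-cong ≈-refl (0∷-· a (f * g)) ⟩
      a · (b · g) + a · (0ℚ ∷ f * g)       ≈⟨ ·-distribˡ a (b · g) (0ℚ ∷ f * g) ⟨
      a · (b · g + (0ℚ ∷ f * g))           ∎
      where open import Relation.Binary.Reasoning.Setoid ≈-setoid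

  *-assoc : ∀ f g h → f * g * h ≈ f * (g * h)
  *-assoc []      g h = ≈-refl
  *-assoc (a ∷ f) g h = begin
    (a · g + (0ℚ ∷ f * g)) * h         ≈⟨ *-distribʳ h (a · g) (0ℚ ∷ f * g) ⟩
    (a · g) * h + (0ℚ ∷ f * g) * h     ≈⟨ +-cong (·-* a g h) (0∷-* (f * g) h) ⟩
    a · (g * h) + (0ℚ ∷ f * g * h)     ≈⟨ +-cong ≈-refl (∷-cong refl (*-assoc f g h)) ⟩
    a · (g * h) + (0ℚ ∷ f * (g * h))   ∎
    where open import Relation.Binary.Reasoning.Setoid ≈-setoid

  *-identityˡ : ∀ f → 1ₚ * f ≈ f
  *-identityˡ f = ≈-trans (+-cong (·-identityˡ f) 0∷0) (+-identityʳ f)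

  commutativeRing : CommutativeRing 0ℓ 0ℓ
  commutativeRing = record
    { isCommutativeRing = record
      { isRing = record
        { +-isAbelianGroup = record
          { isGroup = record
            { isMonoid = record
              { isSemigroup = record
                { isMagma = record { isEquivalence = ≈-isEquivalence ; ∙-cong = +-cong }
                ; assoc = +-assoc }
              ; identity = (λ _ → ≈-refl) , +-identityʳ }
            ; inverse = (λ f → ≈-trans (+-comm (- f) f) (-‿inverseʳ f)) , -‿inverseʳ
            ; ⁻¹-cong = -‿cong }
          ; comm = +-comm }
        ; *-cong = *-cong
        ; *-assoc = *-assoc
        ; *-identity = *-identityˡ , (λ f → ≈-trans (*-comm f 1ₚ) (*-identityˡ f))
        ; distrib = (λ h f g → ≈-trans (*-comm h (f + g)) (≈-trans (*-distribʳ h f g) (+-cong (*-comm f h) (*-comm g h))))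
                  , *-distribʳ }
      ; *-comm = *-comm } }

-- Quotients by a principal ideal

module PrincipalQuotient (R : CommutativeRing 0ℓ 0ℓ) (m : CommutativeRing.Carrier R) where

  open CommutativeRing R
  open IntegerSolver R using (solve; _:=_; _:+_; _:*_; _:-_; :-_)
  open import Relation.Binary.Reasoning.Setoid setoid

  infix 4 _≋_

  -- The quotient keeps the carrier and the operations of R; only equality is coarsened, with an
  -- explicit multiple of m as evidence.
  record _≋_ (x y : Carrier) : Set where
    constructor mod
    field
      quotient : Carrier
      equality : x ≈ y + m * quotient

  ≈⇒≋ : ∀ {x y} → x ≈ y → x ≋ y
  ≈⇒≋ {x} {y} x≈y = mod 0# (trans x≈y (sym (trans (+-congˡ (zeroʳ m)) (+-identityʳ y))))

  ≋-sym : ∀ {x y} → x ≋ y → y ≋ x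
  ≋-sym {x} {y} (mod h x≈) = mod (- h) (begin
    y                     ≈⟨ solve 3 (λ y m h → y := y :+ m :* h :+ m :* (:- h)) refl y m h ⟩
    y + m * h + m * - h   ≈⟨ +-congʳ x≈ ⟨
    x + m * - h           ∎)

  ≋-trans : ∀ {x y z} → x ≋ y → y ≋ z → x ≋ z
  ≋-trans {x} {y} {z} (mod h x≈) (mod k y≈) = mod (k + h) (begin
    x                     ≈⟨ x≈ ⟩
    y + m * h             ≈⟨ +-congʳ y≈ ⟩
    z + m * k + m * h     ≈⟨ solve 4 (λ z m k h → z :+ m :* k :+ m :* h := z :+ m :* (k :+ h)) refl z m k h ⟩
    z + m * (k + h)       ∎)

  +-cong-≋ : ∀ {x y u v} → x ≋ y → u ≋ v → x + u ≋ y + v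
  +-cong-≋ {x} {y} {u} {v} (mod h x≈) (mod k u≈) = mod (h + k) (begin
    x + u                       ≈⟨ +-cong x≈ u≈ ⟩
    y + m * h + (v + m * k)     ≈⟨ solve 5 (λ y v m h k → y :+ m :* h :+ (v :+ m :* k) := y :+ v :+ m :* (h :+ k)) refl y v m h k ⟩
    y + v + m * (h + k)         ∎)

  *-cong-≋ : ∀ {x y u v} → x ≋ y → u ≋ v → x * u ≋ y * v
  *-cong-≋ {x} {y} {u} {v} (mod h x≈) (mod k u≈) = mod (h * v + y * k + m * h * k) (begin
    x * u                       ≈⟨ *-cong x≈ u≈ ⟩
    (y + m * h) * (v + m * k)   ≈⟨ solve 5 (λ y v m h k → (y :+ m :* h) :* (v :+ m :* k) := y :* v :+ m :* (h :* v :+ y :* k :+ m :* h :* k)) refl y v m h k ⟩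
    y * v + m * (h * v + y * k + m * h * k) ∎)

  -‿cong-≋ : ∀ {x y} → x ≋ y → - x ≋ - y
  -‿cong-≋ {x} {y} (mod h x≈) = mod (- h) (begin
    - x                   ≈⟨ -‿cong x≈ ⟩
    - (y + m * h)         ≈⟨ solve 3 (λ y m h → :- (y :+ m :* h) := :- y :+ m :* (:- h)) refl y m h ⟩
    - y + m * - h         ∎)

  commutativeRing : CommutativeRing 0ℓ 0ℓ
  commutativeRing = record
    { _≈_ = _≋_
    ; _+_ = _+_
    ; _*_ = _*_
    ; -_  = -_
    ; 0#  = 0#
    ; 1#  = 1#
    ; isCommutativeRing = record
      { isRing = record
        { +-isAbelianGroup = record
          { isGroup = record
            { isMonoid = record
              { isSemigroup = record
                { isMagma = record
                  { isEquivalence = record { refl = ≈⇒≋ refl ; sym = ≋-sym ; trans = ≋-trans }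
                  ; ∙-cong = +-cong-≋ }
                ; assoc = λ x y z → ≈⇒≋ (+-assoc x y z) }
              ; identity = (λ x → ≈⇒≋ (+-identityˡ x)) , (λ x → ≈⇒≋ (+-identityʳ x)) }
            ; inverse = (λ x → ≈⇒≋ (-‿inverseˡ x)) , (λ x → ≈⇒≋ (-‿inverseʳ x))
            ; ⁻¹-cong = -‿cong-≋ }
          ; comm = λ x y → ≈⇒≋ (+-comm x y) }
        ; *-cong = *-cong-≋
        ; *-assoc = λ x y z → ≈⇒≋ (*-assoc x y z)
        ; *-identity = (λ x → ≈⇒≋ (*-identityˡ x)) , (λ x → ≈⇒≋ (*-identityʳ x))
        ; distrib = (λ x y z → ≈⇒≋ (distribˡ x y z)) , (λ x y z → ≈⇒≋ (distribʳ x y z)) }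
      ; *-comm = λ x y → ≈⇒≋ (*-comm x y) } }

-- Integers inside ℚ

module IntegerEmbedding where

  private
    -- `ℚ._/_` reduces to lowest terms. Unnormalised fractions remove the gcd, and the identities
    -- below become cross-multiplications in ℤ.
    toℚᵘ-/ : ∀ i n .{{_ : ℕ.NonZero n}} → toℚᵘ (i ℚ./ n) ≃ (i ℚᵘ./ n)
    toℚᵘ-/ i (suc n) = ℚ.toℚᵘ-fromℚᵘ (mkℚᵘ i n)

  /1-+ : ∀ i j → (i ℤ.+ j) ℚ./ 1 ≡ i ℚ./ 1 ℚ.+ j ℚ./ 1
  /1-+ i j = ℚ.toℚᵘ-injective (begin
    toℚᵘ ((i ℤ.+ j) ℚ./ 1)              ≈⟨ toℚᵘ-/ (i ℤ.+ j) 1 ⟩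
    mkℚᵘ (i ℤ.+ j) 0                  ≈⟨ *≡* (lemma i j) ⟩
    mkℚᵘ i 0 ℚᵘ.+ mkℚᵘ j 0            ≈⟨ ℚᵘ.+-cong (toℚᵘ-/ i 1) (toℚᵘ-/ j 1) ⟨
    toℚᵘ (i ℚ./ 1) ℚᵘ.+ toℚᵘ (j ℚ./ 1)    ≈⟨ ℚ.toℚᵘ-homo-+ (i ℚ./ 1) (j ℚ./ 1) ⟨
    toℚᵘ (i ℚ./ 1 ℚ.+ j ℚ./ 1)            ∎)
    where
    open import Relation.Binary.Reasoning.Setoid ℚᵘ.≃-setoid
    lemma : ∀ i j → (i ℤ.+ j) ℤ.* + 1 ≡ (i ℤ.* + 1 ℤ.+ j ℤ.* + 1) ℤ.* + 1
    lemma = ℤSolver.solve-∀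

  /1-* : ∀ i j → (i ℤ.* j) ℚ./ 1 ≡ (i ℚ./ 1) ℚ.* (j ℚ./ 1)
  /1-* i j = ℚ.toℚᵘ-injective (begin
    toℚᵘ ((i ℤ.* j) ℚ./ 1)              ≈⟨ toℚᵘ-/ (i ℤ.* j) 1 ⟩
    mkℚᵘ i 0 ℚᵘ.* mkℚᵘ j 0            ≈⟨ ℚᵘ.*-cong (toℚᵘ-/ i 1) (toℚᵘ-/ j 1) ⟨
    toℚᵘ (i ℚ./ 1) ℚᵘ.* toℚᵘ (j ℚ./ 1)    ≈⟨ ℚ.toℚᵘ-homo-* (i ℚ./ 1) (j ℚ./ 1) ⟨
    toℚᵘ ((i ℚ./ 1) ℚ.* (j ℚ./ 1))            ∎)
    where open import Relation.Binary.Reasoning.Setoid ℚᵘ.≃-setoid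

  /1-neg : ∀ i → (ℤ.- i) ℚ./ 1 ≡ ℚ.- (i ℚ./ 1)
  /1-neg i = ℚ.toℚᵘ-injective (begin
    toℚᵘ ((ℤ.- i) ℚ./ 1)     ≈⟨ toℚᵘ-/ (ℤ.- i) 1 ⟩
    ℚᵘ.- (mkℚᵘ i 0)        ≈⟨ ℚᵘ.-‿cong (toℚᵘ-/ i 1) ⟨
    ℚᵘ.- toℚᵘ (i ℚ./ 1)      ≈⟨ ℚ.toℚᵘ-homo‿- (i ℚ./ 1) ⟨
    toℚᵘ (ℚ.- (i ℚ./ 1))     ∎)
    where open import Relation.Binary.Reasoning.Setoid ℚᵘ.≃-setoid

  n/1*i/n≡i/1 : ∀ i n .{{_ : ℕ.NonZero n}} → (+ n) ℚ./ 1 ℚ.* (i ℚ./ n) ≡ i ℚ./ 1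
  n/1*i/n≡i/1 i n@(suc n-1) = ℚ.toℚᵘ-injective (begin
    toℚᵘ ((+ n) ℚ./ 1 ℚ.* (i ℚ./ n))          ≈⟨ ℚ.toℚᵘ-homo-* ((+ n) ℚ./ 1) (i ℚ./ n) ⟩
    toℚᵘ ((+ n) ℚ./ 1) ℚᵘ.* toℚᵘ (i ℚ./ n)  ≈⟨ ℚᵘ.*-cong (toℚᵘ-/ (+ n) 1) (toℚᵘ-/ i n) ⟩
    mkℚᵘ (+ n) 0 ℚᵘ.* mkℚᵘ i n-1        ≈⟨ *≡* (lemma (+ n) i) ⟩
    mkℚᵘ i 0                            ≈⟨ toℚᵘ-/ i 1 ⟨
    toℚᵘ (i ℚ./ 1)                        ∎)
    where
    open import Relation.Binary.Reasoning.Setoid ℚᵘ.≃-setoid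
    lemma : ∀ n i → n ℤ.* i ℤ.* + 1 ≡ i ℤ.* (+ 1 ℤ.* n)
    lemma = ℤSolver.solve-∀

open IntegerEmbedding

-- Units, interpolation and elementary symmetric functions

module Evaluation (R : CommutativeRing 0ℓ 0ℓ) where

  open CommutativeRing R
  open IntegerSolver R using (solve; _:=_; _:+_; _:*_; _:-_; :-_)
  open Algebra.Properties.Semiring.Exp semiring public using (_^_; ^-congˡ; ^-homo-*; ^-assocʳ)
  open Algebra.Properties.CommutativeSemiring.Exp commutativeSemiring public using (^-distrib-*)
  open import Relation.Binary.Reasoning.Setoid setoid

  x-y≈0⇒x≈y : ∀ {x y} → x - y ≈ 0# → x ≈ y
  x-y≈0⇒x≈y {x} {y} x-y≈0 = begin
    x           ≈⟨ solve 2 (λ x y → x := y :+ (x :- y)) refl x y ⟩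
    y + (x - y) ≈⟨ +-congˡ x-y≈0 ⟩
    y + 0#      ≈⟨ +-identityʳ y ⟩
    y           ∎

  x≈y⇒x-y≈0 : ∀ {x y} → x ≈ y → x - y ≈ 0#
  x≈y⇒x-y≈0 {x} {y} x≈y = trans (+-congʳ x≈y) (-‿inverseʳ y)

  1^n≈1 : ∀ n → 1# ^ n ≈ 1#
  1^n≈1 zero    = refl
  1^n≈1 (suc n) = trans (*-identityˡ _) (1^n≈1 n)

  record IsUnit (x : Carrier) : Set where
    constructor unit
    field
      inverse   : Carrier
      inverseʳ  : x * inverse ≈ 1#

  unit-cong : ∀ {x y} → x ≈ y → IsUnit x → IsUnit y
  unit-cong x≈y (unit u xu) = unit u (trans (*-congʳ (sym x≈y)) xu)

  unit-1 : IsUnit 1#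
  unit-1 = unit 1# (*-identityˡ 1#)

  unit-* : ∀ {x y} → IsUnit x → IsUnit y → IsUnit (x * y)
  unit-* {x} {y} (unit u xu) (unit v yv) = unit (u * v) (begin
    x * y * (u * v)   ≈⟨ solve 4 (λ x y u v → x :* y :* (u :* v) := (x :* u) :* (y :* v)) refl x y u v ⟩
    x * u * (y * v)   ≈⟨ *-cong xu yv ⟩
    1# * 1#           ≈⟨ *-identityˡ 1# ⟩
    1#                ∎)

  unit-^ : ∀ {x} n → IsUnit x → IsUnit (x ^ n)
  unit-^ {x} n (unit u xu) = unit (u ^ n) (begin
    x ^ n * u ^ n   ≈⟨ ^-distrib-* x u n ⟨
    (x * u) ^ n     ≈⟨ ^-congˡ n xu ⟩
    1# ^ n          ≈⟨ 1^n≈1 n ⟩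
    1#              ∎)

  unit-neg : ∀ {x} → IsUnit x → IsUnit (- x)
  unit-neg {x} (unit u xu) = unit (- u) (trans (solve 2 (λ x u → :- x :* :- u := x :* u) refl x u) xu)

  unit-divisor : ∀ {x y} → IsUnit (x * y) → IsUnit x
  unit-divisor {x} {y} (unit u xyu) = unit (y * u) (trans (sym (*-assoc x y u)) xyu)

  unit-cancel : ∀ {x y z} → IsUnit x → x * y ≈ x * z → y ≈ z
  unit-cancel {x} {y} {z} (unit u xu≈1) xy≈xz = begin
    y             ≈⟨ *-identityˡ y ⟨
    1# * y        ≈⟨ *-congʳ xu≈1 ⟨
    x * u * y     ≈⟨ solve 3 (λ x y u → x :* u :* y := u :* (x :* y)) refl x y u ⟩
    u * (x * y)   ≈⟨ *-congˡ xy≈xz ⟩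
    u * (x * z)   ≈⟨ solve 3 (λ x y u → x :* u :* y := u :* (x :* y)) refl x z u ⟨
    x * u * z     ≈⟨ *-congʳ xu≈1 ⟩
    1# * z        ≈⟨ *-identityˡ z ⟩
    z             ∎

  unit-cancel-0 : ∀ {x y} → IsUnit x → x * y ≈ 0# → y ≈ 0#
  unit-cancel-0 {x} x-unit xy≈0 = unit-cancel x-unit (trans xy≈0 (sym (zeroʳ x)))

  ∏ : ℕ → (ℕ → Carrier) → Carrier
  ∏ zero    f = 1#
  ∏ (suc n) f = f 0 * ∏ n (f ∘ suc)

  ∏-cong : ∀ n {f g} → (∀ i → i < n → f i ≈ g i) → ∏ n f ≈ ∏ n g
  ∏-cong zero    f≈g = refl
  ∏-cong (suc n) f≈g = *-cong (f≈g 0 z<s) (∏-cong n λ i i<n → f≈g (suc i) (s<s i<n))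

  ∏-* : ∀ n f g → ∏ n (λ i → f i * g i) ≈ ∏ n f * ∏ n g
  ∏-* zero    f g = sym (*-identityˡ 1#)
  ∏-* (suc n) f g = begin
    f 0 * g 0 * ∏ n (λ i → f (suc i) * g (suc i))         ≈⟨ *-congˡ (∏-* n (f ∘ suc) (g ∘ suc)) ⟩
    f 0 * g 0 * (∏ n (f ∘ suc) * ∏ n (g ∘ suc))
      ≈⟨ solve 4 (λ a b c d → a :* b :* (c :* d) := a :* c :* (b :* d)) refl (f 0) (g 0) _ _ ⟩
    f 0 * ∏ n (f ∘ suc) * (g 0 * ∏ n (g ∘ suc))           ∎

  ∏-^ : ∀ n f k → ∏ n (λ i → f i ^ k) ≈ ∏ n f ^ k
  ∏-^ zero    f k = sym (1^n≈1 k)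
  ∏-^ (suc n) f k = trans (*-congˡ (∏-^ n (f ∘ suc) k)) (sym (^-distrib-* (f 0) (∏ n (f ∘ suc)) k))

  -- Horner's scheme. The first argument counts coefficients, so it is one more than the degree
  -- bound.
  eval : ℕ → (ℕ → Carrier) → Carrier → Carrier
  eval zero    f x = 0#
  eval (suc n) f x = f 0 + x * eval n (f ∘ suc) x

  eval-cong : ∀ n {f g} x → (∀ i → i < n → f i ≈ g i) → eval n f x ≈ eval n g x
  eval-cong zero    x f≈g = refl
  eval-cong (suc n) x f≈g = +-cong (f≈g 0 z<s) (*-congˡ (eval-cong n x λ i i<n → f≈g (suc i) (s<s i<n)))

  eval-+ : ∀ n f g x → eval n (λ i → f i + g i) x ≈ eval n f x + eval n g x
  eval-+ zero    f g x = sym (+-identityˡ 0#)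
  eval-+ (suc n) f g x = trans (+-congˡ (*-congˡ (eval-+ n (f ∘ suc) (g ∘ suc) x)))
    (solve 5 (λ a b x u v → a :+ b :+ x :* (u :+ v) := a :+ x :* u :+ (b :+ x :* v)) refl
       (f 0) (g 0) x (eval n (f ∘ suc) x) (eval n (g ∘ suc) x))

  eval-* : ∀ n c f x → eval n (λ i → c * f i) x ≈ c * eval n f x
  eval-* zero    c f x = sym (zeroʳ c)
  eval-* (suc n) c f x = trans (+-congˡ (*-congˡ (eval-* n c (f ∘ suc) x)))
    (solve 4 (λ c a x u → c :* a :+ x :* (c :* u) := c :* (a :+ x :* u)) refl
       c (f 0) x (eval n (f ∘ suc) x))

  eval-sub : ∀ n f g x → eval n (λ i → f i - g i) x ≈ eval n f x - eval n g x
  eval-sub zero    f g x = sym (-‿inverseʳ 0#)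
  eval-sub (suc n) f g x = trans (+-congˡ (*-congˡ (eval-sub n (f ∘ suc) (g ∘ suc) x)))
    (solve 5 (λ a b x u v → a :- b :+ x :* (u :- v) := a :+ x :* u :- (b :+ x :* v)) refl
       (f 0) (g 0) x (eval n (f ∘ suc) x) (eval n (g ∘ suc) x))

  eval-zero : ∀ n {f} x → (∀ i → f i ≈ 0#) → eval n f x ≈ 0#
  eval-zero zero    x f≈0 = refl
  eval-zero (suc n) x f≈0 =
    trans (+-cong (f≈0 0) (trans (*-congˡ (eval-zero n x (f≈0 ∘ suc))) (zeroʳ x))) (+-identityˡ 0#)

  eval-truncate : ∀ n f x → f n ≈ 0# → eval (suc n) f x ≈ eval n f x
  eval-truncate zero f x f0≈0 = begin
    f 0 + x * 0#   ≈⟨ +-cong f0≈0 (zeroʳ x) ⟩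
    0# + 0#        ≈⟨ +-identityˡ 0# ⟩
    0#             ∎
  eval-truncate (suc n) f x fn≈0 = +-congˡ (*-congˡ (eval-truncate n (f ∘ suc) x fn≈0))

  -- The quotient of f by X - r, where f has n + 1 coefficients.
  quot : ℕ → (ℕ → Carrier) → Carrier → ℕ → Carrier
  quot zero    f r i       = 0#
  quot (suc n) f r zero    = eval (suc n) (f ∘ suc) r
  quot (suc n) f r (suc i) = quot n (f ∘ suc) r i

  -- Division with remainder: once the tail of f is e + (x - r) d, the value f 0 + x (e + (x - r) d)
  -- regroups into the remainder f 0 + r e and x - r times e + x d.
  eval-quot : ∀ n f r x → eval (suc n) f x ≈ eval (suc n) f r + (x - r) * eval n (quot n f r) x
  eval-quot zero    f r x = begin
    f 0 + x * 0#                        ≈⟨ +-congˡ (trans (zeroʳ x) (sym (zeroʳ r))) ⟩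
    f 0 + r * 0#                        ≈⟨ +-identityʳ _ ⟨
    f 0 + r * 0# + 0#                   ≈⟨ +-congˡ (zeroʳ (x - r)) ⟨
    f 0 + r * 0# + (x - r) * 0#         ∎
  eval-quot (suc n) f r x = begin
    f 0 + x * eval (suc n) (f ∘ suc) x  ≈⟨ +-congˡ (*-congˡ (eval-quot n (f ∘ suc) r x)) ⟩
    f 0 + x * (e + (x - r) * d)
      ≈⟨ solve 5 (λ a x r e d → a :+ x :* (e :+ (x :- r) :* d) :=
                                a :+ r :* e :+ (x :- r) :* (e :+ x :* d)) refl (f 0) x r e d ⟩
    f 0 + r * e + (x - r) * (e + x * d) ∎
    where
    e = eval (suc n) (f ∘ suc) r
    d = eval n (quot n (f ∘ suc) r) x

  quot-leading : ∀ n f r → quot (suc n) f r n ≈ f (suc n)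
  quot-leading zero    f r = trans (+-congˡ (zeroʳ r)) (+-identityʳ (f 1))
  quot-leading (suc n) f r = quot-leading n (f ∘ suc) r

  -- The lowest coefficient of the quotient is the tail of f evaluated at r. If it vanishes, the
  -- root forces f 0 = 0, and the tail satisfies the same hypotheses.
  quot-zero : ∀ n f r → eval (suc n) f r ≈ 0# → (∀ i → i < n → quot n f r i ≈ 0#) →
              ∀ i → i < suc n → f i ≈ 0#
  quot-zero n f r root quot≈0 zero _ = begin
    f 0                             ≈⟨ +-identityʳ (f 0) ⟨
    f 0 + 0#                        ≈⟨ +-congˡ (zeroʳ r) ⟨
    f 0 + r * 0#                    ≈⟨ +-congˡ (*-congˡ (tail≈0 n quot≈0)) ⟨
    f 0 + r * eval n (f ∘ suc) r    ≈⟨ root ⟩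
    0#                              ∎
    where
    tail≈0 : ∀ n → (∀ i → i < n → quot n f r i ≈ 0#) → eval n (f ∘ suc) r ≈ 0#
    tail≈0 zero    quot≈0 = refl
    tail≈0 (suc n) quot≈0 = quot≈0 0 z<s
  quot-zero (suc n) f r root quot≈0 (suc i) (s≤s i<n) =
    quot-zero n (f ∘ suc) r (quot≈0 0 z<s) (λ i i<n → quot≈0 (suc i) (s<s i<n)) i i<n

  -- Differences are required to be invertible because R may have zero divisors and these factors
  -- have to be cancelled.
  DistinctPoints : ℕ → (ℕ → Carrier) → Set
  DistinctPoints n r = ∀ i j → i < j → j < n → IsUnit (r j - r i)

  quot-root : ∀ n f r x → eval (suc n) f r ≈ 0# → eval (suc n) f x ≈ 0# → IsUnit (x - r) →
              eval n (quot n f r) x ≈ 0#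
  quot-root n f r x r-root x-root x-r = unit-cancel-0 x-r (begin
    (x - r) * eval n (quot n f r) x                       ≈⟨ +-identityˡ _ ⟨
    0# + (x - r) * eval n (quot n f r) x                  ≈⟨ +-congʳ r-root ⟨
    eval (suc n) f r + (x - r) * eval n (quot n f r) x    ≈⟨ eval-quot n f r x ⟨
    eval (suc n) f x                                      ≈⟨ x-root ⟩
    0#                                                    ∎)

  -- Division by X - r 0 costs one coefficient and one point, and the other points remain roots of
  -- the quotient.
  interpolation : ∀ n f r → DistinctPoints n r → (∀ i → i < n → eval n f (r i) ≈ 0#) →
                  ∀ i → i < n → f i ≈ 0#
  interpolation (suc n) f r distinct roots = quot-zero n f (r 0) (roots 0 z<s)
    (interpolation n (quot n f (r 0)) (r ∘ suc)
      (λ i j i<j j<n → distinct (suc i) (suc j) (s<s i<j) (s<s j<n))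
      (λ i i<n → quot-root n f (r 0) (r (suc i)) (roots 0 z<s) (roots (suc i) (s<s i<n))
                   (distinct 0 (suc i) z<s (s<s i<n))))

  -- Here there is one coefficient more than roots: each division splits off a linear factor and
  -- preserves the leading coefficient, which alone survives at the end.
  factorisation : ∀ n f r → DistinctPoints n r → (∀ i → i < n → eval (suc n) f (r i) ≈ 0#) →
                  ∀ x → eval (suc n) f x ≈ f n * ∏ n (λ i → x - r i)
  factorisation zero f r distinct roots x = begin
    f 0 + x * 0#   ≈⟨ +-congˡ (zeroʳ x) ⟩
    f 0 + 0#       ≈⟨ +-identityʳ (f 0) ⟩
    f 0            ≈⟨ *-identityʳ (f 0) ⟨
    f 0 * 1#       ∎
  factorisation (suc n) f r distinct roots x = begin
    eval (suc (suc n)) f x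
      ≈⟨ eval-quot (suc n) f (r 0) x ⟩
    eval (suc (suc n)) f (r 0) + (x - r 0) * eval (suc n) g x
      ≈⟨ +-cong (roots 0 z<s) (*-congˡ ih) ⟩
    0# + (x - r 0) * (g n * ∏ n (λ i → x - r (suc i)))
      ≈⟨ +-identityˡ _ ⟩
    (x - r 0) * (g n * ∏ n (λ i → x - r (suc i)))
      ≈⟨ solve 3 (λ a b c → a :* (b :* c) := b :* (a :* c)) refl (x - r 0) (g n) _ ⟩
    g n * ((x - r 0) * ∏ n (λ i → x - r (suc i)))
      ≈⟨ *-congʳ (quot-leading n f (r 0)) ⟩
    f (suc n) * ((x - r 0) * ∏ n (λ i → x - r (suc i)))
      ∎
    where
    g = quot (suc n) f (r 0)
    ih : eval (suc n) g x ≈ g n * ∏ n (λ i → x - r (suc i))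
    ih = factorisation n g (r ∘ suc)
      (λ i j i<j j<n → distinct (suc i) (suc j) (s<s i<j) (s<s j<n))
      (λ i i<n → quot-root (suc n) f (r 0) (r (suc i)) (roots 0 z<s) (roots (suc i) (s<s i<n))
                   (distinct 0 (suc i) z<s (s<s i<n))) x

  elemSym : ℕ → (ℕ → Carrier) → ℕ → Carrier
  elemSym n       x zero    = 1#
  elemSym zero    x (suc t) = 0#
  elemSym (suc n) x (suc t) = x 0 * elemSym n (x ∘ suc) t + elemSym n (x ∘ suc) (suc t)

  elemSym-vanish : ∀ n x t → n < t → elemSym n x t ≈ 0#
  elemSym-vanish zero    x (suc t) n<t = refl
  elemSym-vanish (suc n) x (suc t) (s≤s n<t) = begin
    x 0 * elemSym n (x ∘ suc) t + elemSym n (x ∘ suc) (suc t)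
      ≈⟨ +-cong (*-congˡ (elemSym-vanish n (x ∘ suc) t n<t)) (elemSym-vanish n (x ∘ suc) (suc t) (ℕ.m<n⇒m<1+n n<t)) ⟩
    x 0 * 0# + 0#  ≈⟨ +-identityʳ _ ⟩
    x 0 * 0#       ≈⟨ zeroʳ (x 0) ⟩
    0#             ∎

  elemSym-scale : ∀ n c x t → elemSym n (λ i → c * x i) t ≈ c ^ t * elemSym n x t
  elemSym-scale n       c x zero    = sym (*-identityˡ 1#)
  elemSym-scale zero    c x (suc t) = sym (zeroʳ _)
  elemSym-scale (suc n) c x (suc t) = trans
    (+-cong (*-congˡ (elemSym-scale n c (x ∘ suc) t)) (elemSym-scale n c (x ∘ suc) (suc t)))
    (solve 5 (λ c a b e f → c :* a :* (b :* e) :+ c :* b :* f := c :* b :* (a :* e :+ f)) refl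
      c (x 0) (c ^ t) (elemSym n (x ∘ suc) t) (elemSym n (x ∘ suc) (suc t)))

  ∏[1+y*x] : ∀ n x y → ∏ n (λ i → 1# + y * x i) ≈ eval (suc n) (elemSym n x) y
  ∏[1+y*x] zero    x y = sym (trans (+-congˡ (zeroʳ y)) (+-identityʳ 1#))
  ∏[1+y*x] (suc n) x y = begin
    (1# + y * x 0) * ∏ n (λ i → 1# + y * x′ i)
      ≈⟨ *-congˡ (∏[1+y*x] n x′ y) ⟩
    (1# + y * x 0) * (1# + y * F)
      ≈⟨ solve 4 (λ o y a f → (o :+ y :* a) :* (o :+ y :* f) :=
                              o :* o :+ y :* (a :* (o :+ y :* f) :+ o :* f)) refl 1# y (x 0) F ⟩
    1# * 1# + y * (x 0 * eval (suc n) (elemSym n x′) y + 1# * F)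
      ≈⟨ +-cong (*-identityˡ 1#) (*-congˡ (+-congˡ (*-identityˡ F))) ⟩
    1# + y * (x 0 * eval (suc n) (elemSym n x′) y + F)
      -- e_{n+1} of n variables vanishes, so the second sum may be lengthened by one coefficient to
      -- match the first.
      ≈⟨ +-congˡ (*-congˡ (+-cong (eval-* (suc n) (x 0) (elemSym n x′) y)
           (eval-truncate n (elemSym n x′ ∘ suc) y (elemSym-vanish n x′ (suc n) (ℕ.n<1+n n))))) ⟨
    1# + y * (eval (suc n) (λ t → x 0 * elemSym n x′ t) y + eval (suc n) (elemSym n x′ ∘ suc) y)
      ≈⟨ +-congˡ (*-congˡ (eval-+ (suc n) (λ t → x 0 * elemSym n x′ t) (elemSym n x′ ∘ suc) y)) ⟨
    eval (suc (suc n)) (elemSym (suc n) x) y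
      ∎
    where
    x′ = x ∘ suc
    F  = eval n (elemSym n x′ ∘ suc) y

-- Sums over increasing tuples as elementary symmetric functions

module IncreasingTuples (R : CommutativeRing 0ℓ 0ℓ) where

  open CommutativeRing R hiding (zero)
  open Evaluation R
  open import Relation.Binary.Reasoning.Setoid setoid

  ∑ : {A : Set} → List A → (A → Carrier) → Carrier
  ∑ xs f = List.foldr (λ x s → f x + s) 0# xs

  ∑-cong : {A : Set} (xs : List A) {f g : A → Carrier} → (∀ x → f x ≈ g x) → ∑ xs f ≈ ∑ xs g
  ∑-cong []       f≈g = refl
  ∑-cong (x ∷ xs) f≈g = +-cong (f≈g x) (∑-cong xs f≈g)

  ∑-++ : {A : Set} (xs ys : List A) (f : A → Carrier) → ∑ (xs ++ ys) f ≈ ∑ xs f + ∑ ys f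
  ∑-++ []       ys f = sym (+-identityˡ _)
  ∑-++ (x ∷ xs) ys f = trans (+-congˡ (∑-++ xs ys f)) (sym (+-assoc _ _ _))

  ∑-map : {A B : Set} (h : A → B) (xs : List A) (f : B → Carrier) → ∑ (List.map h xs) f ≈ ∑ xs (f ∘ h)
  ∑-map h []       f = refl
  ∑-map h (x ∷ xs) f = +-congˡ (∑-map h xs f)

  ∑-* : {A : Set} (c : Carrier) (xs : List A) (f : A → Carrier) → ∑ xs (λ x → c * f x) ≈ c * ∑ xs f
  ∑-* c []       f = sym (zeroʳ c)
  ∑-* c (x ∷ xs) f = trans (+-congˡ (∑-* c xs f)) (sym (distribˡ c _ _))

  ∑-cartesianProductWith : {A B C : Set} (h : A → B → C) (xs : List A) (ys : List B) (f : C → Carrier) →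
    ∑ (cartesianProductWith h xs ys) f ≈ ∑ xs (λ x → ∑ ys (λ y → f (h x y)))
  ∑-cartesianProductWith h []       ys f = refl
  ∑-cartesianProductWith h (x ∷ xs) ys f = trans (∑-++ (List.map (h x) ys) _ f)
    (+-cong (∑-map (h x) ys f) (∑-cartesianProductWith h xs ys f))

  -- Iverson bracket: it replaces the filter by a weight that factors along the tuple.
  [_]_ : Bool → Carrier → Carrier
  [ b ] x = if b then x else 0#

  ∑-filter : {A : Set} {P : Pred A 0ℓ} (P? : Decidable P) (xs : List A) (f : A → Carrier) →
    ∑ (filter P? xs) f ≈ ∑ xs (λ x → [ does (P? x) ] f x)
  ∑-filter P? []       f = refl
  ∑-filter P? (x ∷ xs) f with does (P? x)
  ... | true  = +-congˡ (∑-filter P? xs f)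
  ... | false = trans (∑-filter P? xs f) (sym (+-identityˡ _))

  []-∧ : ∀ a b x y → [ a ∧ b ] (x * y) ≈ ([ a ] x) * ([ b ] y)
  []-∧ true  true  x y = refl
  []-∧ true  false x y = sym (zeroʳ x)
  []-∧ false b     x y = sym (zeroˡ _)

  -- The range is m ≤ j < n.
  rangeSum : ℕ → ℕ → (ℕ → Carrier) → Carrier
  rangeSum zero    m       f = 0#
  rangeSum (suc n) zero    f = f 0 + rangeSum n 0 (f ∘ suc)
  rangeSum (suc n) (suc m) f = rangeSum n m (f ∘ suc)

  ∑-allFin-suc : ∀ n (f : Fin (suc n) → Carrier) → ∑ (allFin (suc n)) f ≈ f zero + ∑ (allFin n) (f ∘ suc)
  ∑-allFin-suc n f = +-congˡ (begin
    ∑ (tabulate Fin.suc) f            ≡⟨ ≡.cong (λ xs → ∑ xs f) (map-tabulate (λ i → i) suc) ⟨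
    ∑ (List.map suc (allFin n)) f     ≈⟨ ∑-map suc (allFin n) f ⟩
    ∑ (allFin n) (f ∘ suc)            ∎)

  ∑-allFin : ∀ n f → ∑ (allFin n) (f ∘ toℕ) ≈ rangeSum n 0 f
  ∑-allFin zero    f = refl
  ∑-allFin (suc n) f = trans (∑-allFin-suc n (f ∘ toℕ)) (+-congˡ (∑-allFin n (f ∘ suc)))

  -- The test decides m ≤ j; for m = i + 1 it is convertible to the decision of i < j in the tuples.
  ∑-allFin-> : ∀ n m f → ∑ (allFin n) (λ j → [ m ℕ.<ᵇ suc (toℕ j) ] f (toℕ j)) ≈ rangeSum n m f
  ∑-allFin-> zero    m       f = refl
  ∑-allFin-> (suc n) zero    f = ∑-allFin (suc n) f
  ∑-allFin-> (suc n) (suc m) f = begin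
    ∑ (allFin (suc n)) (λ j → [ suc m ℕ.<ᵇ suc (toℕ j) ] f (toℕ j))
      ≈⟨ ∑-allFin-suc n (λ j → [ suc m ℕ.<ᵇ suc (toℕ j) ] f (toℕ j)) ⟩
    0# + ∑ (allFin n) (λ j → [ m ℕ.<ᵇ suc (toℕ j) ] f (suc (toℕ j)))
      ≈⟨ +-identityˡ _ ⟩
    ∑ (allFin n) (λ j → [ m ℕ.<ᵇ suc (toℕ j) ] f (suc (toℕ j)))
      ≈⟨ ∑-allFin-> n m (f ∘ suc) ⟩
    rangeSum n m (f ∘ suc)
      ∎

  -- The elementary symmetric functions of the last variables only, x m up to x (n - 1).
  elemSymFrom : ℕ → ℕ → (ℕ → Carrier) → ℕ → Carrier
  elemSymFrom n       zero    x l = elemSym n x l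
  elemSymFrom zero    (suc m) x l = elemSym 0 x l
  elemSymFrom (suc n) (suc m) x l = elemSymFrom n m (x ∘ suc) l

  elemSymFrom-zero : ∀ n m x → elemSymFrom n m x 0 ≈ 1#
  elemSymFrom-zero n       zero    x = refl
  elemSymFrom-zero zero    (suc m) x = refl
  elemSymFrom-zero (suc n) (suc m) x = elemSymFrom-zero n m (x ∘ suc)

  -- Monomials are sorted by their smallest index j; all their other indices lie beyond j.
  elemSymFrom-suc : ∀ n m x l → elemSymFrom n m x (suc l) ≈ rangeSum n m (λ j → x j * elemSymFrom n (suc j) x l)
  elemSymFrom-suc zero    zero    x l = refl
  elemSymFrom-suc zero    (suc m) x l = refl
  elemSymFrom-suc (suc n) zero    x l = +-congˡ (elemSymFrom-suc n zero (x ∘ suc) l)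
  elemSymFrom-suc (suc n) (suc m) x l = elemSymFrom-suc n m (x ∘ suc) l

  ∏ᵛ : ∀ {n l} → (ℕ → Carrier) → Vec (Fin n) l → Carrier
  ∏ᵛ x []      = 1#
  ∏ᵛ x (i ∷ v) = x (toℕ i) * ∏ᵛ x v

  isIncreasing : ∀ {n l} → Vec (Fin n) l → Bool
  isIncreasing v = does (linked? Fin._<?_ v)

  -- The prefix constrains v only through its last entry i, so the increasing continuations
  -- contribute e_l of the variables after i.
  ∑-tails : ∀ n l x (i : Fin n) →
    ∑ (tuples n l) (λ v → [ isIncreasing (i ∷ v) ] ∏ᵛ x v) ≈ elemSymFrom n (suc (toℕ i)) x l
  ∑-tails n zero x i = trans (+-identityʳ 1#) (sym (elemSymFrom-zero n (suc (toℕ i)) x))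
  ∑-tails n (suc l) x i = begin
    ∑ (tuples n (suc l)) (λ v → [ isIncreasing (i ∷ v) ] ∏ᵛ x v)
      ≈⟨ ∑-cartesianProductWith _∷_ (allFin n) (tuples n l) _ ⟩
    ∑ (allFin n) (λ j → ∑ (tuples n l) (λ v → [ b j ∧ isIncreasing (j ∷ v) ] (x (toℕ j) * ∏ᵛ x v)))
      ≈⟨ ∑-cong (allFin n) (λ j → trans (∑-cong (tuples n l) (λ v → []-∧ (b j) (isIncreasing (j ∷ v)) (x (toℕ j)) (∏ᵛ x v)))
                                        (∑-* ([ b j ] x (toℕ j)) (tuples n l) _)) ⟩
    ∑ (allFin n) (λ j → ([ b j ] x (toℕ j)) * ∑ (tuples n l) (λ v → [ isIncreasing (j ∷ v) ] ∏ᵛ x v))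
      ≈⟨ ∑-cong (allFin n) (λ j → trans (*-congˡ (∑-tails n l x j)) ([]-* (b j) (x (toℕ j)) _)) ⟩
    ∑ (allFin n) (λ j → [ b j ] (x (toℕ j) * elemSymFrom n (suc (toℕ j)) x l))
      ≈⟨ ∑-allFin-> n (suc (toℕ i)) (λ j → x j * elemSymFrom n (suc j) x l) ⟩
    rangeSum n (suc (toℕ i)) (λ j → x j * elemSymFrom n (suc j) x l)
      ≈⟨ elemSymFrom-suc n (suc (toℕ i)) x l ⟨
    elemSymFrom n (suc (toℕ i)) x (suc l)
      ∎
    where
    b : Fin n → Bool
    b j = suc (toℕ i) ℕ.<ᵇ suc (toℕ j)
    []-* : ∀ a x y → ([ a ] x) * y ≈ [ a ] (x * y)
    []-* true  x y = refl
    []-* false x y = zeroˡ y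

  ∑-increasingTuples : ∀ n l x → ∑ (increasingTuples n l) (∏ᵛ x) ≈ elemSym n x l
  ∑-increasingTuples n zero x = +-identityʳ 1#
  ∑-increasingTuples n (suc l) x = begin
    ∑ (increasingTuples n (suc l)) (∏ᵛ x)
      ≈⟨ ∑-filter (linked? Fin._<?_) (tuples n (suc l)) (∏ᵛ x) ⟩
    ∑ (tuples n (suc l)) (λ v → [ isIncreasing v ] ∏ᵛ x v)
      ≈⟨ ∑-cartesianProductWith _∷_ (allFin n) (tuples n l) _ ⟩
    ∑ (allFin n) (λ j → ∑ (tuples n l) (λ v → [ isIncreasing (j ∷ v) ] (x (toℕ j) * ∏ᵛ x v)))
      ≈⟨ ∑-cong (allFin n) (λ j → trans (∑-cong (tuples n l) (λ v → []-∧ true (isIncreasing (j ∷ v)) (x (toℕ j)) (∏ᵛ x v)))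
                                 (trans (∑-* (x (toℕ j)) (tuples n l) _) (*-congˡ (∑-tails n l x j)))) ⟩
    ∑ (allFin n) (λ j → x (toℕ j) * elemSymFrom n (suc (toℕ j)) x l)
      ≈⟨ ∑-allFin n (λ j → x j * elemSymFrom n (suc j) x l) ⟩
    rangeSum n 0 (λ j → x j * elemSymFrom n (suc j) x l)
      ≈⟨ elemSymFrom-suc n 0 x l ⟨
    elemSym n x (suc l)
      ∎

-- Binomial coefficients and the coefficients of the power sums

module NaturalMultiples (R : CommutativeRing 0ℓ 0ℓ) where

  open CommutativeRing R hiding (zero)
  open Algebra.Properties.Semiring.Mult semiring using (_×_; ×-homo-+; ×1-homo-*)

  -- The unoptimised multiples: `# (suc n)` unfolds to `1# + # n` even for a variable n. Numerals
  -- therefore end in 0, which is why solver calls below spell 1 as `#1 :+ #0`.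
  # : ℕ → Carrier
  # n = n × 1#

  #-+ : ∀ m n → # (m ℕ.+ n) ≈ # m + # n
  #-+ = ×-homo-+ 1#

  #-* : ∀ m n → # (m ℕ.* n) ≈ # m * # n
  #-* = ×1-homo-*

  #-suc : ∀ n → # (suc n) ≈ # n + 1#
  #-suc n = +-comm 1# (# n)

private
  1+s+1+2s : ∀ s → suc (s ℕ.+ suc (s ℕ.+ s)) ≡ 2 ℕ.+ s ℕ.* 3
  1+s+1+2s = ℕSolver.solve-∀

  1+s+1+s+s : ∀ s → suc (s ℕ.+ suc s) ℕ.+ s ≡ 2 ℕ.+ s ℕ.* 3
  1+s+1+s+s = ℕSolver.solve-∀

module BinomialSums (R : CommutativeRing 0ℓ 0ℓ)
  (#-unit : ∀ n → Evaluation.IsUnit R (NaturalMultiples.# R (suc n))) where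

  open CommutativeRing R hiding (zero)
  open NaturalMultiples R
  open Evaluation R
  open IntegerSolver R using (solve; _:=_; _:+_; _:*_; _:-_; :-_; #0; #1; #3)
  open import Relation.Binary.Reasoning.Setoid setoid

  fallingFactorial : Carrier → ℕ → Carrier
  fallingFactorial α zero    = 1#
  fallingFactorial α (suc k) = fallingFactorial α k * (α - # k)

  1/_! : ℕ → Carrier
  1/ zero !  = 1#
  1/ suc k ! = 1/ k ! * IsUnit.inverse (#-unit k)

  binomial : Carrier → ℕ → Carrier
  binomial α k = fallingFactorial α k * 1/ k !

  1/suc! : ∀ k → # (suc k) * 1/ suc k ! ≈ 1/ k !
  1/suc! k = begin
    # (suc k) * (1/ k ! * u)  ≈⟨ solve 3 (λ n f u → n :* (f :* u) := f :* (n :* u)) refl (# (suc k)) (1/ k !) u ⟩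
    1/ k ! * (# (suc k) * u)  ≈⟨ *-congˡ (IsUnit.inverseʳ (#-unit k)) ⟩
    1/ k ! * 1#               ≈⟨ *-identityʳ _ ⟩
    1/ k !                    ∎
    where u = IsUnit.inverse (#-unit k)

  fallingFactorial-cong : ∀ {α β} k → α ≈ β → fallingFactorial α k ≈ fallingFactorial β k
  fallingFactorial-cong zero    α≈β = refl
  fallingFactorial-cong (suc k) α≈β = *-cong (fallingFactorial-cong k α≈β) (+-congʳ α≈β)

  binomial-cong : ∀ {α β} k → α ≈ β → binomial α k ≈ binomial β k
  binomial-cong k α≈β = *-congʳ (fallingFactorial-cong k α≈β)

  fallingFactorial-suc : ∀ α k → fallingFactorial (α + 1#) (suc k) ≈ (α + 1#) * fallingFactorial α k
  fallingFactorial-suc α zero = begin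
    1# * (α + 1# - 0#)      ≈⟨ *-congˡ (+-congˡ (-‿cong (-‿inverseʳ α))) ⟨
    1# * (α + 1# - (α - α)) ≈⟨ solve 1 (λ a → #1 :* (a :+ #1 :- (a :- a)) := (a :+ #1) :* #1) refl α ⟩
    (α + 1#) * 1#           ∎
  fallingFactorial-suc α (suc k) = begin
    fallingFactorial (α + 1#) (suc k) * (α + 1# - (1# + # k))  ≈⟨ *-congʳ (fallingFactorial-suc α k) ⟩
    (α + 1#) * fallingFactorial α k * (α + 1# - (1# + # k))
      ≈⟨ solve 3 (λ a f k → (a :+ #1) :* f :* (a :+ #1 :- (#1 :+ k)) := (a :+ #1) :* (f :* (a :- k))) refl α (fallingFactorial α k) (# k) ⟩
    (α + 1#) * (fallingFactorial α k * (α - # k))              ∎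

  binomial-absorb : ∀ α k → # (suc k) * binomial (α + 1#) (suc k) ≈ (α + 1#) * binomial α k
  binomial-absorb α k = begin
    # (suc k) * (fallingFactorial (α + 1#) (suc k) * 1/ suc k !)   ≈⟨ *-congˡ (*-congʳ (fallingFactorial-suc α k)) ⟩
    # (suc k) * ((α + 1#) * fallingFactorial α k * 1/ suc k !)
      ≈⟨ solve 4 (λ n a f r → n :* (a :* f :* r) := a :* (f :* (n :* r))) refl (# (suc k)) (α + 1#) (fallingFactorial α k) (1/ suc k !) ⟩
    (α + 1#) * (fallingFactorial α k * (# (suc k) * 1/ suc k !))   ≈⟨ *-congˡ (*-congˡ (1/suc! k)) ⟩
    (α + 1#) * (fallingFactorial α k * 1/ k !)                     ∎

  binomial-suc : ∀ α k → # (suc k) * binomial α (suc k) ≈ (α - # k) * binomial α k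
  binomial-suc α k = begin
    # (suc k) * (fallingFactorial α k * (α - # k) * 1/ suc k !)
      ≈⟨ solve 4 (λ n a f r → n :* (f :* a :* r) := a :* (f :* (n :* r))) refl (# (suc k)) (α - # k) (fallingFactorial α k) (1/ suc k !) ⟩
    (α - # k) * (fallingFactorial α k * (# (suc k) * 1/ suc k !))  ≈⟨ *-congˡ (*-congˡ (1/suc! k)) ⟩
    (α - # k) * (fallingFactorial α k * 1/ k !)                    ∎

  -- After multiplication by k + 1 every term is a multiple of C(α, k), and the rule reads α + 1 =
  -- (k + 1) + (α - k).
  pascal : ∀ α k → binomial (α + 1#) (suc k) ≈ binomial α k + binomial α (suc k)
  pascal α k = unit-cancel (#-unit k) (begin
    # (suc k) * binomial (α + 1#) (suc k)    ≈⟨ binomial-absorb α k ⟩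
    (α + 1#) * B                          ≈⟨ solve 3 (λ a k b → (a :+ #1) :* b := (#1 :+ k) :* b :+ (a :- k) :* b) refl α (# k) B ⟩
    # (suc k) * B + (α - # k) * B         ≈⟨ +-congˡ (binomial-suc α k) ⟨
    # (suc k) * B + # (suc k) * binomial α (suc k) ≈⟨ distribˡ _ _ _ ⟨
    # (suc k) * (B + binomial α (suc k))     ∎)
    where B = binomial α k

  fallingFactorial-vanish : ∀ n k → n < k → fallingFactorial (# n) k ≈ 0#
  fallingFactorial-vanish n (suc k) (s≤s n≤k) with ℕ.m≤n⇒m<n∨m≡n n≤k
  ... | inj₁ n<k    = trans (*-congʳ (fallingFactorial-vanish n k n<k)) (zeroˡ _)
  ... | inj₂ ≡.refl = trans (*-congˡ (-‿inverseʳ (# n))) (zeroʳ _)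

  binomial-vanish : ∀ {α} n k → α ≈ # n → n < k → binomial α k ≈ 0#
  binomial-vanish n k α≈n n<k =
    trans (*-congʳ (trans (fallingFactorial-cong k α≈n) (fallingFactorial-vanish n k n<k))) (zeroˡ _)

  3# : Carrier
  3# = 1# + 1# + 1#

  -- A third difference in the upper entry lowers the lower entry by 3: Pascal's rule writes every
  -- term through C(β, k), ..., C(β, k + 3).
  binomial-Δ³ : ∀ β k → binomial (β + 1# + 1# + 1#) (3 ℕ.+ k) ≈
             3# * binomial (β + 1# + 1#) (3 ℕ.+ k) - 3# * binomial (β + 1#) (3 ℕ.+ k) + binomial β (3 ℕ.+ k) + binomial β k
  binomial-Δ³ β k = begin
    B 3 3                                                   ≈⟨ B₃₃ ⟩
    x₀ + x₁ + (x₁ + x₂) + (x₁ + x₂ + (x₂ + x₃))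
      ≈⟨ solve 4 (λ a b c d → a :+ b :+ (b :+ c) :+ (b :+ c :+ (c :+ d)) :=
                              #3 :* (b :+ c :+ (c :+ d)) :- #3 :* (c :+ d) :+ d :+ a) refl x₀ x₁ x₂ x₃ ⟩
    3# * (x₁ + x₂ + (x₂ + x₃)) - 3# * (x₂ + x₃) + x₃ + x₀   ≈⟨ +-congʳ (+-congʳ (+-cong (*-congˡ B₂₃) (-‿cong (*-congˡ (p 0 2))))) ⟨
    3# * B 2 3 - 3# * B 1 3 + B 0 3 + B 0 0                 ∎
    where
    shift : ℕ → Carrier
    shift zero    = β
    shift (suc j) = shift j + 1#
    B : ℕ → ℕ → Carrier
    B j i = binomial (shift j) (i ℕ.+ k)
    p : ∀ j i → B (suc j) (suc i) ≈ B j i + B j (suc i)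
    p j i = pascal (shift j) (i ℕ.+ k)
    x₀ = B 0 0
    x₁ = B 0 1
    x₂ = B 0 2
    x₃ = B 0 3
    B₂₃ : B 2 3 ≈ x₁ + x₂ + (x₂ + x₃)
    B₂₃ = trans (p 1 2) (+-cong (p 0 1) (p 0 2))
    B₃₃ : B 3 3 ≈ x₀ + x₁ + (x₁ + x₂) + (x₁ + x₂ + (x₂ + x₃))
    B₃₃ = trans (p 2 2) (+-cong (trans (p 1 1) (+-cong (p 0 0) (p 0 1))) B₂₃)

  -- The coefficient of y ^ s in aᵅ + bᵅ + cᵅ, where a, b, c are the roots of
  -- (x - 1)³ = y x²; equal to α / s · binomial (α + 2 s - 1) (3 s - 1) for s > 0.
  G : Carrier → ℕ → Carrier
  G α s = binomial (α + # s + # s) (s ℕ.* 3) + (1# + 1#) * binomial (α + # s + # s - 1#) (s ℕ.* 3)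

  G-cong : ∀ {α β} s → α ≈ β → G α s ≈ G β s
  G-cong s α≈β = +-cong (binomial-cong (s ℕ.* 3) α≈β′) (*-congˡ (binomial-cong (s ℕ.* 3) (+-congʳ α≈β′)))
    where α≈β′ = +-congʳ (+-congʳ α≈β)

  -- At y = 0 all three roots are 1. Written with two binomials and without division by s, `G`
  -- covers this constant term too.
  G-zero : ∀ α → G α 0 ≈ 3#
  G-zero α = solve 0 (#1 :* #1 :+ (#1 :+ #1) :* (#1 :* #1) := #3) refl

  -- This is (x - 1)³ = y x², multiplied by x^α, summed over the roots and read at y^(s+1). Each
  -- binomial of `G` obeys it separately: lowering 3 (s + 1) by 3 under a fixed upper entry is the
  -- passage from (α, s + 1) to (α + 2, s).
  G-Δ³ : ∀ α s → G (α + 1# + 1# + 1#) (suc s) ≈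
    3# * G (α + 1# + 1#) (suc s) - 3# * G (α + 1#) (suc s) + G α (suc s) + G (α + 1# + 1#) s
  G-Δ³ α s = begin
    G (α + 1# + 1# + 1#) (suc s)
      ≈⟨ +-cong (trans (binomial-cong k β₃) (binomial-Δ³ β (s ℕ.* 3)))
                (*-congˡ (trans (binomial-cong k γ₃) (binomial-Δ³ γ (s ℕ.* 3)))) ⟩
    3# * b₂ - 3# * b₁ + b₀ + b + (1# + 1#) * (3# * c₂ - 3# * c₁ + c₀ + c)
      ≈⟨ solve 8 (λ b₂ b₁ b₀ b c₂ c₁ c₀ c →
           #3 :* b₂ :- #3 :* b₁ :+ b₀ :+ b :+ (#1 :+ #1) :* (#3 :* c₂ :- #3 :* c₁ :+ c₀ :+ c) :=
           #3 :* (b₂ :+ (#1 :+ #1) :* c₂) :- #3 :* (b₁ :+ (#1 :+ #1) :* c₁) :+ (b₀ :+ (#1 :+ #1) :* c₀)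
             :+ (b :+ (#1 :+ #1) :* c))
           refl b₂ b₁ b₀ b c₂ c₁ c₀ c ⟩
    3# * (b₂ + (1# + 1#) * c₂) - 3# * (b₁ + (1# + 1#) * c₁) + (b₀ + (1# + 1#) * c₀) + (b + (1# + 1#) * c)
      ≈⟨ +-cong (+-congʳ (+-cong (*-congˡ (+-cong (binomial-cong k β₂) (*-congˡ (binomial-cong k γ₂))))
                                 (-‿cong (*-congˡ (+-cong (binomial-cong k β₁) (*-congˡ (binomial-cong k γ₁)))))))
                (+-cong (binomial-cong (s ℕ.* 3) β₀) (*-congˡ (binomial-cong (s ℕ.* 3) γ₀))) ⟨
    3# * G (α + 1# + 1#) (suc s) - 3# * G (α + 1#) (suc s) + G α (suc s) + G (α + 1# + 1#) s
      ∎
    where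
    k = suc s ℕ.* 3
    n = # (suc s)
    β = α + n + n
    γ = α + n + n - 1#
    b₂ = binomial (β + 1# + 1#) k
    b₁ = binomial (β + 1#) k
    b₀ = binomial β k
    b  = binomial β (s ℕ.* 3)
    c₂ = binomial (γ + 1# + 1#) k
    c₁ = binomial (γ + 1#) k
    c₀ = binomial γ k
    c  = binomial γ (s ℕ.* 3)
    β₃ : α + 1# + 1# + 1# + n + n ≈ β + 1# + 1# + 1#
    β₃ = solve 2 (λ a n → a :+ #1 :+ #1 :+ #1 :+ n :+ n := a :+ n :+ n :+ #1 :+ #1 :+ #1) refl α n
    β₂ : α + 1# + 1# + n + n ≈ β + 1# + 1#
    β₂ = solve 2 (λ a n → a :+ #1 :+ #1 :+ n :+ n := a :+ n :+ n :+ #1 :+ #1) refl α n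
    β₁ : α + 1# + n + n ≈ β + 1#
    β₁ = solve 2 (λ a n → a :+ #1 :+ n :+ n := a :+ n :+ n :+ #1) refl α n
    β₀ : α + 1# + 1# + # s + # s ≈ β
    β₀ = solve 2 (λ a n → a :+ #1 :+ #1 :+ n :+ n := a :+ (#1 :+ n) :+ (#1 :+ n)) refl α (# s)
    γ₃ : α + 1# + 1# + 1# + n + n - 1# ≈ γ + 1# + 1# + 1#
    γ₃ = solve 2 (λ a n → a :+ #1 :+ #1 :+ #1 :+ n :+ n :- #1 := a :+ n :+ n :- #1 :+ #1 :+ #1 :+ #1) refl α n
    γ₂ : α + 1# + 1# + n + n - 1# ≈ γ + 1# + 1#
    γ₂ = solve 2 (λ a n → a :+ #1 :+ #1 :+ n :+ n :- #1 := a :+ n :+ n :- #1 :+ #1 :+ #1) refl α n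
    γ₁ : α + 1# + n + n - 1# ≈ γ + 1#
    γ₁ = solve 2 (λ a n → a :+ #1 :+ n :+ n :- #1 := a :+ n :+ n :- #1 :+ #1) refl α n
    γ₀ : α + 1# + 1# + # s + # s - 1# ≈ γ
    γ₀ = +-congʳ β₀

  G-closed : ∀ α t → α * binomial (α + # t + # t + 1#) (2 ℕ.+ t ℕ.* 3) ≈ # (suc t) * G α (suc t)
  G-closed α t = unit-cancel (#-unit 2) (begin
    # 3 * (α * C)
      -- 3 α = (β + 1) + 2 (β - k) for β = α + 2 t + 1 and k = 3 t + 2. Times C(β, k), the two parts
      -- are multiples of C(β + 1, k + 1) and C(β, k + 1), the binomials of `G α (suc t)`.
      ≈⟨ solve 3 (λ a t c → (#1 :+ (#1 :+ (#1 :+ #0))) :* (a :* c) :=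
           (a :+ t :+ t :+ #1 :+ #1) :* c :+ (#1 :+ #1) :* ((a :+ t :+ t :+ #1 :- (#1 :+ (#1 :+ t :* #3))) :* c)) refl α (# t) C ⟩
    (β + 1#) * C + (1# + 1#) * ((β - (1# + (1# + # t * 3#))) * C)
      ≈⟨ +-congˡ (*-congˡ (*-congʳ (+-congˡ (-‿cong (+-congˡ (+-congˡ #[t*3])))))) ⟨
    (β + 1#) * C + (1# + 1#) * ((β - # k) * C)
      ≈⟨ +-cong (binomial-absorb β k) (*-congˡ (binomial-suc β k)) ⟨
    # (suc k) * binomial (β + 1#) (suc k) + (1# + 1#) * (# (suc k) * binomial β (suc k))
      ≈⟨ solve 3 (λ k b c → k :* b :+ (#1 :+ #1) :* (k :* c) := k :* (b :+ (#1 :+ #1) :* c)) refl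
           (# (suc k)) (binomial (β + 1#) (suc k)) (binomial β (suc k)) ⟩
    # (suc k) * (binomial (β + 1#) (suc k) + (1# + 1#) * binomial β (suc k))
      ≈⟨ *-congˡ (+-cong (binomial-cong (suc k) β₁) (*-congˡ (binomial-cong (suc k) β₀))) ⟩
    # (suc k) * G α (suc t)
      ≈⟨ *-congʳ (trans (reflexive (≡.cong # (ℕ.*-comm (suc t) 3))) (#-* 3 (suc t))) ⟩
    # 3 * # (suc t) * G α (suc t)
      ≈⟨ *-assoc _ _ _ ⟩
    # 3 * (# (suc t) * G α (suc t))
      ∎)
    where
    k = 2 ℕ.+ t ℕ.* 3
    β = α + # t + # t + 1#
    C = binomial β k
    #[t*3] : # (t ℕ.* 3) ≈ # t * 3#
    #[t*3] = trans (#-* t 3) (*-congˡ (solve 0 (#1 :+ (#1 :+ (#1 :+ #0)) := #3) refl))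
    β₁ : β + 1# ≈ α + # (suc t) + # (suc t)
    β₁ = solve 2 (λ a n → a :+ n :+ n :+ #1 :+ #1 := a :+ (#1 :+ n) :+ (#1 :+ n)) refl α (# t)
    β₀ : β ≈ α + # (suc t) + # (suc t) - 1#
    β₀ = solve 2 (λ a n → a :+ n :+ n :+ #1 := a :+ (#1 :+ n) :+ (#1 :+ n) :- #1) refl α (# t)

  -- Both upper entries are natural numbers, n + 1 and n, smaller than the lower entry 3 s.
  G-vanish : ∀ α s n → α + # s + # s - 1# ≈ # n → suc n < s ℕ.* 3 → G α s ≈ 0#
  G-vanish α s n eq n< = begin
    binomial (α + # s + # s) (s ℕ.* 3) + (1# + 1#) * binomial (α + # s + # s - 1#) (s ℕ.* 3)
      ≈⟨ +-cong (binomial-vanish (suc n) _ eq′ n<) (*-congˡ (binomial-vanish n _ eq (ℕ.<-trans (ℕ.n<1+n n) n<))) ⟩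
    0# + (1# + 1#) * 0#  ≈⟨ +-identityˡ _ ⟩
    (1# + 1#) * 0#       ≈⟨ zeroʳ _ ⟩
    0#                   ∎
    where
    eq′ : α + # s + # s ≈ # (suc n)
    eq′ = begin
      α + # s + # s             ≈⟨ solve 1 (λ x → x := #1 :+ (x :- #1)) refl (α + # s + # s) ⟩
      1# + (α + # s + # s - 1#) ≈⟨ +-congˡ eq ⟩
      1# + # n                  ∎

  -- This bounds the degree of aⁿ + bⁿ + cⁿ in y by n.
  G-vanish-# : ∀ n s → n < s → G (# n) s ≈ 0#
  G-vanish-# n (suc s) (s≤s n≤s) = G-vanish (# n) (suc s) (n ℕ.+ suc (s ℕ.+ s)) (begin
    # n + # (suc s) + # (suc s) - 1#    ≈⟨ solve 2 (λ n s → n :+ (#1 :+ s) :+ (#1 :+ s) :- #1 := n :+ (#1 :+ (s :+ s))) refl (# n) (# s) ⟩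
    # n + (1# + (# s + # s))            ≈⟨ +-congˡ (+-congˡ (#-+ s s)) ⟨
    # n + # (suc (s ℕ.+ s))             ≈⟨ #-+ n (suc (s ℕ.+ s)) ⟨
    # (n ℕ.+ suc (s ℕ.+ s))             ∎)
    (s≤s (ℕ.≤-trans (s≤s (ℕ.+-monoˡ-≤ (suc (s ℕ.+ s)) n≤s))
      (ℕ.≤-reflexive (1+s+1+2s s))))

  -- For s > n the upper entry -n + 2 s - 1 is still a natural number, at least s, so the vanishing
  -- criterion applies to negative exponents as well.
  G-vanish-neg : ∀ n s → n < s → G (- # n) s ≈ 0#
  G-vanish-neg n (suc s) (s≤s n≤s) with ℕ.m≤n⇒∃[o]m+o≡n n≤s
  ... | e , ≡.refl = G-vanish (- # n) (suc s) (e ℕ.+ suc s) (begin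
    - # n + # (suc s) + # (suc s) - 1#  ≈⟨ +-congʳ (+-congʳ (+-congˡ (+-congˡ (#-+ n e)))) ⟩
    - # n + (1# + (# n + # e)) + # (suc s) - 1#
      ≈⟨ solve 3 (λ n e s → :- n :+ (#1 :+ (n :+ e)) :+ s :- #1 := e :+ s) refl (# n) (# e) (# (suc s)) ⟩
    # e + # (suc s)                     ≈⟨ #-+ e (suc s) ⟨
    # (e ℕ.+ suc s)                     ∎)
    (s≤s (ℕ.≤-trans (s≤s (ℕ.+-monoˡ-≤ (suc s) (ℕ.m≤n+m e n)))
      (ℕ.≤-trans (ℕ.m≤m+n _ s)
      (ℕ.≤-reflexive (1+s+1+s+s s)))))

  binomial-diagonal : ∀ n → binomial (# n) n ≈ 1#
  binomial-diagonal zero    = *-identityˡ 1#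
  binomial-diagonal (suc n) = unit-cancel (#-unit n) (begin
    # (suc n) * binomial (# (suc n)) (suc n)   ≈⟨ *-congˡ (binomial-cong (suc n) (#-suc n)) ⟩
    # (suc n) * binomial (# n + 1#) (suc n)    ≈⟨ binomial-absorb (# n) n ⟩
    (# n + 1#) * binomial (# n) n              ≈⟨ *-cong (sym (#-suc n)) (binomial-diagonal n) ⟩
    # (suc n) * 1#                          ∎)

-- Power sums of the roots of the cubic

private
  1+s+2s : ∀ s → suc s ℕ.+ (s ℕ.+ s) ≡ suc (s ℕ.* 3)
  1+s+2s = ℕSolver.solve-∀

module TrinomialRoots (R : CommutativeRing 0ℓ 0ℓ)
  (#-unit : ∀ n → Evaluation.IsUnit R (NaturalMultiples.# R (suc n))) where

  open CommutativeRing R hiding (zero)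
  open NaturalMultiples R
  open Evaluation R
  open BinomialSums R #-unit
  open IntegerSolver R using (solve; _:=_; _:+_; _:*_; _:-_; :-_; #0; #1; #3)
  open import Relation.Binary.Reasoning.Setoid setoid

  powerSum : Carrier → Carrier → Carrier → ℕ → Carrier
  powerSum a b c n = a ^ n + b ^ n + c ^ n

  -- Each of a, b, c satisfies x³ = e₁ x² - e₂ x + e₃; this is multiplied by xⁿ and summed.
  newton : ∀ a b c n → powerSum a b c (3 ℕ.+ n) ≈
    (a + b + c) * powerSum a b c (2 ℕ.+ n) - (a * b + b * c + c * a) * powerSum a b c (1 ℕ.+ n)
      + a * b * c * powerSum a b c n
  newton a b c n = solve 6 (λ a b c x y z →
    a :* (a :* (a :* x)) :+ b :* (b :* (b :* y)) :+ c :* (c :* (c :* z)) :=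
    (a :+ b :+ c) :* (a :* (a :* x) :+ b :* (b :* y) :+ c :* (c :* z))
      :- (a :* b :+ b :* c :+ c :* a) :* (a :* x :+ b :* y :+ c :* z)
      :+ a :* b :* c :* (x :+ y :+ z)) refl a b c (a ^ n) (b ^ n) (c ^ n)

  -- (X - 1)³ - y X² = (X - a)(X - b)(X - c)
  record Roots (y : Carrier) : Set where
    field
      a b c : Carrier
      sum   : a + b + c ≈ 3# + y
      pairs : a * b + b * c + c * a ≈ 3#
      prod  : a * b * c ≈ 1#

    -- As abc = 1, the products bc, ca, ab are the inverses of a, b, c, so `p⁻ n` is the power sum
    -- with exponent -n.
    p p⁻ : ℕ → Carrier
    p  = powerSum a b c
    p⁻ = powerSum (b * c) (c * a) (a * b)

    p-suc : ∀ n → p (3 ℕ.+ n) ≈ (3# + y) * p (2 ℕ.+ n) - 3# * p (1 ℕ.+ n) + p n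
    p-suc n = trans (newton a b c n)
      (+-cong (+-cong (*-congʳ sum) (-‿cong (*-congʳ pairs))) (trans (*-congʳ prod) (*-identityˡ _)))

    -- Inverting the roots exchanges the first two elementary symmetric functions, because the third
    -- is 1.
    p⁻-suc : ∀ n → p⁻ (3 ℕ.+ n) ≈ 3# * p⁻ (2 ℕ.+ n) - (3# + y) * p⁻ (1 ℕ.+ n) + p⁻ n
    p⁻-suc n = trans (newton (b * c) (c * a) (a * b) n)
      (+-cong (+-cong (*-congʳ sum⁻) (-‿cong (*-congʳ pairs⁻))) (trans (*-congʳ prod⁻) (*-identityˡ _)))
      where
      sum⁻ : b * c + c * a + a * b ≈ 3#
      sum⁻ = trans (solve 3 (λ a b c → b :* c :+ c :* a :+ a :* b := a :* b :+ b :* c :+ c :* a) refl a b c) pairs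
      pairs⁻ : b * c * (c * a) + c * a * (a * b) + a * b * (b * c) ≈ 3# + y
      pairs⁻ = begin
        b * c * (c * a) + c * a * (a * b) + a * b * (b * c)
          ≈⟨ solve 3 (λ a b c → b :* c :* (c :* a) :+ c :* a :* (a :* b) :+ a :* b :* (b :* c)
                        := a :* b :* c :* (a :+ b :+ c)) refl a b c ⟩
        a * b * c * (a + b + c)   ≈⟨ *-cong prod sum ⟩
        1# * (3# + y)             ≈⟨ *-identityˡ _ ⟩
        3# + y                    ∎
      prod⁻ : b * c * (c * a) * (a * b) ≈ 1#
      prod⁻ = begin
        b * c * (c * a) * (a * b)   ≈⟨ solve 3 (λ a b c → b :* c :* (c :* a) :* (a :* b) := a :* b :* c :* (a :* b :* c)) refl a b c ⟩
        a * b * c * (a * b * c)     ≈⟨ *-cong prod prod ⟩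
        1# * 1#                     ≈⟨ *-identityˡ 1# ⟩
        1#                          ∎

    -- The constant term of the expansion is (abc)ⁿ - 1 = 0, and the pairwise products of the powers
    -- are powers of the inverses.
    ∏[xⁿ-1] : ∀ n → (a ^ n - 1#) * (b ^ n - 1#) * (c ^ n - 1#) ≈ p n - p⁻ n
    ∏[xⁿ-1] n = begin
      (A - 1#) * (B - 1#) * (C - 1#)
        ≈⟨ solve 3 (λ a b c → (a :- #1) :* (b :- #1) :* (c :- #1) :=
             a :+ b :+ c :- (b :* c :+ c :* a :+ a :* b) :+ (a :* b :* c :- #1)) refl A B C ⟩
      A + B + C - (B * C + C * A + A * B) + (A * B * C - 1#)
        ≈⟨ +-cong (+-congˡ (-‿cong (+-cong (+-cong (^-distrib-* b c n) (^-distrib-* c a n)) (^-distrib-* a b n))))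
                  (sym (x≈y⇒x-y≈0 (sym ABC))) ⟨
      p n - p⁻ n + 0#
        ≈⟨ +-identityʳ _ ⟩
      p n - p⁻ n
        ∎
      where
      A = a ^ n
      B = b ^ n
      C = c ^ n
      ABC : 1# ≈ A * B * C
      ABC = begin
        1#              ≈⟨ 1^n≈1 n ⟨
        1# ^ n          ≈⟨ ^-congˡ n prod ⟨
        (a * b * c) ^ n ≈⟨ ^-distrib-* (a * b) c n ⟩
        (a * b) ^ n * C ≈⟨ *-congʳ (^-distrib-* a b n) ⟩
        A * B * C       ∎

    module _ (m : ℕ) where

      P : Carrier → Carrier
      P α = eval (suc m) (G α) y

      P-cong : ∀ {α β} → α ≈ β → P α ≈ P β
      P-cong α≈β = eval-cong (suc m) y (λ s _ → G-cong s α≈β)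

      -- `P` is cut off after yᵐ. Multiplication by y pushes the coefficient `G (α + 1# + 1#) m`
      -- past the cut, so the recurrence survives where that coefficient vanishes.
      P-Δ³ : ∀ α → G (α + 1# + 1#) m ≈ 0# →
             P (α + 1# + 1# + 1#) ≈ (3# + y) * P (α + 1# + 1#) - 3# * P (α + 1#) + P α
      P-Δ³ α truncated = begin
        P₃
          ≈⟨ solve 4 (λ x a b c → x := #3 :* a :- #3 :* b :+ c :+ (x :- #3 :* a :+ #3 :* b :- c)) refl P₃ P₂ P₁ P₀ ⟩
        3# * P₂ - 3# * P₁ + P₀ + (P₃ - 3# * P₂ + 3# * P₁ - P₀)
          ≈⟨ +-congˡ difference ⟩
        3# * P₂ - 3# * P₁ + P₀ + y * P₂
          ≈⟨ solve 4 (λ y a b c → #3 :* a :- #3 :* b :+ c :+ y :* a := (#3 :+ y) :* a :- #3 :* b :+ c) refl y P₂ P₁ P₀ ⟩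
        (3# + y) * P₂ - 3# * P₁ + P₀
          ∎
        where
        g₃ = G (α + 1# + 1# + 1#)
        g₂ = G (α + 1# + 1#)
        g₁ = G (α + 1#)
        g₀ = G α
        P₃ = P (α + 1# + 1# + 1#)
        P₂ = P (α + 1# + 1#)
        P₁ = P (α + 1#)
        P₀ = P α
        d : ℕ → Carrier
        d s = g₃ s - 3# * g₂ s + 3# * g₁ s - g₀ s
        d-zero : d 0 ≈ 0#
        d-zero = trans
          (+-cong (+-cong (+-cong (G-zero (α + 1# + 1# + 1#)) (-‿cong (*-congˡ (G-zero (α + 1# + 1#)))))
                          (*-congˡ (G-zero (α + 1#)))) (-‿cong (G-zero α)))
          (solve 0 (#3 :- #3 :* #3 :+ #3 :* #3 :- #3 := #0) refl)
        d-suc : ∀ s → d (suc s) ≈ g₂ s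
        d-suc s = trans (+-congʳ (+-congʳ (+-congʳ (G-Δ³ α s))))
          (solve 4 (λ a b c e → #3 :* a :- #3 :* b :+ c :+ e :- #3 :* a :+ #3 :* b :- c := e) refl
            (g₂ (suc s)) (g₁ (suc s)) (g₀ (suc s)) (g₂ s))
        difference : P₃ - 3# * P₂ + 3# * P₁ - P₀ ≈ y * P₂
        difference = begin
          P₃ - 3# * P₂ + 3# * P₁ - P₀
            ≈⟨ +-congʳ (+-cong (+-congˡ (-‿cong (eval-* (suc m) 3# g₂ y))) (eval-* (suc m) 3# g₁ y)) ⟨
          P₃ - eval (suc m) (λ s → 3# * g₂ s) y + eval (suc m) (λ s → 3# * g₁ s) y - P₀
            ≈⟨ +-congʳ (+-congʳ (eval-sub (suc m) g₃ (λ s → 3# * g₂ s) y)) ⟨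
          eval (suc m) (λ s → g₃ s - 3# * g₂ s) y + eval (suc m) (λ s → 3# * g₁ s) y - P₀
            ≈⟨ +-congʳ (eval-+ (suc m) (λ s → g₃ s - 3# * g₂ s) (λ s → 3# * g₁ s) y) ⟨
          eval (suc m) (λ s → g₃ s - 3# * g₂ s + 3# * g₁ s) y - P₀
            ≈⟨ eval-sub (suc m) (λ s → g₃ s - 3# * g₂ s + 3# * g₁ s) g₀ y ⟨
          eval (suc m) d y
            ≈⟨ +-cong d-zero (*-congˡ (eval-cong m y (λ s _ → d-suc s))) ⟩
          0# + y * eval m g₂ y
            ≈⟨ +-identityˡ _ ⟩
          y * eval m g₂ y
            ≈⟨ *-congˡ (eval-truncate m g₂ y truncated) ⟨
          y * P₂
            ∎

      P-constant : ∀ α → (∀ s → G α (suc s) ≈ 0#) → P α ≈ 3#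
      P-constant α vanish = begin
        G α 0 + y * eval m (G α ∘ suc) y  ≈⟨ +-cong (G-zero α) (*-congˡ (eval-zero m y vanish)) ⟩
        3# + y * 0#                       ≈⟨ +-congˡ (zeroʳ y) ⟩
        3# + 0#                           ≈⟨ +-identityʳ 3# ⟩
        3#                                ∎

      P-zero : P (# 0) ≈ 3#
      P-zero = P-constant (# 0) λ s → G-vanish-# 0 (suc s) z<s

      P-neg-one : P (- # 1) ≈ 3#
      P-neg-one = P-constant (- # 1) λ s → G-vanish (- # 1) (suc s) (s ℕ.+ s)
        (begin
          - # 1 + # (suc s) + # (suc s) - 1#
            ≈⟨ solve 1 (λ s → :- (#1 :+ #0) :+ (#1 :+ s) :+ (#1 :+ s) :- #1 := s :+ s) refl (# s) ⟩
          # s + # s       ≈⟨ #-+ s s ⟨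
          # (s ℕ.+ s)     ∎)
        (s≤s (s≤s (ℕ.≤-trans (ℕ.m≤n+m _ (suc s)) (ℕ.≤-reflexive (1+s+2s s)))))

    P-one : ∀ m → 1 ≤ m → P m (# 1) ≈ 3# + y
    P-one (suc m) _ = begin
      G (# 1) 0 + y * (G (# 1) 1 + y * eval m (λ s → G (# 1) (2 ℕ.+ s)) y)
        ≈⟨ +-cong (G-zero (# 1)) (*-congˡ (+-cong G₁₁
             (trans (*-congˡ (eval-zero m y λ s → G-vanish-# 1 (2 ℕ.+ s) (s≤s (s≤s z≤n)))) (zeroʳ y)))) ⟩
      3# + y * (1# + 0#)
        ≈⟨ +-congˡ (trans (*-congˡ (+-identityʳ 1#)) (*-identityʳ y)) ⟩
      3# + y
        ∎
      where
      G₁₁ : G (# 1) 1 ≈ 1#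
      G₁₁ = begin
        binomial (# 1 + # 1 + # 1) 3 + (1# + 1#) * binomial (# 1 + # 1 + # 1 - 1#) 3
          ≈⟨ +-cong (trans (binomial-cong 3 (solve 0 (#1 :+ #0 :+ (#1 :+ #0) :+ (#1 :+ #0) := #1 :+ (#1 :+ (#1 :+ #0))) refl)) (binomial-diagonal 3))
                    (*-congˡ (binomial-vanish 2 3 (solve 0 (#1 :+ #0 :+ (#1 :+ #0) :+ (#1 :+ #0) :- #1 := #1 :+ (#1 :+ #0)) refl)
                                (ℕ.n<1+n 2))) ⟩
        1# + (1# + 1#) * 0#   ≈⟨ +-congˡ (zeroʳ _) ⟩
        1# + 0#               ≈⟨ +-identityʳ 1# ⟩
        1#                    ∎

    -- Both sides satisfy the same third-order recurrence in n.
    eval-G-# : ∀ m n → 1 ≤ m → n ≤ m → eval (suc m) (G (# n)) y ≈ p n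
    eval-G-# m 0 1≤m _ = P-zero m
    eval-G-# m 1 1≤m _ = trans (P-one m 1≤m) (sym (trans (p-one) sum))
      where
      p-one : p 1 ≈ a + b + c
      p-one = +-cong (+-cong (*-identityʳ a) (*-identityʳ b)) (*-identityʳ c)
    -- The recurrence starts at -1, where the sum is 3 because ab + bc + ca = 3. Together with the
    -- values at 0 and 1 this gives the exponent 2; the cut-off asks for `G (# 1) m` to vanish,
    -- which is m ≥ 2.
    eval-G-# m 2 1≤m 2≤m = begin
      P m (# 2)
        ≈⟨ P-cong m (solve 0 (#1 :+ (#1 :+ #0) := :- (#1 :+ #0) :+ #1 :+ #1 :+ #1) refl) ⟩
      P m (- # 1 + 1# + 1# + 1#)
        ≈⟨ P-Δ³ m (- # 1) (trans (G-cong m (sym α₁)) (G-vanish-# 1 m 2≤m)) ⟩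
      (3# + y) * P m (- # 1 + 1# + 1#) - 3# * P m (- # 1 + 1#) + P m (- # 1)
        ≈⟨ +-cong (+-cong (*-congˡ (trans (P-cong m (sym α₁)) (P-one m 1≤m)))
             (-‿cong (*-congˡ (trans (P-cong m (sym α₀)) (P-zero m))))) (P-neg-one m) ⟩
      (3# + y) * (3# + y) - 3# * 3# + 3#
        ≈⟨ solve 1 (λ y → (#3 :+ y) :* (#3 :+ y) :- #3 :* #3 :+ #3 := (#3 :+ y) :* (#3 :+ y) :- (#3 :+ #3)) refl y ⟩
      (3# + y) * (3# + y) - (3# + 3#)
        ≈⟨ +-cong (*-cong sum sum) (-‿cong (+-cong pairs pairs)) ⟨
      (a + b + c) * (a + b + c) - (a * b + b * c + c * a + (a * b + b * c + c * a))
        ≈⟨ solve 3 (λ a b c → (a :+ b :+ c) :* (a :+ b :+ c) :- (a :* b :+ b :* c :+ c :* a :+ (a :* b :+ b :* c :+ c :* a))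
             := a :* (a :* #1) :+ b :* (b :* #1) :+ c :* (c :* #1)) refl a b c ⟩
      p 2
        ∎
      where
      α₁ : # 1 ≈ - # 1 + 1# + 1#
      α₁ = solve 0 (#1 :+ #0 := :- (#1 :+ #0) :+ #1 :+ #1) refl
      α₀ : # 0 ≈ - # 1 + 1#
      α₀ = solve 0 (#0 := :- (#1 :+ #0) :+ #1) refl
    eval-G-# m (suc (suc (suc n))) 1≤m 3+n≤m = begin
      P m (# (3 ℕ.+ n))
        ≈⟨ P-cong m (solve 1 (λ n → #1 :+ (#1 :+ (#1 :+ n)) := n :+ #1 :+ #1 :+ #1) refl (# n)) ⟩
      P m (# n + 1# + 1# + 1#)
        ≈⟨ P-Δ³ m (# n) (trans (G-cong m (sym α₂)) (G-vanish-# (2 ℕ.+ n) m 3+n≤m)) ⟩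
      (3# + y) * P m (# n + 1# + 1#) - 3# * P m (# n + 1#) + P m (# n)
        ≈⟨ +-cong (+-cong (*-congˡ (trans (P-cong m (sym α₂)) (eval-G-# m (suc (suc n)) 1≤m 2+n≤m)))
             (-‿cong (*-congˡ (trans (P-cong m (sym α₁)) (eval-G-# m (suc n) 1≤m 1+n≤m))))) (eval-G-# m n 1≤m (ℕ.<⇒≤ 1+n≤m)) ⟩
      (3# + y) * p (2 ℕ.+ n) - 3# * p (1 ℕ.+ n) + p n
        ≈⟨ p-suc n ⟨
      p (3 ℕ.+ n)
        ∎
      where
      2+n≤m = ℕ.<⇒≤ 3+n≤m
      1+n≤m = ℕ.<⇒≤ 2+n≤m
      α₂ : # (2 ℕ.+ n) ≈ # n + 1# + 1#
      α₂ = solve 1 (λ n → #1 :+ (#1 :+ n) := n :+ #1 :+ #1) refl (# n)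
      α₁ : # (1 ℕ.+ n) ≈ # n + 1#
      α₁ = #-suc n

    -- The recurrence is run downwards: the other terms are added and subtracted to isolate the
    -- lowest one. The values at 1, 0 and -1 start the descent.
    eval-G-neg : ∀ m n → 1 ≤ m → n ≤ m → eval (suc m) (G (- # n)) y ≈ p⁻ n
    eval-G-neg m 0 1≤m _ = trans (P-cong m (solve 0 (:- #0 := #0) refl)) (P-zero m)
    eval-G-neg m 1 1≤m _ = trans (P-neg-one m) (sym (trans
      (solve 3 (λ a b c → b :* c :* #1 :+ c :* a :* #1 :+ a :* b :* #1 := a :* b :+ b :* c :+ c :* a) refl a b c) pairs))
    eval-G-neg m 2 1≤m 2≤m = begin
      P m (- # 2)
        ≈⟨ solve 4 (λ y a b x → x := (#3 :+ y) :* a :- #3 :* b :+ x :- ((#3 :+ y) :* a :- #3 :* b)) refl y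
             (P m (# 0)) (P m (- # 1)) (P m (- # 2)) ⟩
      (3# + y) * P m (# 0) - 3# * P m (- # 1) + P m (- # 2) - ((3# + y) * P m (# 0) - 3# * P m (- # 1))
        ≈⟨ +-congʳ (+-congʳ (+-cong (*-congˡ (P-cong m α₀)) (-‿cong (*-congˡ (P-cong m α₁))))) ⟩
      (3# + y) * P m (- # 2 + 1# + 1#) - 3# * P m (- # 2 + 1#) + P m (- # 2) - ((3# + y) * P m (# 0) - 3# * P m (- # 1))
        ≈⟨ +-cong (P-Δ³ m (- # 2) (trans (G-cong m (sym α₀)) (G-vanish-# 0 m 1≤m)))
             (-‿cong (+-cong (*-congˡ (sym (P-zero m))) (-‿cong (*-congˡ (sym (P-neg-one m)))))) ⟨
      P m (- # 2 + 1# + 1# + 1#) - ((3# + y) * 3# - 3# * 3#)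
        ≈⟨ +-congʳ (trans (P-cong m (solve 0 (:- (#1 :+ (#1 :+ #0)) :+ #1 :+ #1 :+ #1 := #1 :+ #0) refl)) (P-one m 1≤m)) ⟩
      3# + y - ((3# + y) * 3# - 3# * 3#)
        -- The aim is e₂² - 2 e₁ e₃, the sum of the squares of bc, ca and ab.
        ≈⟨ solve 1 (λ y → #3 :+ y :- ((#3 :+ y) :* #3 :- #3 :* #3) := #3 :* #3 :- #1 :* (#3 :+ y) :- #1 :* (#3 :+ y)) refl y ⟩
      3# * 3# - 1# * (3# + y) - 1# * (3# + y)
        ≈⟨ +-cong (+-cong (*-cong pairs pairs) (-‿cong (*-cong prod sum))) (-‿cong (*-cong prod sum)) ⟨
      e * e - a * b * c * (a + b + c) - a * b * c * (a + b + c)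
        ≈⟨ solve 3 (λ a b c → (a :* b :+ b :* c :+ c :* a) :* (a :* b :+ b :* c :+ c :* a)
             :- a :* b :* c :* (a :+ b :+ c) :- a :* b :* c :* (a :+ b :+ c)
             := b :* c :* (b :* c :* #1) :+ c :* a :* (c :* a :* #1) :+ a :* b :* (a :* b :* #1)) refl a b c ⟩
      p⁻ 2
        ∎
      where
      e = a * b + b * c + c * a
      α₀ : # 0 ≈ - # 2 + 1# + 1#
      α₀ = solve 0 (#0 := :- (#1 :+ (#1 :+ #0)) :+ #1 :+ #1) refl
      α₁ : - # 1 ≈ - # 2 + 1#
      α₁ = solve 0 (:- (#1 :+ #0) := :- (#1 :+ (#1 :+ #0)) :+ #1) refl
    eval-G-neg m (suc (suc (suc n))) 1≤m 3+n≤m = begin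
      P₃
        ≈⟨ solve 4 (λ y a b x → x := (#3 :+ y) :* a :- #3 :* b :+ x :+ #3 :* b :- (#3 :+ y) :* a) refl y P₁ P₂ P₃ ⟩
      (3# + y) * P₁ - 3# * P₂ + P₃ + 3# * P₂ - (3# + y) * P₁
        ≈⟨ +-congʳ (+-congʳ (+-congʳ (+-cong (*-congˡ (P-cong m α₁)) (-‿cong (*-congˡ (P-cong m α₂)))))) ⟩
      (3# + y) * P m (α + 1# + 1#) - 3# * P m (α + 1#) + P₃ + 3# * P₂ - (3# + y) * P₁
        ≈⟨ +-congʳ (+-congʳ (P-Δ³ m α (trans (G-cong m (sym α₁)) (G-vanish-neg (1 ℕ.+ n) m 2+n≤m)))) ⟨
      P m (α + 1# + 1# + 1#) + 3# * P₂ - (3# + y) * P₁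
        ≈⟨ +-cong (+-cong (trans (P-cong m α₀) (eval-G-neg m n 1≤m (ℕ.<⇒≤ 1+n≤m)))
             (*-congˡ (eval-G-neg m (suc (suc n)) 1≤m 2+n≤m))) (-‿cong (*-congˡ (eval-G-neg m (suc n) 1≤m 1+n≤m))) ⟩
      p⁻ n + 3# * p⁻ (2 ℕ.+ n) - (3# + y) * p⁻ (1 ℕ.+ n)
        ≈⟨ solve 3 (λ a b c → a :+ b :- c := b :- c :+ a) refl _ _ _ ⟩
      3# * p⁻ (2 ℕ.+ n) - (3# + y) * p⁻ (1 ℕ.+ n) + p⁻ n
        ≈⟨ p⁻-suc n ⟨
      p⁻ (3 ℕ.+ n)
        ∎
      where
      2+n≤m = ℕ.<⇒≤ 3+n≤m
      1+n≤m = ℕ.<⇒≤ 2+n≤m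
      α  = - # (3 ℕ.+ n)
      P₁ = P m (- # (1 ℕ.+ n))
      P₂ = P m (- # (2 ℕ.+ n))
      P₃ = P m α
      α₀ : α + 1# + 1# + 1# ≈ - # n
      α₀ = solve 1 (λ n → :- (#1 :+ (#1 :+ (#1 :+ n))) :+ #1 :+ #1 :+ #1 := :- n) refl (# n)
      α₁ : - # (1 ℕ.+ n) ≈ α + 1# + 1#
      α₁ = solve 1 (λ n → :- (#1 :+ n) := :- (#1 :+ (#1 :+ (#1 :+ n))) :+ #1 :+ #1) refl (# n)
      α₂ : - # (2 ℕ.+ n) ≈ α + 1#
      α₂ = solve 1 (λ n → :- (#1 :+ (#1 :+ n)) := :- (#1 :+ (#1 :+ (#1 :+ n))) :+ #1) refl (# n)

-- Rational values of y for which the cubic splits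

private
  cube : ℕ → ℕ
  cube n = n ℕ.* (n ℕ.* n)

  square : ℕ → ℕ
  square n = n ℕ.* n

  -- M² N² - 3 M N - M - N - 1 for M = m + 2 and N = n + 3, expanded with natural coefficients so
  -- that its sign is evident.
  gap₀ : ℕ → ℕ → ℕ
  gap₀ m n = (2 ℕ.+ (3 ℕ.* m ℕ.+ 2 ℕ.* n ℕ.+ m ℕ.* n)) ℕ.* (3 ℕ.+ (3 ℕ.* m ℕ.+ 2 ℕ.* n ℕ.+ m ℕ.* n))
             ℕ.+ (6 ℕ.+ 11 ℕ.* m ℕ.+ 7 ℕ.* n ℕ.+ 4 ℕ.* (m ℕ.* n))

  -- Arranged so that `suc (gap m e)` is the product of e + 1 = N - M and gap₀ + 1.
  gap : ℕ → ℕ → ℕ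
  gap m e = gap₀ m (m ℕ.+ e) ℕ.+ e ℕ.* suc (gap₀ m (m ℕ.+ e))

  -- (N + 1)³ M² - (M + 1)³ N² = (N - M) (M² N² - 3 M N - M - N) > 0 for
  -- M = m + 2 and N = M + e + 1.
  cube/square-mono : ∀ m e → cube (4 ℕ.+ (m ℕ.+ e)) ℕ.* square (2 ℕ.+ m) ≡
    suc (gap m e) ℕ.+ cube (3 ℕ.+ m) ℕ.* square (3 ℕ.+ (m ℕ.+ e))
  cube/square-mono = expanded
    where
    expanded : ∀ m e →
      let n = m ℕ.+ e
          q = 3 ℕ.* m ℕ.+ 2 ℕ.* n ℕ.+ m ℕ.* n
          r = (2 ℕ.+ q) ℕ.* (3 ℕ.+ q) ℕ.+ (6 ℕ.+ 11 ℕ.* m ℕ.+ 7 ℕ.* n ℕ.+ 4 ℕ.* (m ℕ.* n))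
      in (4 ℕ.+ n) ℕ.* ((4 ℕ.+ n) ℕ.* (4 ℕ.+ n)) ℕ.* ((2 ℕ.+ m) ℕ.* (2 ℕ.+ m)) ≡
         1 ℕ.+ (r ℕ.+ e ℕ.* (1 ℕ.+ r)) ℕ.+ (3 ℕ.+ m) ℕ.* ((3 ℕ.+ m) ℕ.* (3 ℕ.+ m)) ℕ.* ((3 ℕ.+ n) ℕ.* (3 ℕ.+ n))
    expanded = ℕSolver.solve-∀

  i[3+i] : ∀ i → (1 ℕ.+ i) ℕ.* (2 ℕ.+ i) ≡ 2 ℕ.+ i ℕ.* (3 ℕ.+ i)
  i[3+i] = ℕSolver.solve-∀

-- With V = i + 1 and W = i + 2, the roots of (x - 1)³ = y x² are - V W,
-- V / W² and - W / V² for y = - (V W + 1)³ / (V W)².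
module RationalPoints (R : CommutativeRing 0ℓ 0ℓ)
  (#-unit : ∀ n → Evaluation.IsUnit R (NaturalMultiples.# R (suc n))) where

  open CommutativeRing R hiding (zero)
  open NaturalMultiples R
  open Evaluation R
  open BinomialSums R #-unit using (3#)
  open TrinomialRoots R #-unit
  open IntegerSolver R using (solve; _:=_; _:+_; _:*_; _:-_; :-_; #1; #3)
  open import Relation.Binary.Reasoning.Setoid setoid

  module _ (i : ℕ) where

    private
      V W V⁻¹ W⁻¹ a b c : Carrier
      V   = # (suc i)
      W   = # (suc (suc i))
      V⁻¹ = IsUnit.inverse (#-unit i)
      W⁻¹ = IsUnit.inverse (#-unit (suc i))
      a   = - (V * W)
      b   = V * (W⁻¹ * W⁻¹)
      c   = - (W * (V⁻¹ * V⁻¹))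

      VV⁻¹ : V * V⁻¹ ≈ 1#
      VV⁻¹ = IsUnit.inverseʳ (#-unit i)

      WW⁻¹ : W * W⁻¹ ≈ 1#
      WW⁻¹ = IsUnit.inverseʳ (#-unit (suc i))

    -- Read off from the sum of the roots, which leaves only the pairwise products and the product
    -- to verify.
    point : Carrier
    point = a + b + c - 3#

    points-roots : Roots point
    points-roots = record
      { a = a ; b = b ; c = c
      ; sum = solve 2 (λ s t → s := t :+ (s :- t)) refl (a + b + c) 3#
      -- Once denominators are cleared this is W³ - V³ - 1 = 3 V W, true because W = V + 1.
      ; pairs = unit-cancel (unit-* (#-unit i) (#-unit (suc i))) (begin
          V * W * (a * b + b * c + c * a)
            ≈⟨ solve 4 (λ V W v w →
                 V :* W :* (:- (V :* W) :* (V :* (w :* w)) :+ V :* (w :* w) :* :- (W :* (v :* v)) :+ :- (W :* (v :* v)) :* :- (V :* W)) :=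
                 :- (V :* V :* V :* (W :* w :* (W :* w))) :- V :* v :* (V :* v) :* (W :* w :* (W :* w))
                   :+ W :* W :* W :* (V :* v :* (V :* v))) refl V W V⁻¹ W⁻¹ ⟩
          - (V * V * V * (W * W⁻¹ * (W * W⁻¹))) - V * V⁻¹ * (V * V⁻¹) * (W * W⁻¹ * (W * W⁻¹)) + W * W * W * (V * V⁻¹ * (V * V⁻¹))
            ≈⟨ +-cong (+-cong (-‿cong (*-congˡ (*-cong WW⁻¹ WW⁻¹)))
                 (-‿cong (*-cong (*-cong VV⁻¹ VV⁻¹) (*-cong WW⁻¹ WW⁻¹)))) (*-congˡ (*-cong VV⁻¹ VV⁻¹)) ⟩
          - (V * V * V * (1# * 1#)) - 1# * 1# * (1# * 1#) + W * W * W * (1# * 1#)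
            ≈⟨ solve 1 (λ V → :- (V :* V :* V :* (#1 :* #1)) :- #1 :* #1 :* (#1 :* #1) :+ (#1 :+ V) :* (#1 :+ V) :* (#1 :+ V) :* (#1 :* #1)
                 := V :* (#1 :+ V) :* #3) refl V ⟩
          V * W * 3#
            ∎)
      ; prod = begin
          a * b * c
            ≈⟨ solve 4 (λ V W v w → :- (V :* W) :* (V :* (w :* w)) :* :- (W :* (v :* v)) :=
                 V :* v :* (V :* v) :* (W :* w :* (W :* w))) refl V W V⁻¹ W⁻¹ ⟩
          V * V⁻¹ * (V * V⁻¹) * (W * W⁻¹ * (W * W⁻¹))
            ≈⟨ *-cong (*-cong VV⁻¹ VV⁻¹) (*-cong WW⁻¹ WW⁻¹) ⟩
          1# * 1# * (1# * 1#)
            ≈⟨ solve 0 (#1 :* #1 :* (#1 :* #1) := #1) refl ⟩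
          1#
            ∎
      }

    -- (i + 1)(i + 2) in the shape m + 2 with m = i (3 + i), which is how `cube/square-mono` takes
    -- M.
    VW : ℕ
    VW = 2 ℕ.+ i ℕ.* (3 ℕ.+ i)

    point-equation : # (square VW) * point ≈ - # (cube (suc VW))
    point-equation = begin
      # (square VW) * point
        ≈⟨ *-congʳ (trans (#-* VW VW) (*-cong #VW #VW)) ⟩
      V * W * (V * W) * point
        ≈⟨ solve 4 (λ V W v w → V :* W :* (V :* W) :* (:- (V :* W) :+ V :* (w :* w) :+ :- (W :* (v :* v)) :- #3) :=
             :- (V :* W :* (V :* W :* (V :* W))) :+ V :* V :* V :* (W :* w :* (W :* w))
               :- W :* W :* W :* (V :* v :* (V :* v)) :- #3 :* (V :* W :* (V :* W))) refl V W V⁻¹ W⁻¹ ⟩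
      - (V * W * (V * W * (V * W))) + V * V * V * (W * W⁻¹ * (W * W⁻¹)) - W * W * W * (V * V⁻¹ * (V * V⁻¹)) - 3# * (V * W * (V * W))
        ≈⟨ +-congʳ (+-cong (+-congˡ (*-congˡ (*-cong WW⁻¹ WW⁻¹))) (-‿cong (*-congˡ (*-cong VV⁻¹ VV⁻¹)))) ⟩
      - (V * W * (V * W * (V * W))) + V * V * V * (1# * 1#) - W * W * W * (1# * 1#) - 3# * (V * W * (V * W))
        ≈⟨ solve 1 (λ V → :- (V :* (#1 :+ V) :* (V :* (#1 :+ V) :* (V :* (#1 :+ V)))) :+ V :* V :* V :* (#1 :* #1)
               :- (#1 :+ V) :* (#1 :+ V) :* (#1 :+ V) :* (#1 :* #1) :- #3 :* (V :* (#1 :+ V) :* (V :* (#1 :+ V)))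
             := :- ((#1 :+ V :* (#1 :+ V)) :* ((#1 :+ V :* (#1 :+ V)) :* (#1 :+ V :* (#1 :+ V))))) refl V ⟩
      - ((1# + V * W) * ((1# + V * W) * (1# + V * W)))
        ≈⟨ -‿cong (*-cong (+-congˡ #VW) (*-cong (+-congˡ #VW) (+-congˡ #VW))) ⟨
      - (# (suc VW) * (# (suc VW) * # (suc VW)))
        ≈⟨ -‿cong (trans (#-* (suc VW) (square (suc VW))) (*-congˡ (#-* (suc VW) (suc VW)))) ⟨
      - # (cube (suc VW))
        ∎
      where
      #VW : # VW ≈ V * W
      #VW = trans (reflexive (≡.cong # (≡.sym (i[3+i] i)))) (#-* (suc i) (suc (suc i)))

  -- Multiplied by the squares of both values of V W, the difference of two points is the negative
  -- of a positive integer, hence a unit.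
  points-distinct : ∀ n → DistinctPoints n point
  points-distinct n i j i<j j<n = unit-divisor {y = A * B} (unit-cong (sym (begin
    (point j - point i) * (A * B)
      ≈⟨ solve 4 (λ x y a b → (y :- x) :* (a :* b) := a :* (b :* y) :- b :* (a :* x)) refl (point i) (point j) A B ⟩
    A * (B * point j) - B * (A * point i)
      ≈⟨ +-cong (*-congˡ (point-equation j)) (-‿cong (*-congˡ (point-equation i))) ⟩
    A * - # (cube (suc N)) - B * - # (cube (suc M))
      ≈⟨ solve 4 (λ a b x y → a :* (:- y) :- b :* (:- x) := x :* b :- y :* a) refl A B (# (cube (suc M))) (# (cube (suc N))) ⟩
    # (cube (suc M)) * B - # (cube (suc N)) * A
      ≈⟨ +-congˡ (-‿cong (begin
           # (cube (suc N)) * A                                 ≈⟨ #-* (cube (suc N)) (square M) ⟨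
           # (cube (suc N) ℕ.* square M)                        ≡⟨ ≡.cong # nat-equation ⟩
           # (suc (gap m e) ℕ.+ cube (suc M) ℕ.* square N)      ≈⟨ #-+ (suc (gap m e)) (cube (suc M) ℕ.* square N) ⟩
           # (suc (gap m e)) + # (cube (suc M) ℕ.* square N)    ≈⟨ +-congˡ (#-* (cube (suc M)) (square N)) ⟩
           # (suc (gap m e)) + # (cube (suc M)) * B             ∎)) ⟩
    # (cube (suc M)) * B - (# (suc (gap m e)) + # (cube (suc M)) * B)
      ≈⟨ solve 2 (λ x d → x :- (d :+ x) := :- d) refl (# (cube (suc M)) * B) (# (suc (gap m e))) ⟩
    - # (suc (gap m e))
      ∎)) (unit-neg (#-unit (gap m e))))
    where
    M = VW i
    N = VW j
    A = # (square M)
    B = # (square N)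
    m = i ℕ.* (3 ℕ.+ i)
    e = j ℕ.* (3 ℕ.+ j) ∸ suc m
    m+e : suc m ℕ.+ e ≡ j ℕ.* (3 ℕ.+ j)
    m+e = ℕ.m+[n∸m]≡n (ℕ.*-mono-< i<j (s<s (s<s (s<s i<j))))
    nat-equation : cube (suc N) ℕ.* square M ≡ suc (gap m e) ℕ.+ cube (suc M) ℕ.* square N
    nat-equation = ≡.subst (λ k → cube (3 ℕ.+ k) ℕ.* square M ≡ suc (gap m e) ℕ.+ cube (suc M) ℕ.* square (2 ℕ.+ k))
      m+e (cube/square-mono m e)

-- Products over powers of a root of unity

module RootsOfUnity (R : CommutativeRing 0ℓ 0ℓ)
  (#-unit : ∀ n → Evaluation.IsUnit R (NaturalMultiples.# R (suc n))) where

  open CommutativeRing R hiding (zero)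
  open NaturalMultiples R
  open Evaluation R
  open BinomialSums R #-unit using (3#; binomial; G; G-closed)
  open TrinomialRoots R #-unit
  open RationalPoints R #-unit
  open IntegerSolver R using (solve; _:=_; _:+_; _:*_; _:-_; :-_; #1; #3)
  open import Relation.Binary.Reasoning.Setoid setoid

  geometric : ℕ → Carrier → Carrier
  geometric n = eval n (λ _ → 1#)

  geometric-* : ∀ n x → (x - 1#) * geometric n x ≈ x ^ n - 1#
  geometric-* zero    x = trans (zeroʳ _) (sym (-‿inverseʳ 1#))
  geometric-* (suc n) x = begin
    (x - 1#) * (1# + x * g)       ≈⟨ solve 2 (λ x g → (x :- #1) :* (#1 :+ x :* g) := (x :- #1) :+ x :* ((x :- #1) :* g)) refl x g ⟩
    x - 1# + x * ((x - 1#) * g)   ≈⟨ +-congˡ (*-congˡ (geometric-* n x)) ⟩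
    x - 1# + x * (x ^ n - 1#)     ≈⟨ solve 2 (λ x z → x :- #1 :+ x :* (z :- #1) := x :* z :- #1) refl x (x ^ n) ⟩
    x ^ suc n - 1#                ∎
    where g = geometric n x

  geometric-1 : ∀ n → geometric n 1# ≈ # n
  geometric-1 zero    = refl
  geometric-1 (suc n) = +-congˡ (trans (*-identityˡ _) (geometric-1 n))

  module _ (n : ℕ) (ω : Carrier) (ω^p≈1 : ω ^ suc n ≈ 1#)
    (1-ω^k-unit : ∀ k → k < n → IsUnit (1# - ω ^ suc k)) where

    private
      p : ℕ
      p = suc n

      r : ℕ → Carrier
      r i = ω ^ suc i

    -- The difference is -ω^(i+1) (1 - ω^(j-i)), and ω is invertible with inverse ωⁿ because p = n +
    -- 1.
    ω-distinct : DistinctPoints n r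
    ω-distinct i j i<j j<n = unit-cong eq
      (unit-neg (unit-* (unit-^ (suc i) (unit (ω ^ n) ω^p≈1)) (1-ω^k-unit d (ℕ.≤-<-trans (ℕ.m∸n≤m j (suc i)) j<n))))
      where
      d = j ∸ suc i
      eq : - (ω ^ suc i * (1# - ω ^ suc d)) ≈ r j - r i
      eq = begin
        - (ω ^ suc i * (1# - ω ^ suc d))
          ≈⟨ solve 2 (λ x y → :- (x :* (#1 :- y)) := x :* y :- x) refl (ω ^ suc i) (ω ^ suc d) ⟩
        ω ^ suc i * ω ^ suc d - ω ^ suc i
          ≈⟨ +-congʳ (^-homo-* ω (suc i) (suc d)) ⟨
        ω ^ (suc i ℕ.+ suc d) - ω ^ suc i
          ≡⟨ ≡.cong (λ k → ω ^ k - ω ^ suc i) (≡.trans (ℕ.+-suc (suc i) d) (≡.cong suc (ℕ.m+[n∸m]≡n i<j))) ⟩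
        r j - r i
          ∎

    ω-root : ∀ i → i < n → geometric p (r i) ≈ 0#
    ω-root i i<n = unit-cancel-0 (unit-neg (1-ω^k-unit i i<n)) (begin
      - (1# - r i) * geometric p (r i)  ≈⟨ *-congʳ (solve 1 (λ x → :- (#1 :- x) := x :- #1) refl (r i)) ⟩
      (r i - 1#) * geometric p (r i)    ≈⟨ geometric-* p (r i) ⟩
      r i ^ p - 1#                      ≈⟨ +-congʳ r^p ⟩
      1# - 1#                           ≈⟨ -‿inverseʳ 1# ⟩
      0#                                ∎)
      where
      r^p : r i ^ p ≈ 1#
      r^p = begin
        (ω ^ suc i) ^ p     ≈⟨ ^-assocʳ ω (suc i) p ⟩
        ω ^ (suc i ℕ.* p)   ≡⟨ ≡.cong (ω ^_) (ℕ.*-comm (suc i) p) ⟩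
        ω ^ (p ℕ.* suc i)   ≈⟨ ^-assocʳ ω p (suc i) ⟨
        (ω ^ p) ^ suc i     ≈⟨ ^-congˡ (suc i) ω^p≈1 ⟩
        1# ^ suc i          ≈⟨ 1^n≈1 (suc i) ⟩
        1#                  ∎

    ∏[x-ω^k] : ∀ x → ∏ n (λ i → x - r i) ≈ geometric p x
    ∏[x-ω^k] x = trans (sym (*-identityˡ _)) (sym (factorisation n (λ _ → 1#) r ω-distinct ω-root x))

    ∏[1-ω^k] : ∏ n (λ i → 1# - r i) ≈ # p
    ∏[1-ω^k] = trans (∏[x-ω^k] 1#) (geometric-1 p)

    module _ (x : ℕ → Carrier) (x-spec : ∀ i → i < n → (1# - r i) ^ 3 * x i ≈ r i ^ 2) where

      ∏-cubic : ∀ y → ∏ n (λ i → (1# - r i) ^ 3 + y * r i ^ 2) ≈ # p ^ 3 * eval p (elemSym n x) y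
      ∏-cubic y = begin
        ∏ n (λ i → (1# - r i) ^ 3 + y * r i ^ 2)
          ≈⟨ ∏-cong n (λ i i<n → trans (+-congˡ (*-congˡ (sym (x-spec i i<n))))
               (solve 3 (λ c y x → c :+ y :* (c :* x) := c :* (#1 :+ y :* x)) refl ((1# - r i) ^ 3) y (x i))) ⟩
        ∏ n (λ i → (1# - r i) ^ 3 * (1# + y * x i))
          ≈⟨ ∏-* n (λ i → (1# - r i) ^ 3) (λ i → 1# + y * x i) ⟩
        ∏ n (λ i → (1# - r i) ^ 3) * ∏ n (λ i → 1# + y * x i)
          ≈⟨ *-cong (trans (∏-^ n (λ i → 1# - r i) 3) (^-congˡ 3 ∏[1-ω^k])) (∏[1+y*x] n x y) ⟩
        # p ^ 3 * eval p (elemSym n x) y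
          ∎

      -- The factor y = (a - 1)(b - 1)(c - 1) completes ∏ₖ (a - ωᵏ)(b - ωᵏ)(c - ωᵏ) to
      -- (aᵖ - 1)(bᵖ - 1)(cᵖ - 1).
      generating-function : ∀ {y} → Roots y →
        y * (# p ^ 3 * eval p (elemSym n x) y) ≈ eval (suc p) (G (# p)) y - eval (suc p) (G (- # p)) y
      generating-function {y} roots = begin
        y * (# p ^ 3 * eval p (elemSym n x) y)
          ≈⟨ *-congˡ (∏-cubic y) ⟨
        y * ∏ n (λ i → (1# - r i) ^ 3 + y * r i ^ 2)
          ≈⟨ *-cong y≈ (∏-cong n (λ i _ → factor (r i))) ⟩
        (a - 1#) * (b - 1#) * (c - 1#) * ∏ n (λ i → (a - r i) * (b - r i) * (c - r i))
          ≈⟨ *-congˡ (trans (∏-* n (λ i → (a - r i) * (b - r i)) (λ i → c - r i)) (*-congʳ (∏-* n (λ i → a - r i) (λ i → b - r i)))) ⟩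
        (a - 1#) * (b - 1#) * (c - 1#) * (∏ n (λ i → a - r i) * ∏ n (λ i → b - r i) * ∏ n (λ i → c - r i))
          ≈⟨ *-congˡ (*-cong (*-cong (∏[x-ω^k] a) (∏[x-ω^k] b)) (∏[x-ω^k] c)) ⟩
        (a - 1#) * (b - 1#) * (c - 1#) * (geometric p a * geometric p b * geometric p c)
          ≈⟨ solve 6 (λ a b c u v w → a :* b :* c :* (u :* v :* w) := a :* u :* (b :* v) :* (c :* w)) refl
               (a - 1#) (b - 1#) (c - 1#) (geometric p a) (geometric p b) (geometric p c) ⟩
        (a - 1#) * geometric p a * ((b - 1#) * geometric p b) * ((c - 1#) * geometric p c)
          ≈⟨ *-cong (*-cong (geometric-* p a) (geometric-* p b)) (geometric-* p c) ⟩
        (a ^ p - 1#) * (b ^ p - 1#) * (c ^ p - 1#)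
          ≈⟨ ∏[xⁿ-1] p ⟩
        powerSum a b c p - powerSum (b * c) (c * a) (a * b) p
          ≈⟨ +-cong (eval-G-# p p (s≤s z≤n) ℕ.≤-refl) (-‿cong (eval-G-neg p p (s≤s z≤n) ℕ.≤-refl)) ⟨
        eval (suc p) (G (# p)) y - eval (suc p) (G (- # p)) y
          ∎
        where
        open Roots roots hiding (p)
        y≈ : y ≈ (a - 1#) * (b - 1#) * (c - 1#)
        y≈ = begin
          y                                 ≈⟨ solve 1 (λ y → y := #3 :+ y :- #3 :+ (#1 :- #1)) refl y ⟩
          3# + y - 3# + (1# - 1#)           ≈⟨ +-cong (+-cong sum (-‿cong pairs)) (+-congʳ prod) ⟨
          a + b + c - (a * b + b * c + c * a) + (a * b * c - 1#)
            ≈⟨ solve 3 (λ a b c → a :+ b :+ c :- (a :* b :+ b :* c :+ c :* a) :+ (a :* b :* c :- #1) :=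
                 (a :- #1) :* (b :- #1) :* (c :- #1)) refl a b c ⟩
          (a - 1#) * (b - 1#) * (c - 1#)    ∎
        factor : ∀ r → (1# - r) ^ 3 + y * r ^ 2 ≈ (a - r) * (b - r) * (c - r)
        factor r = begin
          (1# - r) ^ 3 + y * r ^ 2
            ≈⟨ solve 2 (λ y r → (#1 :- r) :* ((#1 :- r) :* ((#1 :- r) :* #1)) :+ y :* (r :* (r :* #1)) :=
                 #1 :- #3 :* r :+ (#3 :+ y) :* (r :* r) :- r :* (r :* r)) refl y r ⟩
          1# - 3# * r + (3# + y) * (r * r) - r * (r * r)
            ≈⟨ +-congʳ (+-cong (+-cong prod (-‿cong (*-congʳ pairs))) (*-congʳ sum)) ⟨
          a * b * c - (a * b + b * c + c * a) * r + (a + b + c) * (r * r) - r * (r * r)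
            ≈⟨ solve 4 (λ a b c r → a :* b :* c :- (a :* b :+ b :* c :+ c :* a) :* r :+ (a :+ b :+ c) :* (r :* r) :- r :* (r :* r)
                 := (a :- r) :* (b :- r) :* (c :- r)) refl a b c r ⟩
          (a - r) * (b - r) * (c - r) ∎

      private
        -- The coefficients of y p³ Σ e_t yᵗ; the factor y causes the shift by one.
        f : ℕ → Carrier
        f zero    = 0#
        f (suc t) = # p ^ 3 * elemSym n x t

        D : ℕ → Carrier
        D s = G (# p) s - G (- # p) s

      -- Both polynomials have p + 1 coefficients and agree at p + 1 points where the cubic splits.
      coefficients : ∀ s → s < suc p → f s - D s ≈ 0#
      coefficients = interpolation (suc p) (λ s → f s - D s) point (points-distinct (suc p)) λ i _ → begin
        eval (suc p) (λ s → f s - D s) (point i)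
          ≈⟨ eval-sub (suc p) f D (point i) ⟩
        eval (suc p) f (point i) - eval (suc p) D (point i)
          ≈⟨ x≈y⇒x-y≈0 (begin
               0# + point i * eval p (f ∘ suc) (point i)
                 ≈⟨ +-identityˡ _ ⟩
               point i * eval p (f ∘ suc) (point i)
                 ≈⟨ *-congˡ (eval-* p (# p ^ 3) (elemSym n x) (point i)) ⟩
               point i * (# p ^ 3 * eval p (elemSym n x) (point i))
                 ≈⟨ generating-function (points-roots i) ⟩
               eval (suc p) (G (# p)) (point i) - eval (suc p) (G (- # p)) (point i)
                 ≈⟨ eval-sub (suc p) (G (# p)) (G (- # p)) (point i) ⟨
               eval (suc p) D (point i)
                 ∎) ⟩
        0# ∎

      elemSym-closed-form : ∀ t → t < p → # (suc t) * (# p * # p) * elemSym n x t ≈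
        binomial (# p + # t + # t + 1#) (2 ℕ.+ t ℕ.* 3) + binomial (- # p + # t + # t + 1#) (2 ℕ.+ t ℕ.* 3)
      elemSym-closed-form t t<p = unit-cancel (#-unit n) (begin
        # p * (# (suc t) * (# p * # p) * e)
          ≈⟨ solve 3 (λ p s e → p :* (s :* (p :* p) :* e) := s :* (p :* (p :* (p :* #1)) :* e)) refl (# p) (# (suc t)) e ⟩
        # (suc t) * (# p ^ 3 * e)
          ≈⟨ *-congˡ (x-y≈0⇒x≈y (coefficients (suc t) (s<s t<p))) ⟩
        # (suc t) * (G (# p) (suc t) - G (- # p) (suc t))
          ≈⟨ solve 3 (λ s a b → s :* (a :- b) := s :* a :- s :* b) refl (# (suc t)) (G (# p) (suc t)) (G (- # p) (suc t)) ⟩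
        # (suc t) * G (# p) (suc t) - # (suc t) * G (- # p) (suc t)
          ≈⟨ +-cong (G-closed (# p) t) (-‿cong (G-closed (- # p) t)) ⟨
        # p * B₊ - (- # p * B₋)
          -- The closed form at -p brings a factor -p, so the difference of power sums turns into a
          -- sum of binomials, and one of the three factors p cancels.
          ≈⟨ solve 3 (λ p a b → p :* a :- (:- p :* b) := p :* (a :+ b)) refl (# p) B₊ B₋ ⟩
        # p * (B₊ + B₋)
          ∎)
        where
        e = elemSym n x t
        B₊ = binomial (# p + # t + # t + 1#) (2 ℕ.+ t ℕ.* 3)
        B₋ = binomial (- # p + # t + # t + 1#) (2 ℕ.+ t ℕ.* 3)

-- Units modulo the cyclotomic polynomial

module CyclotomicUnits (R : CommutativeRing 0ℓ 0ℓ)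
  (#-unit : ∀ n → Evaluation.IsUnit R (NaturalMultiples.# R (suc n))) where

  open CommutativeRing R hiding (zero)
  open NaturalMultiples R
  open Evaluation R
  open BinomialSums R #-unit using (binomial)
  open RootsOfUnity R #-unit
  open IntegerSolver R using (solve; _:=_; _:+_; _:*_; _:-_; :-_; #1)
  open import Relation.Binary.Reasoning.Setoid setoid

  module _ (n : ℕ) (pr : Prime (suc n)) (ω : Carrier) (ω-root : geometric (suc n) ω ≈ 0#) where

    private
      p : ℕ
      p = suc n

    ω^p≈1 : ω ^ p ≈ 1#
    ω^p≈1 = x-y≈0⇒x≈y (begin
      ω ^ p - 1#                    ≈⟨ geometric-* p ω ⟨
      (ω - 1#) * geometric p ω      ≈⟨ *-congˡ ω-root ⟩
      (ω - 1#) * 0#                 ≈⟨ zeroʳ _ ⟩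
      0#                            ∎)

    -- The cyclotomic polynomial takes the value p at 1.
    1-ω-unit : IsUnit (1# - ω)
    1-ω-unit = unit-divisor {y = g} (unit-cong (begin
      # p                           ≈⟨ geometric-1 p ⟨
      geometric p 1#                ≈⟨ solve 3 (λ e x g → e := e :+ (x :- #1) :* g :+ (#1 :- x) :* g) refl (geometric p 1#) ω g ⟩
      geometric p 1# + (ω - 1#) * g + (1# - ω) * g
                                    ≈⟨ +-congʳ (eval-quot n (λ _ → 1#) 1# ω) ⟨
      geometric p ω + (1# - ω) * g  ≈⟨ +-congʳ ω-root ⟩
      0# + (1# - ω) * g             ≈⟨ +-identityˡ _ ⟩
      (1# - ω) * g                  ∎) (#-unit n))
      where g = eval n (quot n (λ _ → 1#) 1#) ω

    ω^[m*p]≈1 : ∀ m → ω ^ (m ℕ.* p) ≈ 1#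
    ω^[m*p]≈1 m = begin
      ω ^ (m ℕ.* p)   ≡⟨ ≡.cong (ω ^_) (ℕ.*-comm m p) ⟩
      ω ^ (p ℕ.* m)   ≈⟨ ^-assocʳ ω p m ⟨
      (ω ^ p) ^ m     ≈⟨ ^-congˡ m ω^p≈1 ⟩
      1# ^ m          ≈⟨ 1^n≈1 m ⟩
      1#              ∎

    -- ωᵏ - 1 divides ω^(yk) - 1 for every y. Bézout provides y with yk congruent to 1 or -1 modulo
    -- p, and then ω^(yk) - 1 is 1 - ω up to a unit.
    1-ω^k-unit : ∀ i → i < n → IsUnit (1# - ω ^ suc i)
    1-ω^k-unit i i<n = unit-cong (solve 1 (λ x → :- (x :- #1) := #1 :- x) refl (ω ^ k))
      (unit-neg (bézout (coprime-Bézout (prime⇒coprime pr (s<s i<n)))))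
      where
      k = suc i
      divides : ∀ y → (ω ^ k - 1#) * geometric y (ω ^ k) ≈ ω ^ (y ℕ.* k) - 1#
      divides y = begin
        (ω ^ k - 1#) * geometric y (ω ^ k)  ≈⟨ geometric-* y (ω ^ k) ⟩
        (ω ^ k) ^ y - 1#                    ≈⟨ +-congʳ (^-assocʳ ω k y) ⟩
        ω ^ (k ℕ.* y) - 1#                  ≡⟨ ≡.cong (λ m → ω ^ m - 1#) (ℕ.*-comm k y) ⟩
        ω ^ (y ℕ.* k) - 1#                  ∎
      bézout : Bézout.Identity 1 p k → IsUnit (ω ^ k - 1#)
      bézout (Bézout.-+ x y 1+xp≡yk) = unit-divisor {y = geometric y (ω ^ k)} (unit-cong (begin
        - (1# - ω)              ≈⟨ solve 1 (λ w → :- (#1 :- w) := w :* #1 :- #1) refl ω ⟩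
        ω * 1# - 1#             ≈⟨ +-congʳ (*-congˡ (ω^[m*p]≈1 x)) ⟨
        ω ^ (1 ℕ.+ x ℕ.* p) - 1#  ≡⟨ ≡.cong (λ m → ω ^ m - 1#) 1+xp≡yk ⟩
        ω ^ (y ℕ.* k) - 1#      ≈⟨ divides y ⟨
        (ω ^ k - 1#) * geometric y (ω ^ k) ∎) (unit-neg 1-ω-unit))
      bézout (Bézout.+- x y 1+yk≡xp) = unit-divisor {y = geometric y (ω ^ k) * ω} (unit-cong (begin
        1# - ω                            ≈⟨ +-congʳ (ω^[m*p]≈1 x) ⟨
        ω ^ (x ℕ.* p) - ω                 ≡⟨ ≡.cong (λ m → ω ^ m - ω) 1+yk≡xp ⟨
        ω * ω ^ (y ℕ.* k) - ω             ≈⟨ solve 2 (λ w z → w :* z :- w := (z :- #1) :* w) refl ω (ω ^ (y ℕ.* k)) ⟩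
        (ω ^ (y ℕ.* k) - 1#) * ω          ≈⟨ *-congʳ (divides y) ⟨
        (ω ^ k - 1#) * geometric y (ω ^ k) * ω ≈⟨ *-assoc _ _ _ ⟩
        (ω ^ k - 1#) * (geometric y (ω ^ k) * ω) ∎) 1-ω-unit)

    1-ω^k : ∀ k → (1# - ω) * geometric k ω ≈ 1# - ω ^ k
    1-ω^k k = begin
      (1# - ω) * geometric k ω        ≈⟨ solve 2 (λ w g → (#1 :- w) :* g := :- ((w :- #1) :* g)) refl ω (geometric k ω) ⟩
      - ((ω - 1#) * geometric k ω)    ≈⟨ -‿cong (geometric-* k ω) ⟩
      - (ω ^ k - 1#)                  ≈⟨ solve 1 (λ x → :- (x :- #1) := #1 :- x) refl (ω ^ k) ⟩
      1# - ω ^ k                      ∎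

    geometric-unit : ∀ i → i < n → IsUnit (geometric (suc i) ω)
    geometric-unit i i<n = unit-divisor {y = 1# - ω}
      (unit-cong (trans (sym (1-ω^k (suc i))) (*-comm _ _)) (1-ω^k-unit i i<n))

    module _ (z : ℕ → Carrier) (z-spec : ∀ i → i < n → geometric (suc i) ω ^ 3 * z i ≈ ω ^ (2 ℕ.* suc i)) where

      private
        u : Carrier
        u = IsUnit.inverse 1-ω-unit

        -- As [k] = (1 - ωᵏ)/(1 - ω), division by (1 - ω)³ turns z i = ω²ᵏ/[k]³ into ω²ᵏ/(1 - ωᵏ)³,
        -- where k = i + 1.
        x : ℕ → Carrier
        x i = u ^ 3 * z i

        x-spec : ∀ i → i < n → (1# - ω ^ suc i) ^ 3 * x i ≈ (ω ^ suc i) ^ 2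
        x-spec i i<n = begin
          (1# - ω ^ suc i) ^ 3 * (u ^ 3 * z i)
            ≈⟨ *-congʳ (^-congˡ 3 (1-ω^k (suc i))) ⟨
          ((1# - ω) * g) ^ 3 * (u ^ 3 * z i)
            ≈⟨ solve 4 (λ w g u z → cubed (w :* g) :* (cubed u :* z) := cubed (w :* u) :* (cubed g :* z)) refl (1# - ω) g u (z i) ⟩
          ((1# - ω) * u) ^ 3 * (g ^ 3 * z i)
            ≈⟨ *-cong (trans (^-congˡ 3 (IsUnit.inverseʳ 1-ω-unit)) (1^n≈1 3)) (z-spec i i<n) ⟩
          1# * ω ^ (2 ℕ.* suc i)
            ≈⟨ *-identityˡ _ ⟩
          ω ^ (2 ℕ.* suc i)
            ≡⟨ ≡.cong (ω ^_) (ℕ.*-comm 2 (suc i)) ⟩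
          ω ^ (suc i ℕ.* 2)
            ≈⟨ ^-assocʳ ω (suc i) 2 ⟨
          (ω ^ suc i) ^ 2
            ∎
          where
          g = geometric (suc i) ω
          cubed : ∀ {n} → IntegerSolver.Polynomial R n → IntegerSolver.Polynomial R n
          cubed e = e :* (e :* (e :* #1))

      -- By homogeneity the factor (1 - ω)^(-3t) distributes over the t variables of each monomial.
      cyclotomic-sum : ∀ t → t < p → # (suc t) * (# p * # p) * (elemSym n z t * u ^ (3 ℕ.* t)) ≈
        binomial (# p + # t + # t + 1#) (2 ℕ.+ t ℕ.* 3) + binomial (- # p + # t + # t + 1#) (2 ℕ.+ t ℕ.* 3)
      cyclotomic-sum t t<p = trans (*-congˡ (begin
        elemSym n z t * u ^ (3 ℕ.* t)    ≈⟨ *-comm _ _ ⟩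
        u ^ (3 ℕ.* t) * elemSym n z t    ≈⟨ *-congʳ (^-assocʳ u 3 t) ⟨
        (u ^ 3) ^ t * elemSym n z t      ≈⟨ elemSym-scale n (u ^ 3) z t ⟨
        elemSym n x t                    ∎)) (elemSym-closed-form n ω ω^p≈1 1-ω^k-unit x x-spec t t<p)

-- Fractions with invertible denominator

module Fractions (R : CommutativeRing 0ℓ 0ℓ) where

  open CommutativeRing R hiding (zero)
  open Evaluation R
  open IntegerSolver R using (solve; _:=_; _:+_; _:*_)
  open import Relation.Binary.Reasoning.Setoid setoid

  -- α plays the role of f / g. The lemmas below copy the unreduced numerators and denominators of
  -- `ℚ⟨q⟩`, so they apply to its operations as they stand.
  record IsFraction (f g α : Carrier) : Set where
    constructor fraction
    field
      den-unit : IsUnit g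
      den-*    : g * α ≈ f

  fraction-cong : ∀ {f g α β} → α ≈ β → IsFraction f g α → IsFraction f g β
  fraction-cong α≈β (fraction g-unit gα) = fraction g-unit (trans (*-congˡ (sym α≈β)) gα)

  fraction-+ : ∀ {f₁ g₁ α f₂ g₂ β} → IsFraction f₁ g₁ α → IsFraction f₂ g₂ β →
               IsFraction (f₁ * g₂ + f₂ * g₁) (g₁ * g₂) (α + β)
  fraction-+ {f₁} {g₁} {α} {f₂} {g₂} {β} (fraction u₁ e₁) (fraction u₂ e₂) = fraction (unit-* u₁ u₂) (begin
    g₁ * g₂ * (α + β)               ≈⟨ solve 4 (λ g h a b → g :* h :* (a :+ b) := g :* a :* h :+ h :* b :* g) refl g₁ g₂ α β ⟩
    g₁ * α * g₂ + g₂ * β * g₁       ≈⟨ +-cong (*-congʳ e₁) (*-congʳ e₂) ⟩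
    f₁ * g₂ + f₂ * g₁               ∎)

  fraction-* : ∀ {f₁ g₁ α f₂ g₂ β} → IsFraction f₁ g₁ α → IsFraction f₂ g₂ β →
               IsFraction (f₁ * f₂) (g₁ * g₂) (α * β)
  fraction-* {f₁} {g₁} {α} {f₂} {g₂} {β} (fraction u₁ e₁) (fraction u₂ e₂) = fraction (unit-* u₁ u₂) (begin
    g₁ * g₂ * (α * β)               ≈⟨ solve 4 (λ g h a b → g :* h :* (a :* b) := g :* a :* (h :* b)) refl g₁ g₂ α β ⟩
    g₁ * α * (g₂ * β)               ≈⟨ *-cong e₁ e₂ ⟩
    f₁ * f₂                         ∎)

  fraction-÷ : ∀ {f g α h} → IsFraction f g α → (h-unit : IsUnit h) → IsFraction f (g * h) (α * IsUnit.inverse h-unit)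
  fraction-÷ {f} {g} {α} {h} (fraction u e) h-unit@(unit v hv) = fraction (unit-* u h-unit) (begin
    g * h * (α * v)     ≈⟨ solve 4 (λ g h a v → g :* h :* (a :* v) := g :* a :* (h :* v)) refl g h α v ⟩
    g * α * (h * v)     ≈⟨ *-cong e hv ⟩
    f * 1#              ≈⟨ *-identityʳ f ⟩
    f                   ∎)

  fraction-difference : ∀ {f₁ g₁ α f₂ g₂ β} → IsFraction f₁ g₁ α → IsFraction f₂ g₂ β → α ≈ β →
                        f₁ * g₂ - f₂ * g₁ ≈ 0#
  fraction-difference {f₁} {g₁} {α} {f₂} {g₂} {β} (fraction u₁ e₁) (fraction u₂ e₂) α≈β = x≈y⇒x-y≈0 (begin
    f₁ * g₂             ≈⟨ *-congʳ e₁ ⟨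
    g₁ * α * g₂         ≈⟨ *-congʳ (*-congˡ α≈β) ⟩
    g₁ * β * g₂         ≈⟨ solve 3 (λ g h b → g :* b :* h := h :* b :* g) refl g₁ g₂ β ⟩
    g₂ * β * g₁         ≈⟨ *-congʳ e₂ ⟩
    f₂ * g₁             ∎)

-- Finite choice: witnesses available only for i < n become a function on all of ℕ, as `elemSym`
-- expects; beyond n it takes the default x₀.
extend : ∀ n {A : Set} {P : ℕ → A → Set} → A → (∀ i → i < n → ∃[ x ] P i x) →
         Σ[ f ∈ (ℕ → A) ] (∀ i → i < n → P i (f i))
extend zero    x₀ exist = (λ _ → x₀) , (λ _ ())
extend (suc n) {A} {P} x₀ exist with exist 0 z<s | extend n {P = P ∘ suc} x₀ (λ i i<n → exist (suc i) (s<s i<n))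
... | x , Px | f , Pf = f′ , Pf′
  where
  f′ : ℕ → A
  f′ zero    = x
  f′ (suc i) = f i
  Pf′ : ∀ i → i < suc n → P i (f′ i)
  Pf′ zero    _         = Px
  Pf′ (suc i) (s≤s i<n) = Pf i i<n

-- The residue ring of ℚ[q] modulo [p]_q

module Residues (n : ℕ) where

  p : ℕ
  p = suc n

  private
    module P = CommutativeRing PolynomialRing.commutativeRing
    module Q = PrincipalQuotient PolynomialRing.commutativeRing ℚ[q].[ p ]q

  open Q public using (mod) renaming (commutativeRing to K)
  open Q using (≈⇒≋)
  open CommutativeRing K hiding (zero)
  open Evaluation K
  open NaturalMultiples K
  open Fractions K
  open import Relation.Binary.Reasoning.Setoid setoid

  φ : ℚ → Carrier
  φ c = c ∷ []

  φ-+ : ∀ a b → φ (a ℚ.+ b) ≈ φ a + φ b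
  φ-+ a b = refl

  φ-* : ∀ a b → φ (a ℚ.* b) ≈ φ a * φ b
  φ-* a b = ≈⇒≋ (PolynomialRing.∷-cong (≡.sym (ℚ.+-identityʳ (a ℚ.* b))) P.refl)

  φ-0 : φ 0ℚ ≈ 0#
  φ-0 = ≈⇒≋ (ℚ[q].mk≈ λ { zero → ≡.refl ; (suc _) → ≡.refl })

  φ-cong : ∀ {a b} → a ≡ b → φ a ≈ φ b
  φ-cong a≡b = reflexive (≡.cong φ a≡b)

  φ-# : ∀ k → φ (+ k ℚ./ 1) ≈ # k
  φ-# zero    = φ-0
  φ-# (suc k) = begin
    φ (+ suc k ℚ./ 1)           ≈⟨ φ-cong (/1-+ (+ 1) (+ k)) ⟩
    φ (1ℚ ℚ.+ (+ k ℚ./ 1))      ≈⟨ φ-+ 1ℚ (+ k ℚ./ 1) ⟩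
    1# + φ (+ k ℚ./ 1)          ≈⟨ +-congˡ (φ-# k) ⟩
    1# + # k                    ∎

  #-*-φ : ∀ k .{{_ : ℕ.NonZero k}} → # k * φ (+ 1 ℚ./ k) ≈ 1#
  #-*-φ k = begin
    # k * φ (+ 1 ℚ./ k)                     ≈⟨ *-congʳ (φ-# k) ⟨
    φ (+ k ℚ./ 1) * φ (+ 1 ℚ./ k)           ≈⟨ φ-* (+ k ℚ./ 1) (+ 1 ℚ./ k) ⟨
    φ ((+ k ℚ./ 1) ℚ.* (+ 1 ℚ./ k))         ≈⟨ φ-cong (n/1*i/n≡i/1 (+ 1) k) ⟩
    1#                                      ∎

  -- The rational constants embed, so all positive integers are invertible, p included.
  #-unit : ∀ k → IsUnit (# (suc k))
  #-unit k = unit (φ (+ 1 ℚ./ suc k)) (#-*-φ (suc k))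

  private module B = BinomialSums K #-unit
  open RootsOfUnity K #-unit using (geometric)
  open CyclotomicUnits K #-unit
  open IncreasingTuples K

  φ-falling : ∀ α k → φ (falling α k) ≈ B.fallingFactorial (φ α) k
  φ-falling α zero    = refl
  φ-falling α (suc k) = begin
    φ (falling α k ℚ.* (α ℚ.- (+ k ℚ./ 1)))     ≈⟨ φ-* (falling α k) (α ℚ.- (+ k ℚ./ 1)) ⟩
    φ (falling α k) * (φ α - φ (+ k ℚ./ 1))     ≈⟨ *-cong (φ-falling α k) (+-congˡ (-‿cong (φ-# k))) ⟩
    B.fallingFactorial (φ α) k * (φ α - # k)             ∎

  #-!-unit : ∀ k → IsUnit (# (k !))
  #-!-unit k = unit (φ ((+ 1 ℚ./ k !) {{k ℕ.!≢0}})) (#-*-φ (k !) {{k ℕ.!≢0}})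

  #-!-*-1/! : ∀ k → # (k !) * B.1/ k ! ≈ 1#
  #-!-*-1/! zero    = trans (*-identityʳ (# 1)) (+-identityʳ 1#)
  #-!-*-1/! (suc k) = begin
    # (suc k ℕ.* k !) * B.1/ suc k !        ≈⟨ *-congʳ (trans (#-* (suc k) (k !)) (*-comm (# (suc k)) (# (k !)))) ⟩
    # (k !) * # (suc k) * B.1/ suc k !      ≈⟨ *-assoc (# (k !)) (# (suc k)) (B.1/ suc k !) ⟩
    # (k !) * (# (suc k) * B.1/ suc k !)    ≈⟨ *-congˡ {# (k !)} (B.1/suc! k) ⟩
    # (k !) * B.1/ k !                      ≈⟨ #-!-*-1/! k ⟩
    1#                                      ∎

  -- 1/k! is a single fraction in ℚ but a product of inverses in K; both are inverse to k!, hence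
  -- equal.
  φ-binom : ∀ α k → φ (binom α k) ≈ B.binomial (φ α) k
  φ-binom α k = begin
    φ (falling α k ℚ.* 1/k!)      ≈⟨ φ-* (falling α k) 1/k! ⟩
    φ (falling α k) * φ 1/k!      ≈⟨ *-cong (φ-falling α k) (unit-cancel (#-!-unit k)
                                       (trans (#-*-φ (k !) {{k ℕ.!≢0}}) (sym (#-!-*-1/! k)))) ⟩
    B.fallingFactorial (φ α) k * B.1/ k !  ∎
    where 1/k! = (+ 1 ℚ./ k !) {{k ℕ.!≢0}}

  -- The two powers belong to different bundles and do not compute for a variable exponent, although
  -- they unfold to the same products.
  ^≡ : ∀ f k → f ^ k ≡ f ℚ[q].^ k
  ^≡ f zero    = ≡.refl
  ^≡ f (suc k) = ≡.cong (f *_) (^≡ f k)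

  q-shift : ∀ f → ℚ[q].q ℚ[q].* f ℚ[q].≈ 0ℚ ∷ f
  q-shift f = ℚ[q].mk≈ λ k → ≡.trans (coeff-∷* 0ℚ (1ℚ ∷ []) f k)
    (≡.trans (≡.cong (ℚ._+ ℚ[q].coeff (0ℚ ∷ ℚ[q].1ₚ ℚ[q].* f) k) (ℚ.*-zeroˡ (ℚ[q].coeff f k)))
    (≡.trans (ℚ.+-identityˡ _) (ℚ[q].coeff-≈ (PolynomialRing.∷-cong ≡.refl (P.*-identityˡ f)) k)))

  []q-geometric : ∀ k → ℚ[q].[ k ]q ≈ geometric k ℚ[q].q
  []q-geometric zero    = refl
  []q-geometric (suc k) = begin
    1ℚ ∷ ℚ[q].[ k ]q                        ≈⟨ ≈⇒≋ (PolynomialRing.∷-cong (≡.sym (ℚ.+-identityʳ 1ℚ)) P.refl) ⟩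
    ℚ[q].1ₚ ℚ[q].+ (0ℚ ∷ ℚ[q].[ k ]q)       ≈⟨ +-congˡ {ℚ[q].1ₚ} (≈⇒≋ (q-shift ℚ[q].[ k ]q)) ⟨
    1# + ℚ[q].q * ℚ[q].[ k ]q               ≈⟨ +-congˡ {ℚ[q].1ₚ} (*-congˡ {ℚ[q].q} ([]q-geometric k)) ⟩
    1# + ℚ[q].q * geometric k ℚ[q].q        ∎

  -- The class of q can thus serve as the ω of the general results.
  q-root : geometric p ℚ[q].q ≈ 0#
  q-root = trans (sym ([]q-geometric p)) (mod 1# (P.sym (P.trans (P.+-identityˡ _) (P.*-identityʳ _))))

  Represents : RatFun → Carrier → Set
  Represents (f / g) α = IsFraction f g α

  represents-0 : Represents ℚ⟨q⟩.0ᵣ 0#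
  represents-0 = fraction unit-1 (zeroʳ 1#)

  represents-1 : Represents ℚ⟨q⟩.1ᵣ 1#
  represents-1 = fraction unit-1 (*-identityʳ 1#)

  represents-const : ∀ c → Represents (ℚ⟨q⟩.const c) (φ c)
  represents-const c = fraction unit-1 (*-identityˡ (φ c))

  module _ (pr : Prime p) where

    []q-unit : ∀ i → i < n → IsUnit (ℚ[q].[ suc i ]q)
    []q-unit i i<n = unit-cong (sym ([]q-geometric (suc i))) (geometric-unit n pr ℚ[q].q q-root i i<n)

    private
      -- The residues of q²ᵏ/[k]³ with k = i + 1, for i < n.
      terms : Σ[ z ∈ (ℕ → Carrier) ] (∀ i → i < n → ℚ[q].[ suc i ]q ^ 3 * z i ≈ ℚ[q].q ^ (2 ℕ.* suc i))
      terms = extend n 0# λ i i<n → inverse-* (unit-^ 3 ([]q-unit i i<n)) (ℚ[q].q ^ (2 ℕ.* suc i))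
        where
        inverse-* : ∀ {g} → IsUnit g → ∀ f → ∃[ α ] (g * α ≈ f)
        inverse-* {g} (unit v gv) f = v * f , trans (sym (*-assoc g v f)) (trans (*-congʳ gv) (*-identityˡ f))

    z : ℕ → Carrier
    z = proj₁ terms

    represents-term : ∀ (i : Fin n) → Represents (term 3 i) (z (toℕ i))
    represents-term i = fraction (unit-^ 3 ([]q-unit (toℕ i) (Fin.toℕ<n i)))
      (trans (proj₂ terms (toℕ i) (Fin.toℕ<n i)) (reflexive (^≡ ℚ[q].q (2 ℕ.* suc (toℕ i)))))

    represents-product : ∀ {l} (v : Vec (Fin n) l) →
      Represents (Vec.foldr′ ℚ⟨q⟩._*_ ℚ⟨q⟩.1ᵣ (Vec.zipWith term (replicate l 3) v)) (∏ᵛ z v)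
    represents-product []      = represents-1
    represents-product (i ∷ v) = fraction-* (represents-term i) (represents-product v)

    represents-sum : ∀ {A : Set} (F : A → RatFun) (f : A → Carrier) → (∀ x → Represents (F x) (f x)) →
      ∀ xs → Represents (List.foldr ℚ⟨q⟩._+_ ℚ⟨q⟩.0ᵣ (List.map F xs)) (∑ xs f)
    represents-sum F f rep []       = represents-0
    represents-sum F f rep (x ∷ xs) = fraction-+ (rep x) (represents-sum F f rep xs)

    represents-H : ∀ t → Represents (H n (replicate t 3)) (elemSym n z t)
    represents-H t = fraction-cong (∑-increasingTuples n t z)
      (represents-sum _ (∏ᵛ z) represents-product (increasingTuples n t))

    1-q-unit : IsUnit (1# - ℚ[q].q)
    1-q-unit = 1-ω-unit n pr ℚ[q].q q-root

    represents-÷ : ∀ {A α} t {{nonZero : ℚ[q].NonZero (1-q ℚ[q].^ t)}} → Represents A α →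
      Represents (A ℚ⟨q⟩.÷ 1-q ℚ[q].^ t) (α * IsUnit.inverse 1-q-unit ^ t)
    represents-÷ {f / g} {α} t rep =
      ≡.subst (λ h → IsFraction f (g * h) (α * IsUnit.inverse 1-q-unit ^ t))
        (^≡ 1-q t) (fraction-÷ rep (unit-^ t 1-q-unit))

    lhs-value : ∀ t → t < p → # (suc t) * (# p * # p) * (elemSym n z t * IsUnit.inverse 1-q-unit ^ (3 ℕ.* t)) ≈
      B.binomial (# p + # t + # t + 1#) (2 ℕ.+ t ℕ.* 3) + B.binomial (- # p + # t + # t + 1#) (2 ℕ.+ t ℕ.* 3)
    lhs-value = cyclotomic-sum n pr ℚ[q].q q-root z λ i i<n →
      trans (*-congʳ (^-congˡ 3 (sym ([]q-geometric (suc i))))) (proj₂ terms i i<n)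

-- Clearing denominators

module Integrality where

  open CommutativeRing PolynomialRing.commutativeRing hiding (zero)
  open ℚ[q] using (Poly; coeff-≈; mk≈)
  open ≡.≡-Reasoning

  ι-+ : ∀ f g → ι (f ℤ[q].+ g) ≡ ι f + ι g
  ι-+ []      g       = ≡.refl
  ι-+ (a ∷ f) []      = ≡.refl
  ι-+ (a ∷ f) (b ∷ g) = ≡.cong₂ _∷_ (/1-+ a b) (ι-+ f g)

  ι-· : ∀ a f → ι (List.map (a ℤ.*_) f) ≡ List.map ((a ℚ./ 1) ℚ.*_) (ι f)
  ι-· a []      = ≡.refl
  ι-· a (b ∷ f) = ≡.cong₂ _∷_ (/1-* a b) (ι-· a f)

  ι-* : ∀ f g → ι (f ℤ[q].* g) ≡ ι f * ι g
  ι-* []      g = ≡.refl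
  ι-* (a ∷ f) g = ≡.trans (ι-+ (List.map (a ℤ.*_) g) (+ 0 ∷ f ℤ[q].* g))
    (≡.cong₂ (λ u v → u + (0ℚ ∷ v)) (ι-· a g) (ι-* f g))

  ι-[]q : ∀ n → ι ℤ[q].[ n ]q ≡ ℚ[q].[ n ]q
  ι-[]q n = map-replicate (ℚ._/ 1) n (+ 1)

  const-* : ∀ c f → (c ∷ []) * f ≈ List.map (c ℚ.*_) f
  const-* c f = mk≈ λ k → ≡.trans (coeff-∷* c [] f k) (≡.trans (≡.cong (λ x → c ℚ.* ℚ[q].coeff f k ℚ.+ x) (zeros k))
    (≡.trans (ℚ.+-identityʳ _) (≡.sym (coeff-map* c f k))))
    where
    zeros : ∀ k → ℚ[q].coeff (0ℚ ∷ []) k ≡ 0ℚ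
    zeros zero    = ≡.refl
    zeros (suc _) = ≡.refl

  -- A common multiple of the denominators of the coefficients, in general not the least one.
  denominator : Poly → ℕ
  denominator []      = 1
  denominator (c ∷ f) = ℚ.↧ₙ c ℕ.* denominator f

  denominator≢0 : ∀ f → NonZero (denominator f)
  denominator≢0 []      = _
  denominator≢0 (c ∷ f) = m*n≢0 (ℚ.↧ₙ c) (denominator f) {{_}} {{denominator≢0 f}}

  -- f multiplied by `denominator f`: the head already loses its own denominator and is scaled by
  -- the remaining ones, the tail by that of the head.
  numerator : Poly → ℤ[q].Poly
  numerator []      = []
  numerator (c ∷ f) = + denominator f ℤ.* ℚ.↥ c ∷ List.map (+ ℚ.↧ₙ c ℤ.*_) (numerator f)

  ι-numerator-map : ∀ f → ι (numerator f) ≡ List.map ((+ denominator f ℚ./ 1) ℚ.*_) f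
  ι-numerator-map []      = ≡.refl
  ι-numerator-map (c ∷ f) = ≡.cong₂ _∷_ head tail
    where
    d = ℚ.↧ₙ c
    N = denominator f
    dN : + (d ℕ.* N) ℚ./ 1 ≡ (+ d ℚ./ 1) ℚ.* (+ N ℚ./ 1)
    dN = ≡.trans (≡.cong (ℚ._/ 1) (ℤ.pos-* d N)) (/1-* (+ d) (+ N))
    head : (+ N ℤ.* ℚ.↥ c) ℚ./ 1 ≡ (+ (d ℕ.* N) ℚ./ 1) ℚ.* c
    head = begin
      (+ N ℤ.* ℚ.↥ c) ℚ./ 1                             ≡⟨ /1-* (+ N) (ℚ.↥ c) ⟩
      (+ N ℚ./ 1) ℚ.* (ℚ.↥ c ℚ./ 1)                     ≡⟨ ≡.cong ((+ N ℚ./ 1) ℚ.*_) (n/1*i/n≡i/1 (ℚ.↥ c) d) ⟨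
      (+ N ℚ./ 1) ℚ.* ((+ d ℚ./ 1) ℚ.* (ℚ.↥ c ℚ./ d))   ≡⟨ ≡.cong (λ x → (+ N ℚ./ 1) ℚ.* ((+ d ℚ./ 1) ℚ.* x)) (ℚ.↥p/↧p≡p c) ⟩
      (+ N ℚ./ 1) ℚ.* ((+ d ℚ./ 1) ℚ.* c)               ≡⟨ ℚ.*-assoc (+ N ℚ./ 1) (+ d ℚ./ 1) c ⟨
      (+ N ℚ./ 1) ℚ.* (+ d ℚ./ 1) ℚ.* c                 ≡⟨ ≡.cong (ℚ._* c) (ℚ.*-comm (+ N ℚ./ 1) (+ d ℚ./ 1)) ⟩
      (+ d ℚ./ 1) ℚ.* (+ N ℚ./ 1) ℚ.* c                 ≡⟨ ≡.cong (ℚ._* c) dN ⟨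
      (+ (d ℕ.* N) ℚ./ 1) ℚ.* c                         ∎
    tail : ι (List.map (+ d ℤ.*_) (numerator f)) ≡ List.map ((+ (d ℕ.* N) ℚ./ 1) ℚ.*_) f
    tail = begin
      ι (List.map (+ d ℤ.*_) (numerator f))             ≡⟨ ι-· (+ d) (numerator f) ⟩
      List.map ((+ d ℚ./ 1) ℚ.*_) (ι (numerator f))     ≡⟨ ≡.cong (List.map ((+ d ℚ./ 1) ℚ.*_)) (ι-numerator-map f) ⟩
      List.map ((+ d ℚ./ 1) ℚ.*_) (List.map ((+ N ℚ./ 1) ℚ.*_) f) ≡⟨ map-∘ f ⟨
      List.map (λ x → (+ d ℚ./ 1) ℚ.* ((+ N ℚ./ 1) ℚ.* x)) f
        ≡⟨ map-cong (λ x → ≡.trans (≡.sym (ℚ.*-assoc (+ d ℚ./ 1) (+ N ℚ./ 1) x)) (≡.cong (ℚ._* x) (≡.sym dN))) f ⟩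
      List.map ((+ (d ℕ.* N) ℚ./ 1) ℚ.*_) f             ∎

  ι-numerator : ∀ f → ι (numerator f) ≈ (+ denominator f ℚ./ 1 ∷ []) * f
  ι-numerator f = trans (reflexive (ι-numerator-map f)) (sym (const-* (+ denominator f ℚ./ 1) f))

  const-nonZero : ∀ k .{{_ : NonZero k}} → ℚ[q].NonZero (+ k ℚ./ 1 ∷ [])
  const-nonZero k = ℚ[q].mkNonZero λ eq → ℚ.1≢0 (≡.trans (≡.sym (n/1*i/n≡i/1 (+ 1) k))
    (≡.trans (≡.cong (ℚ._* (+ 1 ℚ./ k)) (coeff-≈ eq 0)) (ℚ.*-zeroˡ (+ 1 ℚ./ k))))

-- From equal residues to the congruence over ℤ[q]

module Congruence (n : ℕ) where

  open Residues n
  private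
    module P = CommutativeRing PolynomialRing.commutativeRing
    module K = CommutativeRing K
    m = ℚ[q].[ p ]q
  open Integrality
  open Evaluation K using (IsUnit; unit; unit-*)
  open Fractions K using (IsFraction; fraction-difference)
  open IntegerSolver PolynomialRing.commutativeRing using (solve; _:=_; _:+_; _:*_; _:-_)
  open import Relation.Binary.Reasoning.Setoid P.setoid

  -- An inverse modulo m is a Bézout relation f u - m h = 1, so a common divisor of f and m divides
  -- 1.
  unit⇒coprime : ∀ {f} → IsUnit f → ℚ[q].Coprime f m
  unit⇒coprime {f} (unit u (mod h fu≈1+mh)) {w} w∣f w∣m = record
    { quotient = f/w P.* u P.- m/w P.* h
    ; equality = begin
        (f/w P.* u P.- m/w P.* h) P.* w
          ≈⟨ solve 5 (λ a b u h w → (a :* u :- b :* h) :* w := (a :* w) :* u :- (b :* w) :* h) P.refl f/w m/w u h w ⟩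
        f/w P.* w P.* u P.- m/w P.* w P.* h
          ≈⟨ P.+-cong (P.*-congʳ (_∣ʳ_.equality w∣f)) (P.-‿cong (P.*-congʳ (_∣ʳ_.equality w∣m))) ⟩
        f P.* u P.- m P.* h
          ≈⟨ P.+-congʳ fu≈1+mh ⟩
        P.1# P.+ m P.* h P.- m P.* h
          ≈⟨ solve 2 (λ o x → o :+ x :- x := o) P.refl P.1# (m P.* h) ⟩
        P.1#
          ∎
    }
    where
    open import Algebra.Definitions.RawMagma P.*-rawMagma using (_∣ʳ_)
    f/w = _∣ʳ_.quotient w∣f
    m/w = _∣ʳ_.quotient w∣m

  φ-#-unit : ∀ k .{{_ : NonZero k}} → IsUnit (+ k ℚ./ 1 ∷ [])
  φ-#-unit k = unit (φ (+ 1 ℚ./ k)) (K.trans (K.*-congʳ (φ-# k)) (#-*-φ k))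

  private
    -- The fraction m h / g is expanded by the denominators of both g and h, which makes both parts
    -- integral. The factor [p]_q is kept explicit, for divisibility must hold in ℤ[q].
    numerator-* denominator-* : (g h : ℚ[q].Poly) → ℤ[q].Poly
    numerator-*   g h = (+ denominator g ∷ []) ℤ[q].* numerator h ℤ[q].* ℤ[q].[ p ]q
    denominator-* g h = (+ denominator h ∷ []) ℤ[q].* numerator g

    c : ℚ[q].Poly → ℚ[q].Poly
    c f = + denominator f ℚ./ 1 ∷ []

    ι-numerator-* : ∀ g h → ι (numerator-* g h) P.≈ c g P.* (c h P.* h) P.* m
    ι-numerator-* g h = begin
      ι (numerator-* g h)
        ≡⟨ ι-* ((+ denominator g ∷ []) ℤ[q].* numerator h) ℤ[q].[ p ]q ⟩
      ι ((+ denominator g ∷ []) ℤ[q].* numerator h) P.* ι ℤ[q].[ p ]q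
        ≡⟨ ≡.cong₂ P._*_ (ι-* (+ denominator g ∷ []) (numerator h)) (ι-[]q p) ⟩
      c g P.* ι (numerator h) P.* m
        ≈⟨ P.*-congʳ {m} (P.*-congˡ {c g} (ι-numerator h)) ⟩
      c g P.* (c h P.* h) P.* m
        ∎

    ι-denominator-* : ∀ g h → ι (denominator-* g h) P.≈ c h P.* (c g P.* g)
    ι-denominator-* g h = begin
      ι (denominator-* g h)       ≡⟨ ι-* (+ denominator h ∷ []) (numerator g) ⟩
      c h P.* ι (numerator g)     ≈⟨ P.*-congˡ {c h} (ι-numerator g) ⟩
      c h P.* (c g P.* g)         ∎

    cross : ∀ f g h → f P.≈ P.0# P.+ m P.* h →
            f P.* ι (denominator-* g h) P.≈ ι (numerator-* g h) P.* g
    cross f g h f≈mh = begin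
      f P.* ι (denominator-* g h)             ≈⟨ P.*-cong (P.trans f≈mh (P.+-identityˡ (m P.* h))) (ι-denominator-* g h) ⟩
      m P.* h P.* (c h P.* (c g P.* g))       ≈⟨ rearrange m h (c g) (c h) g ⟩
      c g P.* (c h P.* h) P.* m P.* g         ≈⟨ P.*-congʳ {g} (ι-numerator-* g h) ⟨
      ι (numerator-* g h) P.* g               ∎
      where
      rearrange : ∀ m h a b g → m P.* h P.* (b P.* (a P.* g)) P.≈ a P.* (b P.* h) P.* m P.* g
      rearrange = solve 5 (λ m h a b g → m :* h :* (b :* (a :* g)) := a :* (b :* h) :* m :* g) P.refl

    denominator-*-unit : ∀ g h → IsUnit g → IsUnit (ι (denominator-* g h))
    denominator-*-unit g h g-unit = Evaluation.unit-cong K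
      (K.sym (PrincipalQuotient.≈⇒≋ PolynomialRing.commutativeRing m (ι-denominator-* g h)))
      (unit-* (φ-#-unit (denominator h) {{denominator≢0 h}}) (unit-* (φ-#-unit (denominator g) {{denominator≢0 g}}) g-unit))

    denominator-*-nonZero : ∀ g h → ℚ[q].NonZero g → ℚ[q].NonZero (ι (denominator-* g h))
    denominator-*-nonZero g h g≢0 = ℚ[q].mkNonZero λ ιg′≈0 → ℚ[q].NonZero.≉0
      (*-nonZero (c h) (c g P.* g) {{const-nonZero _ {{denominator≢0 h}}}}
        {{*-nonZero (c g) g {{const-nonZero _ {{denominator≢0 g}}}} {{g≢0}}}})
      (P.trans (P.sym (ι-denominator-* g h)) ιg′≈0)

  multiple⇒mod : ∀ (A B : RatFun) → IsUnit (RatFun.den (A ℚ⟨q⟩.- B)) → RatFun.num (A ℚ⟨q⟩.- B) K.≈ K.0# →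
                 A ≡ B mod[ ℤ[q].[ p ]q ]
  multiple⇒mod A B den-unit (mod h num≈0) =
      numerator-* g h , denominator-* g h , denominator-*-nonZero g h (RatFun.den≉0 (A ℚ⟨q⟩.- B))
    , cross f g h num≈0
    , ≡.subst (ℚ[q].Coprime (ι (denominator-* g h))) (≡.sym (ι-[]q p)) (unit⇒coprime (denominator-*-unit g h den-unit))
    , record { quotient = (+ denominator g ∷ []) ℤ[q].* numerator h ; equality = ℤ[q].mk≈ λ _ → ≡.refl }
    where
    f = RatFun.num (A ℚ⟨q⟩.- B)
    g = RatFun.den (A ℚ⟨q⟩.- B)

  -- Equal residues make the numerator of A - B a multiple of [p]_q, while its denominator is a
  -- product of units.
  residue⇒mod : ∀ (A B : RatFun) {α β} → Represents A α → Represents B β → α K.≈ β → A ≡ B mod[ ℤ[q].[ p ]q ]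
  residue⇒mod A B repA repB α≈β = multiple⇒mod A B
    (unit-* (IsFraction.den-unit repA) (IsFraction.den-unit repB)) (fraction-difference repA repB α≈β)

open import Data.Nat.Base using (_+_; _*_; _^_)

-- Comparison with the rational binomials, and the theorem

module ClosedForm (n t : ℕ) where

  open Residues n
  private
    module K = CommutativeRing K
  open Evaluation K using (IsUnit; unit-*; unit-cancel)
  open NaturalMultiples K
  open BinomialSums K #-unit using (binomial-cong) renaming (binomial to binomₖ)
  open import Relation.Binary.Reasoning.Setoid K.setoid

  private
    k : ℕ
    k = 3 * t + 2

    α₊ α₋ : ℚ
    α₊ = + (p + 2 * t + 1) ℚ./ 1
    α₋ = (ℤ.- (+ p) ℤ.+ + (2 * t + 1)) ℚ./ 1

  #-2t+1 : ∀ x → x K.+ # (2 * t + 1) K.≈ x K.+ # t K.+ # t K.+ K.1#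
  #-2t+1 x = begin
    x K.+ # (2 * t + 1)             ≡⟨ ≡.cong (λ i → x K.+ # (t + i + 1)) (ℕ.+-identityʳ t) ⟩
    x K.+ # (t + t + 1)             ≈⟨ K.+-congˡ {x} (K.trans (#-+ (t + t) 1) (K.+-cong (#-+ t t) (K.+-identityʳ K.1#))) ⟩
    x K.+ (# t K.+ # t K.+ K.1#)    ≈⟨ K.+-assoc x (# t K.+ # t) K.1# ⟨
    x K.+ (# t K.+ # t) K.+ K.1#    ≈⟨ K.+-congʳ {K.1#} (K.+-assoc x (# t) (# t)) ⟨
    x K.+ # t K.+ # t K.+ K.1#      ∎

  φ-α₊ : φ α₊ K.≈ # p K.+ # t K.+ # t K.+ K.1#
  φ-α₊ = begin
    φ α₊                        ≈⟨ φ-# (p + 2 * t + 1) ⟩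
    # (p + 2 * t + 1)           ≡⟨ ≡.cong # (ℕ.+-assoc p (2 * t) 1) ⟩
    # (p + (2 * t + 1))         ≈⟨ #-+ p (2 * t + 1) ⟩
    # p K.+ # (2 * t + 1)       ≈⟨ #-2t+1 (# p) ⟩
    # p K.+ # t K.+ # t K.+ K.1# ∎

  φ-α₋ : φ α₋ K.≈ K.- # p K.+ # t K.+ # t K.+ K.1#
  φ-α₋ = begin
    φ α₋
      ≈⟨ φ-cong (≡.trans (/1-+ (ℤ.- (+ p)) (+ (2 * t + 1))) (≡.cong (ℚ._+ (+ (2 * t + 1) ℚ./ 1)) (/1-neg (+ p)))) ⟩
    K.- φ (+ p ℚ./ 1) K.+ φ (+ (2 * t + 1) ℚ./ 1)
      ≈⟨ K.+-cong (K.-‿cong (φ-# p)) (φ-# (2 * t + 1)) ⟩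
    K.- # p K.+ # (2 * t + 1)
      ≈⟨ #-2t+1 (K.- # p) ⟩
    K.- # p K.+ # t K.+ # t K.+ K.1#
      ∎

  φ-binom-≈ : ∀ {α β} → φ α K.≈ β → φ (binom α k) K.≈ binomₖ β (2 + t * 3)
  φ-binom-≈ {α} {β} φα≈β = begin
    φ (binom α k)                 ≡⟨ ≡.cong (λ k → φ (binom α k)) (≡.trans (ℕ.+-comm (3 * t) 2) (≡.cong (λ i → suc (suc i)) (ℕ.*-comm 3 t))) ⟩
    φ (binom α (2 + t * 3))       ≈⟨ φ-binom α (2 + t * 3) ⟩
    binomₖ (φ α) (2 + t * 3)      ≈⟨ binomial-cong (2 + t * 3) φα≈β ⟩
    binomₖ β (2 + t * 3)          ∎

  module _ (pr : Prime p) (t<p : t < p) where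

    private
      instance
        d≢0 = m*n≢0 (suc t) (p ^ 2) {{_}} {{m^n≢0 p 2}}

      d = suc t * p ^ 2

      #-d : # d K.≈ # (suc t) K.* (# p K.* # p)
      #-d = begin
        # (suc t * p ^ 2)             ≈⟨ #-* (suc t) (p ^ 2) ⟩
        # (suc t) K.* # (p ^ 2)       ≡⟨ ≡.cong (λ i → # (suc t) K.* # (p * i)) (ℕ.*-identityʳ p) ⟩
        # (suc t) K.* # (p * p)       ≈⟨ K.*-congˡ {# (suc t)} (#-* p p) ⟩
        # (suc t) K.* (# p K.* # p)   ∎

    open Evaluation K using (elemSym) renaming (_^_ to _^ₖ_)

    closed-form : elemSym n (z pr) t K.* IsUnit.inverse (1-q-unit pr) ^ₖ (3 * t) K.≈
                  φ ((+ 1 ℚ./ d) ℚ.* (binom α₊ k ℚ.+ binom α₋ k))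
    -- The sides are compared after multiplication by the unit (t + 1) p², the form in which the
    -- value of the left side is known.
    closed-form = unit-cancel {x = # (suc t) K.* (# p K.* # p)} (unit-* (#-unit t) (unit-* (#-unit n) (#-unit n))) (begin
      # (suc t) K.* (# p K.* # p) K.* (elemSym n (z pr) t K.* IsUnit.inverse (1-q-unit pr) ^ₖ (3 * t))
        ≈⟨ lhs-value pr t t<p ⟩
      binomₖ (# p K.+ # t K.+ # t K.+ K.1#) (2 + t * 3) K.+ binomₖ (K.- # p K.+ # t K.+ # t K.+ K.1#) (2 + t * 3)
        ≈⟨ K.+-cong (φ-binom-≈ φ-α₊) (φ-binom-≈ φ-α₋) ⟨
      φ (binom α₊ k ℚ.+ binom α₋ k)
        ≈⟨ K.*-identityˡ (φ b) ⟨
      K.1# K.* φ b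
        ≈⟨ K.*-congʳ {φ b} (#-*-φ d) ⟨
      # d K.* φ (+ 1 ℚ./ d) K.* φ b
        ≈⟨ K.*-assoc (# d) (φ (+ 1 ℚ./ d)) (φ b) ⟩
      # d K.* (φ (+ 1 ℚ./ d) K.* φ b)
        ≈⟨ K.*-cong #-d (K.sym (φ-* (+ 1 ℚ./ d) b)) ⟩
      # (suc t) K.* (# p K.* # p) K.* φ ((+ 1 ℚ./ d) ℚ.* b)
        ∎)
      where b = binom α₊ k ℚ.+ binom α₋ k

theorem5p1 : ∀ (t : ℕ) → .{{NonZero t}} → ∀ (p : ℕ) (pr : Prime p) → t < p →
    let instance
          p≢0 = prime⇒nonZero pr
          p²≢0 = m^n≢0 p 2
          d≢0 = m*n≢0 (ℕ.suc t) (p ^ 2)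
          e≢0 = ^-nonZero 1-q (3 * t)
    in
    (H (p ∸ 1) (replicate t 3) ℚ⟨q⟩.÷ 1-q ℚ[q].^ (3 * t))
      ≡ ℚ⟨q⟩.const
          ((+ 1 ℚ./ (ℕ.suc t * p ^ 2)) ℚ.*
            (binom ((+ (p + 2 * t + 1)) ℚ./ 1) (3 * t + 2) ℚ.+
             binom ((ℤ.- (+ p) ℤ.+ + (2 * t + 1)) ℚ./ 1) (3 * t + 2)))
      mod[ ℤ[q].[ p ]q ]
-- `t < p` rules out p = 0, and for p = n + 1 the bound p ∸ 1 computes to n.
theorem5p1 t (suc n) pr t<p = residue⇒mod
  (H n (replicate t 3) ℚ⟨q⟩.÷ 1-q ℚ[q].^ (3 * t)) (ℚ⟨q⟩.const c)
  (represents-÷ pr {H n (replicate t 3)} (3 * t) (represents-H pr t)) (represents-const c)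
  (ClosedForm.closed-form n t pr t<p)
  where
  open Residues n
  open Congruence n
  instance
    d≢0 = m*n≢0 (suc t) (suc n ^ 2) {{_}} {{m^n≢0 (suc n) 2}}
    e≢0 = ^-nonZero 1-q (3 * t)
  c : ℚ
  c = (+ 1 ℚ./ (suc t * suc n ^ 2)) ℚ.*
    (binom (+ (suc n + 2 * t + 1) ℚ./ 1) (3 * t + 2) ℚ.+
     binom ((ℤ.- (+ suc n) ℤ.+ + (2 * t + 1)) ℚ./ 1) (3 * t + 2))
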